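{- Let $G$ be a square, triangular or hexagonal lattice with $N$ vertices. Let $\tau^b$ be an optimal stopping time for the blind game on $G$, let $\tau^f$ be an optimal stopping time for the full information game on $G$, and put $c^b=\frac1N\mathbb{E}[\tilde{C}_{\tau^b}]$ and $c^f=\frac1N\mathbb{E}[\tilde{C}_{\tau^f}]$. Then for all sufficiently large $N$: \[ 0.12953\le c^b\le 0.13268 \quad\text{if } G \text{ is the square lattice}, \] \[ 0.09629\le c^b\le 0.10107 \quad\text{if } G \text{ is the triangular lattice}, \] \[ 0.16738\le c^b\le 0.17144 \quad\text{if } G \text{ is the hexagonal lattice}. \] Furthermore, for every $\varepsilon\in(0,1)$ and all sufficiently large $N$ (depending on $\varepsilon$), $c^b\le c^f\le c^b+\varepsilon$.
   Context: Lattices. The square lattice on $N=n^2$ vertices has vertex set $\{1,\ldots,n\}^2$, two vertices being adjacent iff they are at Euclidean distance $1$. The triangular lattice on $N=n^2$ vertices has vertex set $\{1,\ldots,n\}^2$, with $(i,j)$ adjacent to $(i+1,j)$, $(i,j+1)$ and $(i+1,j-1)$ whenever these belong to the vertex set (and no other edges). The hexagonal lattice with parameter $m\ge1$: take the regular hexagons of side length $1$ with two horizontal sides, centred at $\left(\tfrac32 j,\ \sqrt3\,(i+\tfrac12(j\bmod 2))\right)$ for $0\le j\le m-1$, where $0\le i\le m-1$ if $j$ is even and $0\le i\le m-2$ if $j$ is odd; the vertices are the corners and the edges are the sides of these hexagons, and $N$ is the number of vertices. Games. Let $G=(V,E)$ be a graph with $|V|=N$. Let $\mathcal{S}$ be the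 set of all permutations $\sigma=(\sigma_1,\ldots,\sigma_N)$ of $V$ with the uniform probability measure. For $t\in\{1,\ldots,N\}$, $\tilde{G}_t(\sigma)$ is the subgraph of $G$ induced by $\{\sigma_1,\ldots,\sigma_t\}$, and $\tilde{C}_t(\sigma)$ is its number of connected components. Given a filtration $\mathcal{P}_1\subseteq\cdots\subseteq\mathcal{P}_N$ of $\sigma$-algebras of subsets of $\mathcal{S}$, a stopping time is a function $\tau:\mathcal{S}\to\{1,\ldots,N\}$ with $\tau^{ -1}(t)\in\mathcal{P}_t$ for all $t$; $\mathbb{E}[\tilde{C}_\tau]=\frac{1}{N!}\sum_{\sigma\in\mathcal{S}}\tilde{C}_{\tau(\sigma)}(\sigma)$; and $\tau$ is optimal if it maximizes $\mathbb{E}[\tilde{C}_\tau]$ among all stopping times for the given filtration. Blind game: $\mathcal{P}_t=\{\emptyset,\mathcal{S}\}$ for every $t$ (so stopping times are constants). Full information game: $\mathcal{P}_t$ consists of all $A\subseteq\mathcal{S}$ such that whenever $\sigma\in A$ and $\pi\in\mathcal{S}$ satisfies $\pi_i=\sigma_i$ for all $i\le t$, then $\pi\in A$. -}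

module Defs where

open import Algebra.Bundles using (AbelianGroup)
open import Algebra.Properties.Group using (∙-cancelˡ)
open import Data.Fin.Base as Fin using (Fin; toℕ)
open import Data.Fin.Properties using (toℕ<n)
import Data.Fin.Properties as Fin
open import Data.Integer.Base as ℤ using (ℤ; +_; -_)
import Data.Integer.Properties as ℤ
open import Data.Irrelevant using ([_])
open import Data.List.Base
  using (List; []; _∷_; _++_; allFin; applyUpTo; cartesianProduct;
         cartesianProductWith; concatMap; deduplicate; drop; length; lookup;
         map; mapMaybe; take; upTo; zip)
open import Data.List.Membership.Propositional using (_∈_)
open import Data.List.Membership.Propositional.Properties using (∈-allFin)
open import Data.List.Relation.Unary.All as All using (All; []; _∷_)
open import Data.List.Relation.Unary.Any as Any using (Any; here; there; any?)
open import Data.Maybe.Base using (Maybe; just; nothing)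
open import Data.Nat.Base as ℕ using (ℕ; zero; suc; NonZero; _!; ∣_-_∣)
open import Data.Nat.ListAction using (sum)
open import Data.Nat.DivMod using (_%_)
import Data.Nat.Properties as ℕ
open import Data.Product.Base using (∃; _×_; _,_; proj₁)
open import Data.Product.Properties using (≡-dec)
open import Data.Rational.Base as ℚ using (ℚ)
open import Data.Refinement.Base using (Refinement-syntax; _,_; value)
open import Data.Sum.Base as Sum using (_⊎_; inj₁; inj₂)
open import Data.Vec.Base as Vec using (Vec; []; _∷_)
open import Data.Vec.Relation.Unary.AllPairs using (allPairs?)
open import Data.Vec.Relation.Unary.Unique.Propositional using (Unique)
open import Function.Base using (_on_)
open import Level using (0ℓ)
open import Relation.Binary.Construct.Closure.ReflexiveTransitive
  using (Star; ε; _◅_; _◅◅_)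
open import Relation.Binary.Construct.Closure.Symmetric as Sym
  using (SymClosure; fwd; bwd)
open import Relation.Binary.Core using (Rel)
open import Relation.Binary.Definitions using (Decidable; Symmetric)
open import Relation.Binary.PropositionalEquality
  using (_≡_; _≢_; refl; sym; trans; cong; cong₂)
open import Relation.Nullary.Decidable
  using (yes; no; map′; ¬?; _⊎-dec_; _×-dec_)
open import Relation.Nullary.Negation.Core using (¬_)
open import Relation.Unary using (Pred; ∅; U; ∁; _∪_; _≐_)

record Graph : Set₁ where
  field
    order : ℕ

  Vertex : Set
  Vertex = Fin order

  field
    Adj    : Rel Vertex 0ℓ
    adj?   : Decidable Adj
    symm   : Symmetric Adj
    irrefl : ∀ {u} → ¬ Adj u u

module Components (G : Graph) where
  open Graph G

  Connected : Rel Vertex 0ℓ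
  Connected = Star Adj

  private
    -- Reach xs u v: some walk from u to v has all its interior vertices in xs
    -- (Warshall's recursion).
    Reach : List Vertex → Rel Vertex 0ℓ
    Reach []       u v = u ≡ v ⊎ Adj u v
    Reach (x ∷ xs) u v = Reach xs u v ⊎ (Reach xs u x × Reach xs x v)

    reach? : ∀ xs → Decidable (Reach xs)
    reach? []       u v = (u Fin.≟ v) ⊎-dec adj? u v
    reach? (x ∷ xs) u v = reach? xs u v ⊎-dec (reach? xs u x ×-dec reach? xs x v)

    sound : ∀ xs {u v} → Reach xs u v → Connected u v
    sound []       (inj₁ refl)    = ε
    sound []       (inj₂ a)       = a ◅ ε
    sound (x ∷ xs) (inj₁ p)       = sound xs p
    sound (x ∷ xs) (inj₂ (p , q)) = sound xs p ◅◅ sound xs q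

    base : ∀ xs {u v} → u ≡ v ⊎ Adj u v → Reach xs u v
    base []       p = p
    base (x ∷ xs) p = inj₁ (base xs p)

    to-head : ∀ x xs {u} → Reach (x ∷ xs) u x → Reach xs u x
    to-head x xs (inj₁ p)       = p
    to-head x xs (inj₂ (p , _)) = p

    from-head : ∀ x xs {v} → Reach (x ∷ xs) x v → Reach xs x v
    from-head x xs (inj₁ p)       = p
    from-head x xs (inj₂ (_ , q)) = q

    through : ∀ xs {u x v} → x ∈ xs → Reach xs u x → Reach xs x v → Reach xs u v
    through (x ∷ xs) (here refl) p q = inj₂ (to-head x xs p , from-head x xs q)
    through (y ∷ xs) (there x∈) (inj₁ p) (inj₁ q) = inj₁ (through xs x∈ p q)
    through (y ∷ xs) (there x∈) (inj₁ p) (inj₂ (q , r)) = inj₂ (through xs x∈ p q , r)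
    through (y ∷ xs) (there x∈) (inj₂ (p , q)) (inj₁ r) = inj₂ (p , through xs x∈ q r)
    through (y ∷ xs) (there x∈) (inj₂ (p , _)) (inj₂ (_ , r)) = inj₂ (p , r)

    complete : ∀ {u v} → Connected u v → Reach (allFin order) u v
    complete ε       = base _ (inj₁ refl)
    complete (a ◅ p) = through _ (∈-allFin _) (base _ (inj₂ a)) (complete p)

  connected? : Decidable Connected
  connected? u v = map′ (sound _) complete (reach? (allFin order) u v)

  -- `deduplicate` keeps exactly one vertex of each class of `Connected`.
  components : ℕ
  components = length (deduplicate connected? (allFin order))

open Components public using (Connected; components)

-- For a repetition-free us, the subgraph induced by its entries, with the
-- vertex us_i renamed i.
induced : (G : Graph) {t : ℕ} → Vec (Graph.Vertex G) t → Graph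
induced G {t} us = record
  { order  = t
  ; Adj    = Adj on Vec.lookup us
  ; adj?   = λ i j → adj? (Vec.lookup us i) (Vec.lookup us j)
  ; symm   = symm
  ; irrefl = irrefl
  } where open Graph G

-- The graph on the points of a repetition-free list.
graphOn : {A : Set} (vs : List A) (R : Rel A 0ℓ) → Decidable R → Symmetric R →
          (∀ {a} → ¬ R a a) → Graph
graphOn vs R R? R-sym R-irr = record
  { order  = length vs
  ; Adj    = R on lookup vs
  ; adj?   = λ i j → R? (lookup vs i) (lookup vs j)
  ; symm   = R-sym
  ; irrefl = R-irr
  }

private
  symClosure? : {A : Set} {R : Rel A 0ℓ} → Decidable R → Decidable (SymClosure R)
  symClosure? R? a b = map′ Sum.[ fwd , bwd ]
                            (λ { (fwd p) → inj₁ p ; (bwd p) → inj₂ p })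
                            (R? a b ⊎-dec R? b a)

  symClosure-irrefl : {A : Set} {R : Rel A 0ℓ} → (∀ {a} → ¬ R a a) →
                      ∀ {a} → ¬ SymClosure R a a
  symClosure-irrefl irr (fwd p) = irr p
  symClosure-irrefl irr (bwd p) = irr p

grid : ℕ → List (ℕ × ℕ)
grid n = cartesianProduct (applyUpTo suc n) (applyUpTo suc n)

dist² : ℕ × ℕ → ℕ × ℕ → ℕ
dist² (i , j) (k , l) = ∣ i - k ∣ ℕ.^ 2 ℕ.+ ∣ j - l ∣ ℕ.^ 2

UnitDistance : Rel (ℕ × ℕ) 0ℓ
UnitDistance p q = dist² p q ≡ 1

private
  dist²-comm : ∀ p q → dist² p q ≡ dist² q p
  dist²-comm (i , j) (k , l) =
    cong₂ (λ a b → a ℕ.^ 2 ℕ.+ b ℕ.^ 2) (ℕ.∣-∣-comm i k) (ℕ.∣-∣-comm j l)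

  unitDistance-irrefl : ∀ {p} → ¬ UnitDistance p p
  unitDistance-irrefl {i , j} eq
    rewrite ℕ.∣n-n∣≡0 i | ℕ.∣n-n∣≡0 j with () ← eq

square : ℕ → Graph
square n = graphOn (grid n) UnitDistance (λ p q → dist² p q ℕ.≟ 1)
  (λ {p} {q} → trans (dist²-comm q p)) (λ {p} → unitDistance-irrefl {p})

data TriangularStep : Rel (ℕ × ℕ) 0ℓ where
  right     : ∀ {i j} → TriangularStep (i , j) (suc i , j)
  up        : ∀ {i j} → TriangularStep (i , j) (i , suc j)
  rightDown : ∀ {i j} → TriangularStep (i , suc j) (suc i , j)

private
  triangularStep? : Decidable TriangularStep
  triangularStep? (i , j) (k , l)
    with (k ℕ.≟ suc i) ×-dec (l ℕ.≟ j)
  ... | yes (refl , refl) = yes right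
  ... | no ¬right with (k ℕ.≟ i) ×-dec (l ℕ.≟ suc j)
  ...   | yes (refl , refl) = yes up
  ...   | no ¬up with (k ℕ.≟ suc i) ×-dec (j ℕ.≟ suc l)
  ...     | yes (refl , refl) = yes rightDown
  ...     | no ¬rightDown = no λ
    { right     → ¬right (refl , refl)
    ; up        → ¬up (refl , refl)
    ; rightDown → ¬rightDown (refl , refl)
    }

  triangularStep-irrefl′ : ∀ {p q} → p ≡ q → ¬ TriangularStep p q
  triangularStep-irrefl′ () right
  triangularStep-irrefl′ () up
  triangularStep-irrefl′ () rightDown

triangular : ℕ → Graph
triangular n = graphOn (grid n) (SymClosure TriangularStep)
  (symClosure? triangularStep?) (Sym.symmetric _)
  (symClosure-irrefl (triangularStep-irrefl′ refl))

-- The point (x , y) stands for (x/2 , √3y/2) in the plane.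
Point : Set
Point = ℤ × ℤ

infixl 6 _⊕_
_⊕_ : Point → Point → Point
(a , b) ⊕ (c , d) = (a ℤ.+ c) , (b ℤ.+ d)

_≟ᴾ_ : Decidable {A = Point} _≡_
_≟ᴾ_ = ≡-dec ℤ._≟_ ℤ._≟_

centres : ℕ → List Point
centres m = concatMap
  (λ j → map (λ i → + (3 ℕ.* j) , + (2 ℕ.* i ℕ.+ j % 2)) (upTo (m ℕ.∸ j % 2)))
  (upTo m)

cornerOffsets : List Point
cornerOffsets = (+ 2 , + 0) ∷ (+ 1 , + 1) ∷ (- + 1 , + 1)
              ∷ (- + 2 , + 0) ∷ (- + 1 , - + 1) ∷ (+ 1 , - + 1) ∷ []

corners : Point → List Point
corners c = map (c ⊕_) cornerOffsets

sides : Point → List (Point × Point)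
sides c = zip (corners c) (drop 1 (corners c) ++ take 1 (corners c))

HexagonalSide : ℕ → Rel Point 0ℓ
HexagonalSide m p q = Any (λ c → (p , q) ∈ sides c) (centres m)

private
  hexagonalSide? : ∀ m → Decidable (HexagonalSide m)
  hexagonalSide? m p q =
    any? (λ c → any? (≡-dec _≟ᴾ_ _≟ᴾ_ (p , q)) (sides c)) (centres m)

  ⊕-≢ : ∀ c {d e} → proj₁ d ≢ proj₁ e → c ⊕ d ≢ c ⊕ e
  ⊕-≢ (x , y) d≢e eq = d≢e (∙-cancelˡ (AbelianGroup.group ℤ.+-0-abelianGroup) x _ _ (cong proj₁ eq))

  sides-proper : ∀ c → All (λ (p , q) → p ≢ q) (sides c)
  sides-proper c =
    ⊕-≢ c (λ ()) ∷ ⊕-≢ c (λ ()) ∷ ⊕-≢ c (λ ()) ∷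
    ⊕-≢ c (λ ()) ∷ ⊕-≢ c (λ ()) ∷ ⊕-≢ c (λ ()) ∷ []

  hexagonalSide-irrefl : ∀ m {p} → ¬ HexagonalSide m p p
  hexagonalSide-irrefl m p∈ with Any.satisfied p∈
  ... | c , pp∈ = All.lookup (sides-proper c) pp∈ refl

hexagonal : ℕ → Graph
hexagonal m = graphOn (deduplicate _≟ᴾ_ (concatMap corners (centres m)))
  (SymClosure (HexagonalSide m)) (symClosure? (hexagonalSide? m))
  (Sym.symmetric _) (symClosure-irrefl (hexagonalSide-irrefl m))

data Lattice : Set where
  squareL triangularL hexagonalL : Lattice

lattice : Lattice → ℕ → Graph
lattice squareL     = square
lattice triangularL = triangular
lattice hexagonalL  = hexagonal

module Game (G : Graph) where
  open Graph G renaming (order to N)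

  𝒮 : Set
  𝒮 = [ σ ∈ Vec Vertex N ∣ Unique σ ]

  words : ∀ k → List (Vec Vertex k)
  words zero    = [] ∷ []
  words (suc k) = cartesianProductWith _∷_ (allFin N) (words k)

  asPermutation : Vec Vertex N → Maybe 𝒮
  asPermutation σ with allPairs? (λ u v → ¬? (u Fin.≟ v)) σ
  ... | yes σ! = just (σ , [ σ! ])
  ... | no  _  = nothing

  permutations : List 𝒮
  permutations = mapMaybe asPermutation (words N)

  -- The index t : Time stands for the time toℕ t + 1 in {1,…,N}.
  Time : Set
  Time = Fin N

  G̃ : Time → 𝒮 → Graph
  G̃ t σ = induced G (Vec.truncate (toℕ<n t) (value σ))

  C̃ : Time → 𝒮 → ℕ
  C̃ t σ = components (G̃ t σ)

  𝔼C̃ : (𝒮 → Time) → ℚ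
  𝔼C̃ τ = + sum (map (λ σ → C̃ (τ σ) σ) permutations) ℚ./ N !
    where instance _ = N ℕ.!≢0

  Event : Set₁
  Event = Pred 𝒮 0ℓ

  -- As 𝒮 is finite, a σ-algebra on it is an algebra of subsets.
  record Filtration : Set₁ where
    field
      𝒫     : Time → Pred Event 0ℓ
      empty : ∀ t → 𝒫 t ∅
      compl : ∀ t {A} → 𝒫 t A → 𝒫 t (∁ A)
      union : ∀ t {A B} → 𝒫 t A → 𝒫 t B → 𝒫 t (A ∪ B)
      mono  : ∀ {s t} → s Fin.≤ t → ∀ {A} → 𝒫 s A → 𝒫 t A

  IsStoppingTime : Filtration → (𝒮 → Time) → Set
  IsStoppingTime 𝓕 τ = ∀ t → Filtration.𝒫 𝓕 t (λ σ → τ σ ≡ t)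

  IsOptimal : Filtration → (𝒮 → Time) → Set
  IsOptimal 𝓕 τ = IsStoppingTime 𝓕 τ ×
    (∀ τ′ → IsStoppingTime 𝓕 τ′ → 𝔼C̃ τ′ ℚ.≤ 𝔼C̃ τ)

  blind : Filtration
  blind = record
    { 𝒫     = λ _ A → A ≐ ∅ ⊎ A ≐ U
    ; empty = λ _ → inj₁ ((λ p → p) , (λ p → p))
    ; compl = λ _ → λ
      { (inj₁ (A⊆∅ , _)) → inj₂ ((λ _ → _) , (λ _ → A⊆∅))
      ; (inj₂ (_ , U⊆A)) → inj₁ ((λ ¬a → ¬a (U⊆A _)) , (λ ()))
      }
    ; union = λ _ → λ
      { (inj₁ (A⊆∅ , _)) (inj₁ (B⊆∅ , _)) → inj₁ (Sum.[ A⊆∅ , B⊆∅ ] , (λ ()))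
      ; (inj₂ (_ , U⊆A)) _                → inj₂ ((λ _ → _) , (λ u → inj₁ (U⊆A u)))
      ; (inj₁ _)         (inj₂ (_ , U⊆B)) → inj₂ ((λ _ → _) , (λ u → inj₂ (U⊆B u)))
      }
    ; mono  = λ _ p → p
    }

  AgreeUpTo : Time → Rel 𝒮 0ℓ
  AgreeUpTo t σ π = ∀ i → i Fin.≤ t → Vec.lookup (value π) i ≡ Vec.lookup (value σ) i

  fullInformation : Filtration
  fullInformation = record
    { 𝒫     = λ t A → ∀ σ π → A σ → AgreeUpTo t σ π → A π
    ; empty = λ _ _ _ ()
    ; compl = λ _ A-closed σ π ¬a σ≈π a →
                ¬a (A-closed π σ a (λ i i≤t → sym (σ≈π i i≤t)))
    ; union = λ _ A-closed B-closed σ π → λ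
      { (inj₁ a) σ≈π → inj₁ (A-closed σ π a σ≈π)
      ; (inj₂ b) σ≈π → inj₂ (B-closed σ π b σ≈π)
      }
    ; mono  = λ s≤t A-closed σ π a σ≈π →
                A-closed σ π a (λ i i≤s → σ≈π i (ℕ.≤-trans i≤s s≤t))
    }

  perVertex : .{{NonZero N}} → (𝒮 → Time) → ℚ
  perVertex τ = (+ 1 ℚ./ N) ℚ.* 𝔼C̃ τ

open Game public

-- The NonZero hypothesis excludes only the parameter n = 0.
ForLargeN : Lattice → ((G : Graph) → .{{NonZero (Graph.order G)}} → Set) → Set
ForLargeN L P = ∃ λ N₀ → ∀ n → .{{_ : NonZero (Graph.order (lattice L n))}} →
  N₀ ℕ.≤ Graph.order (lattice L n) → P (lattice L n)

module Submission where

-- Scan the vertices of a lattice in decreasing lexicographic order. Opening a vertex v changes the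
-- number of clusters by 1 minus the number of clusters of later vertices adjacent to v. Two such
-- neighbours are certainly joined by a short cycle through v, and can only be joined if each of them
-- has another open neighbour; this bounds the change from both sides by a polynomial in the
-- indicators of the open vertices near v. When m of the N vertices are open, the expectation of a
-- monomial of degree a is (m)_a / (N)_a ≈ (m / N) ^ a, so it remains to bound a polynomial in one
-- variable p = m / N: from above by interval arithmetic on a fine grid in [0 , 1], and from below by
-- its value at one point.
--
-- For the full information game, exchanging two vertices changes the number of clusters by a bounded
-- amount, so by the law of total variance, applied along the successive choices of a random
-- ordering, its variance is O(N) at every time. As it grows by at most 1 per step, it is close to
-- its mean at all times at once, so no rule gains more than ε N.

-- When a vertex with two later neighbours x and y opens, the exact change is 1 - x - y + xyJ, where
-- J says that x and y are joined by later open vertices (on the triangular lattice a third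
-- neighbour lies between them). J is not local. The upper bound replaces it by a local event that J
-- implies, the lower bound by a local event that implies J; inclusion-exclusion turns either event
-- into monomials. For the lower bound the shortest cycle alone falls just short: its polynomial has
-- maximum about 0.12951, 0.0962 or 0.1673796 per vertex on the square, triangular or hexagonal
-- lattice, against the required 0.12953, 0.09629 and 0.16738. This forces the second, longer detour
-- (the rings), and the slack left after it is so thin that the witness densities are evaluated at
-- scale 10^-8.
--
-- Clusters are never counted during the scan: a list that reaches every point bounds their number
-- from above, a list of pairwise unconnected points from below. Monomials have the stated averages
-- only inside the lattice, so the vertices near the boundary form a margin of order sqrt N that is
-- bounded crudely.

-- Clusters of a set of points, and how one more point changes their number.

module Clusters where
  open import Defs
  open import Data.List.Base using (List; []; _∷_; _++_; length; map; allFin; deduplicate)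
  open import Data.List.Properties using (length-++; length-map)
  open import Data.List.Membership.Propositional using (_∈_; lose)
  open import Data.List.Membership.Propositional.Properties using (∈-allFin)
  open import Data.List.Relation.Unary.All as All using (All; []; _∷_)
  import Data.List.Relation.Unary.All.Properties as All
  open import Data.List.Relation.Unary.AllPairs as AllPairs using (AllPairs; []; _∷_)
  import Data.List.Relation.Unary.AllPairs.Properties as AllPairs
  open import Data.List.Relation.Unary.Any as Any using (Any; here; there; _─_)
  import Data.List.Relation.Unary.Any.Properties as Any
  open import Data.Nat.Base
  open import Data.Nat.Properties
  open import Data.Product.Base using (∃; _×_; _,_; proj₁; proj₂)
  open import Data.Sum.Base using (_⊎_; inj₁; inj₂)
  open import Function.Base using (_∘_)
  open import Level using (0ℓ)
  open import Relation.Binary.Construct.Closure.ReflexiveTransitive as Star using (Star; ε; _◅_; _◅◅_)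
  open import Relation.Binary.Core using (Rel)
  open import Relation.Binary.Definitions using (Decidable; Symmetric; Transitive)
  open import Relation.Binary.PropositionalEquality
  open import Relation.Nullary.Decidable using (yes; no; ¬?; ¬¬-excluded-middle)
  open import Relation.Nullary.Negation using (¬_; contradiction)
  open import Relation.Unary using (Pred; _⊆_)

  module _ {A : Set} where

    Any-split : {S Q : Pred A 0ℓ} {xs : List A} (i : Any S xs) → Any Q xs →
                (∃ λ x → S x × Q x) ⊎ Any Q (xs ─ i)
    Any-split (here s)  (here q)  = inj₁ (_ , s , q)
    Any-split (here s)  (there j) = inj₂ j
    Any-split (there i) (here q)  = inj₂ (here q)
    Any-split (there i) (there j) with Any-split i j
    ... | inj₁ r = inj₁ r
    ... | inj₂ r = inj₂ (there r)

    length-─ : {S : Pred A 0ℓ} {xs : List A} (i : Any S xs) → length xs ≡ suc (length (xs ─ i))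
    length-─ (here s)  = refl
    length-─ (there i) = cong suc (length-─ i)

    AllPairs-─ : {S : Pred A 0ℓ} {Q : Rel A 0ℓ} → Symmetric Q → {xs : List A} (i : Any S xs) →
                 AllPairs Q xs → All (Q (Any.lookup i)) (xs ─ i) × AllPairs Q (xs ─ i)
    AllPairs-─ Q-sym (here s)  (q ∷ qs) = q , qs
    AllPairs-─ Q-sym (there i) (q ∷ qs) with AllPairs-─ Q-sym i qs
    ... | r , rs = Q-sym (proj₁ (All.lookupAny q i)) ∷ r , All.─⁺ i q ∷ rs

    Any-lookup : {S : Pred A 0ℓ} {xs : List A} (i : Any S xs) → S (Any.lookup i)
    Any-lookup (here s)  = s
    Any-lookup (there i) = Any-lookup i

    module _ {E : Rel A 0ℓ} (E-sym : Symmetric E) (E-trans : Transitive E) where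

      -- Pigeonhole: two entries of `xs` equivalent to the same `y` would be equivalent to each
      -- other, so every entry uses up a `y` of its own. This one count gives both comparisons with
      -- `components`.
      inequivalent-length-≤ : ∀ {xs} ys → AllPairs (λ a b → ¬ E a b) xs →
                              All (λ x → Any (E x) ys) xs → length xs ≤ length ys
      inequivalent-length-≤ ys [] [] = z≤n
      inequivalent-length-≤ ys (n ∷ ns) (i ∷ is) =
        subst (_ ≤_) (sym (length-─ i)) (s≤s (inequivalent-length-≤ (ys ─ i) ns (All.zipWith keep (n , is))))
        where
        keep : ∀ {y} → (¬ E _ y) × Any (E y) ys → Any (E y) (ys ─ i)
        keep (x≁y , j) with Any-split i j
        ... | inj₁ (_ , x~z , y~z) = contradiction (E-trans x~z (E-sym y~z)) x≁y
        ... | inj₂ k = k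

      module _ (E? : Decidable E) (E-refl : ∀ {x} → E x x) where

        deduplicate-separated : ∀ xs → AllPairs (λ a b → ¬ E a b) (deduplicate E? xs)
        deduplicate-separated [] = []
        deduplicate-separated (x ∷ xs) =
          All.all-filter (¬? ∘ E? x) (deduplicate E? xs) ∷
          AllPairs.filter⁺ (¬? ∘ E? x) (deduplicate-separated xs)

        deduplicate-covers : ∀ xs {y} → y ∈ xs → Any (E y) (deduplicate E? xs)
        deduplicate-covers (x ∷ xs) (here refl) = here E-refl
        deduplicate-covers (x ∷ xs) {y} (there y∈) with deduplicate-covers xs y∈
        ... | i with E? x y
        ... | yes x~y = here (E-sym x~y)
        ... | no  x≁y with Any.filter⁺ (¬? ∘ E? x) i
        ... | inj₁ j = there j
        ... | inj₂ ¬¬e = contradiction (λ x~z → x≁y (E-trans x~z (E-sym (Any-lookup i)))) ¬¬e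

  module _ {P : Set} (R : Rel P 0ℓ) (R-sym : Symmetric R) where

    Step : Pred P 0ℓ → Rel P 0ℓ
    Step X a b = X a × X b × R a b

    Conn : Pred P 0ℓ → Rel P 0ℓ
    Conn X = Star (Step X)

    Conn-sym : ∀ {X} → Symmetric (Conn X)
    Conn-sym = Star.reverse (λ (a , b , r) → b , a , R-sym r)

    Conn-mono : ∀ {X Y} → X ⊆ Y → ∀ {a b} → Conn X a b → Conn Y a b
    Conn-mono X⊆Y = Star.map (λ (a , b , r) → X⊆Y a , X⊆Y b , r)

    Conn-target : ∀ {X a b} → X a → Conn X a b → X b
    Conn-target xa ε = xa
    Conn-target _ ((_ , xc , _) ◅ p) = Conn-target xc p

    isolated : ∀ {X a b} → (∀ {w} → X w → ¬ R a w) → Conn X a b → a ≡ b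
    isolated alone ε                  = refl
    isolated alone ((_ , xw , r) ◅ _) = contradiction r (alone xw)

    Apart : Pred P 0ℓ → List P → Set
    Apart X = AllPairs (λ a b → ¬ Conn X a b)

    -- `Covered X k` bounds the number of clusters of `X` from above, `Separated X k` from below.
    -- The entries of a covering list may lie outside `X`, which lets `covered-delete` list all
    -- possible neighbours of the deleted point.
    Covered : Pred P 0ℓ → ℕ → Set
    Covered X k = ∃ λ L → length L ≤ k × (∀ {x} → X x → Any (Conn X x) L)

    Separated : Pred P 0ℓ → ℕ → Set
    Separated X k = ∃ λ L → k ≤ length L × All X L × Apart X L

    Insert : P → Pred P 0ℓ → Pred P 0ℓ → Set
    Insert p Z X = Z ⊆ X × (∀ {x} → X x → x ≡ p ⊎ Z x)

    -- Cut the walk at its first visit to `p`: the part before it uses only points of `Z` and ends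
    -- at a neighbour of `p`.
    escape : ∀ {Z X p} → (∀ {x} → X x → x ≡ p ⊎ Z x) → ∀ {a b} → Conn X a b → Z a →
             Conn Z a b ⊎ (∃ λ w → Z w × R w p × Conn Z a w)
    escape X⊆ ε za = inj₁ ε
    escape X⊆ ((xa , xc , r) ◅ q) za with X⊆ xc
    ... | inj₁ refl = inj₂ (_ , za , r , ε)
    ... | inj₂ zc with escape X⊆ q zc
    ... | inj₁ q′ = inj₁ ((za , zc , r) ◅ q′)
    ... | inj₂ (w , zw , rw , q′) = inj₂ (w , zw , rw , (za , zc , r) ◅ q′)

    -- A point whose walk to its representative passes through `p` still reaches, within `Z`, the
    -- neighbour of `p` at which `escape` cuts the walk.
    covered-delete : ∀ {Z X p} → Insert p Z X → (nb : List P) → (∀ {w} → R w p → w ∈ nb) →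
                     ∀ {k} → Covered X k → Covered Z (length nb + k)
    covered-delete (Z⊆X , X⊆) nb R⇒∈ (L , L≤k , cov) =
      nb ++ L , ≤-trans (≤-reflexive (length-++ nb)) (+-monoʳ-≤ (length nb) L≤k) , λ {x} zx → go zx (cov (Z⊆X zx))
      where
      go : ∀ {x M} → _ → Any (Conn _ x) M → Any (Conn _ x) (nb ++ M)
      go zx (here c) with escape X⊆ c zx
      ... | inj₁ c′ = Any.++⁺ʳ nb (here c′)
      ... | inj₂ (w , _ , r , c′) = Any.++⁺ˡ (lose (R⇒∈ r) c′)
      go zx (there i) with Any.++⁻ nb (go zx i)
      ... | inj₁ j = Any.++⁺ˡ j
      ... | inj₂ j = Any.++⁺ʳ nb (there j)

    covered-extend : ∀ {Z X} (E : List P) → Z ⊆ X → (∀ {x} → X x → x ∈ E ⊎ Z x) →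
                     ∀ {k} → Covered Z k → Covered X (length E + k)
    covered-extend E Z⊆X X⊆ (L , L≤k , cov) =
      E ++ L , ≤-trans (≤-reflexive (length-++ E)) (+-monoʳ-≤ (length E) L≤k) , go
      where
      go : ∀ {x} → _ → Any (Conn _ x) (E ++ L)
      go xx with X⊆ xx
      ... | inj₁ x∈E = Any.++⁺ˡ (lose x∈E ε)
      ... | inj₂ zx = Any.++⁺ʳ E (Any.map (Conn-mono Z⊆X) (cov zx))

    covered-thin : ∀ {Z} (rs : List P) → All Z rs → Apart Z rs → (L : List P) →
                   (∀ {x} → Z x → Any (Conn Z x) L) →
                   ∃ λ M → length M + length rs ≤ length L ×
                           (∀ {x} → Z x → Any (Conn Z x) M ⊎ Any (Conn Z x) rs)
    covered-thin [] [] [] L cov = L , ≤-reflexive (+-identityʳ _) , λ zx → inj₁ (cov zx)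
    covered-thin {Z} (r ∷ rs) (zr ∷ zrs) (r≁ ∷ rs≁) L cov with covered-thin rs zrs rs≁ L cov
    ... | M , M≤ , cov′ with cov′ zr
    ... | inj₂ j = contradiction (proj₂ (All.lookupAny r≁ j)) (proj₁ (All.lookupAny r≁ j))
    ... | inj₁ i = (M ─ i) , ≤-trans (≤-reflexive len) M≤ , go
      where
      len : length (M ─ i) + suc (length rs) ≡ length M + length rs
      len = trans (+-suc _ _) (cong (_+ length rs) (sym (length-─ i)))
      go : ∀ {x} → Z x → Any (Conn Z x) (M ─ i) ⊎ Any (Conn Z x) (r ∷ rs)
      go zx with cov′ zx
      ... | inj₂ j = inj₂ (there j)
      ... | inj₁ j with Any-split i j
      ... | inj₁ (_ , r~y , x~y) = inj₂ (here (x~y ◅◅ Conn-sym r~y))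
      ... | inj₂ k = inj₁ k

    -- The representatives of the clusters of `rs` are first exchanged for `rs` themselves; all of
    -- these are adjacent to `p`, which then represents them alone.
    covered-insert : ∀ {Z X p} → Insert p Z X → X p → (rs : List P) →
                     All (λ r → Z r × R r p) rs → Apart Z rs →
                     ∀ {k} → Covered Z k → ∃ λ k′ → Covered X k′ × k′ + length rs ≤ suc k
    covered-insert {Z} {X} {p} (Z⊆X , X⊆) xp rs zrs rs≁ {k} (L , L≤k , cov)
      with covered-thin rs (All.map proj₁ zrs) rs≁ L cov
    ... | M , M≤ , cov′ = suc (length M) , (p ∷ M , ≤-refl , go) , s≤s (≤-trans M≤ L≤k)
      where
      go : ∀ {x} → X x → Any (Conn X x) (p ∷ M)
      go xx with X⊆ xx
      ... | inj₁ refl = here ε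
      ... | inj₂ zx with cov′ zx
      ... | inj₁ i = there (Any.map (Conn-mono Z⊆X) i)
      ... | inj₂ j with All.lookupAny zrs j
      ... | (zr , r) , x~r = here (Conn-mono Z⊆X x~r ◅◅ ((Z⊆X zr , xp , r) ◅ ε))

    -- The entries of the list are unconnected, so each `r` reaches at most one of them, and
    -- deleting that one costs one per `r`. Walks in an arbitrary `Z` are not decidable, hence the
    -- double negation; it is removed in `clusters-≥-weight`.
    sieve : ∀ {Z} (rs L : List P) → All Z L → Apart Z L →
            ¬ ¬ (∃ λ M → length L ≤ length M + length rs × All Z M × Apart Z M ×
                         All (λ l → ¬ Any (Conn Z l) rs) M)
    sieve [] L zL L≁ k = k (L , ≤-reflexive (sym (+-identityʳ _)) , zL , L≁ , All.universal (λ _ ()) L)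
    sieve {Z} (r ∷ rs) L zL L≁ k = sieve rs L zL L≁ λ (M , L≤ , zM , M≁ , far) →
      ¬¬-excluded-middle {A = Any (λ l → Conn Z l r) M} λ where
        (no ¬i) → k (M , ≤-trans L≤ (+-monoʳ-≤ _ (n≤1+n _)) , zM , M≁ ,
          All.zipWith (λ (l≁r , f) → λ { (here c) → l≁r c ; (there j) → f j }) (All.¬Any⇒All¬ M ¬i , far))
        (yes i) → let l≁ , M′≁ = AllPairs-─ (λ ¬c c → ¬c (Conn-sym c)) i M≁ in
          k ((M ─ i) ,
             ≤-trans L≤ (≤-reflexive (trans (cong (_+ length rs) (length-─ i)) (sym (+-suc _ _)))) ,
             All.─⁺ i zM , M′≁ ,
             All.zipWith (λ (l≁m , f) → λ { (here c) → l≁m (Any-lookup i ◅◅ Conn-sym c) ; (there j) → f j })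
               (l≁ , All.─⁺ i far))

    -- Clusters that avoid `rs` are not affected by `p`: by `escape`, a new walk out of such a
    -- cluster would first reach a neighbour of `p` inside `Z`, and this neighbour is connected to
    -- `rs`.
    separated-insert : ∀ {Z X p} → Insert p Z X → X p → ¬ Z p → (rs : List P) →
                       (∀ {w} → Z w → R w p → Any (Conn Z w) rs) →
                       ∀ {k} → Separated Z k → ¬ ¬ (∃ λ k′ → Separated X k′ × suc k ≤ k′ + length rs)
    separated-insert {Z} {X} {p} (Z⊆X , X⊆) xp ¬zp rs near {k} (L , k≤L , zL , L≁) =
      λ no → sieve rs L zL L≁ λ (M , L≤ , zM , M≁ , far) →
        no (suc (length M) ,
            (p ∷ M , ≤-refl , xp ∷ All.map Z⊆X zM , All.zipWith p≁ (zM , far) ∷ apart zM M≁ far) ,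
            s≤s (≤-trans k≤L L≤))
      where
      near-trans : ∀ {a w} → Conn Z a w → Any (Conn Z w) rs → Any (Conn Z a) rs
      near-trans c = Any.map (c ◅◅_)
      p≁ : ∀ {l} → Z l × ¬ Any (Conn Z l) rs → ¬ Conn X p l
      p≁ (zl , f) c with escape X⊆ (Conn-sym c) zl
      ... | inj₁ c′ = ¬zp (Conn-target zl c′)
      ... | inj₂ (w , zw , r , c′) = f (near-trans c′ (near zw r))
      apart : ∀ {M} → All Z M → Apart Z M → All (λ l → ¬ Any (Conn Z l) rs) M → Apart X M
      apart [] [] [] = []
      apart (zm ∷ zM) (m≁ ∷ M≁) (f ∷ fs) = All.map one m≁ ∷ apart zM M≁ fs
        where
        one : ∀ {l} → ¬ Conn Z _ l → ¬ Conn X _ l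
        one ¬c c with escape X⊆ c zm
        ... | inj₁ c′ = ¬c c′
        ... | inj₂ (w , zw , r , c′) = f (near-trans c′ (near zw r))

    Conn-≐ : ∀ {X Y} → X ⊆ Y → Y ⊆ X → ∀ {k} → Covered X k → Covered Y k
    Conn-≐ X⊆Y Y⊆X (L , L≤ , cov) = L , L≤ , λ y → Any.map (Conn-mono X⊆Y) (cov (Y⊆X y))

    module _ (H : Graph) (ℓ : Graph.Vertex H → P) (ℓ-inj : ∀ {i j} → ℓ i ≡ ℓ j → i ≡ j)
             (adj⇒ : ∀ {i j} → Graph.Adj H i j → R (ℓ i) (ℓ j))
             (adj⇐ : ∀ {i j} → R (ℓ i) (ℓ j) → Graph.Adj H i j) where
      open Graph H

      Image : Pred P 0ℓ
      Image p = ∃ λ i → ℓ i ≡ p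

      Connected⇒Conn : ∀ {i j} → Connected H i j → Conn Image (ℓ i) (ℓ j)
      Connected⇒Conn = Star.gmap ℓ (λ a → (_ , refl) , (_ , refl) , adj⇒ a)

      Conn⇒Connected : ∀ {i j p} → ℓ j ≡ p → Conn Image (ℓ i) p → Connected H i j
      Conn⇒Connected {i} eq ε with refl ← ℓ-inj eq = ε
      Conn⇒Connected eq ((_ , (k , refl) , r) ◅ c) = adj⇐ r ◅ Conn⇒Connected eq c

      Connected-sym : Symmetric (Connected H)
      Connected-sym = Star.reverse symm

      private
        D : List Vertex
        D = deduplicate (Components.connected? H) (allFin order)

      components-≤ : ∀ {k} → Covered Image k → components H ≤ k
      components-≤ (L , L≤k , cov) = ≤-trans
        (subst (_≤ length L) (length-map ℓ D)
          (inequivalent-length-≤ Conn-sym _◅◅_ L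
            (AllPairs.map⁺ (AllPairs.map (λ ¬c c → ¬c (Conn⇒Connected refl c))
              (deduplicate-separated Connected-sym _◅◅_ (Components.connected? H) ε (allFin order))))
            (All.map⁺ (All.universal (λ i → cov (i , refl)) D))))
        L≤k

      components-covered : Covered Image (components H)
      components-covered = map ℓ D , ≤-reflexive (length-map ℓ D) , λ { (i , refl) →
        Any.map⁺ (Any.map Connected⇒Conn
          (deduplicate-covers Connected-sym _◅◅_ (Components.connected? H) ε (allFin order) (∈-allFin i))) }

      components-≥ : ∀ {k} → Separated Image k → k ≤ components H
      components-≥ (L , k≤L , inL , L≁) = ≤-trans k≤L
        (subst (length L ≤_) (length-map ℓ D)
          (inequivalent-length-≤ Conn-sym _◅◅_ (map ℓ D) L≁ (All.map (proj₂ (proj₂ components-covered)) inL)))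

-- Sums over lists, and the scan of a configuration in a fixed order.

module Scan where
  open Clusters
  open import Data.Bool.Base using (Bool; true; false)
  open import Data.Integer.Base as ℤ using (ℤ; +_; 0ℤ; 1ℤ; _+_; _*_; _≤_)
  import Data.Integer.Properties as ℤ
  open import Data.Integer.Tactic.RingSolver using (solve-∀)
  open import Data.List.Base using (List; []; _∷_; _++_; length)
  open import Data.List.Properties using (length-++)
  open import Data.List.Membership.Propositional using (_∈_)
  import Data.List.Membership.Propositional.Properties as ∈
  open import Data.List.Relation.Binary.Permutation.Propositional using (_↭_; ↭-refl; ↭-trans; ↭-sym; prep; swap; refl) renaming (trans to ↭trans)
  import Data.List.Relation.Binary.Permutation.Propositional.Properties as ↭
  open import Data.List.Relation.Unary.All as All using (All; []; _∷_)
  open import Data.List.Relation.Unary.AllPairs as AllPairs using (AllPairs; []; _∷_)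
  open import Data.List.Relation.Unary.Any as Any using (Any; here; there)
  open import Data.List.Relation.Unary.Unique.Propositional using (Unique)
  open import Data.Nat.Base as ℕ using (ℕ)
  import Data.Nat.Properties as ℕ
  open import Data.Product.Base using (∃; _×_; _,_; proj₂)
  open import Data.Sum.Base using (_⊎_; inj₁; inj₂)
  open import Level using (0ℓ)
  open import Relation.Binary.Core using (Rel)
  open import Relation.Binary.Definitions using (Symmetric; Asymmetric; Transitive; Trichotomous; tri<; tri≈; tri>)
  open import Relation.Binary.PropositionalEquality
  open import Relation.Nullary.Negation using (¬_; contradiction)
  open import Relation.Unary using (Pred)

  +-cancelʳ-≤ : ∀ c a b → a + c ≤ b + c → a ≤ b
  +-cancelʳ-≤ c a b le = subst₂ _≤_ (lem a c) (lem b c) (ℤ.+-monoˡ-≤ (ℤ.- c) le)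
    where
    lem : ∀ a c → a + c + ℤ.- c ≡ a
    lem = solve-∀

  Σᴸ : {A : Set} → (A → ℤ) → List A → ℤ
  Σᴸ f []       = 0ℤ
  Σᴸ f (x ∷ xs) = f x + Σᴸ f xs

  module _ {A : Set} where

    Σᴸ-mono : {f g : A → ℤ} (xs : List A) → (∀ {x} → x ∈ xs → f x ≤ g x) → Σᴸ f xs ≤ Σᴸ g xs
    Σᴸ-mono []       f≤g = ℤ.≤-refl
    Σᴸ-mono (x ∷ xs) f≤g = ℤ.+-mono-≤ (f≤g (here refl)) (Σᴸ-mono xs (λ x∈ → f≤g (there x∈)))

    Σᴸ-cong : {f g : A → ℤ} (xs : List A) → (∀ {x} → x ∈ xs → f x ≡ g x) → Σᴸ f xs ≡ Σᴸ g xs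
    Σᴸ-cong []       f≡g = refl
    Σᴸ-cong (x ∷ xs) f≡g = cong₂ _+_ (f≡g (here refl)) (Σᴸ-cong xs (λ x∈ → f≡g (there x∈)))

    Σᴸ-++ : (f : A → ℤ) (xs ys : List A) → Σᴸ f (xs ++ ys) ≡ Σᴸ f xs + Σᴸ f ys
    Σᴸ-++ f []       ys = sym (ℤ.+-identityˡ _)
    Σᴸ-++ f (x ∷ xs) ys = trans (cong (_+_ (f x)) (Σᴸ-++ f xs ys)) (sym (ℤ.+-assoc (f x) _ _))

    Σᴸ-const : (c : ℤ) (xs : List A) → Σᴸ (λ _ → c) xs ≡ + length xs * c
    Σᴸ-const c []       = refl
    Σᴸ-const c (x ∷ xs) = trans (cong (_+_ c) (Σᴸ-const c xs)) (sym (ℤ.suc-* (+ length xs) c))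

    Σᴸ-+ : (f g : A → ℤ) (xs : List A) → Σᴸ (λ x → f x + g x) xs ≡ Σᴸ f xs + Σᴸ g xs
    Σᴸ-+ f g []       = refl
    Σᴸ-+ f g (x ∷ xs) rewrite Σᴸ-+ f g xs = lem (f x) (g x) (Σᴸ f xs) (Σᴸ g xs)
      where
      lem : ∀ a b c d → a + b + (c + d) ≡ a + c + (b + d)
      lem = solve-∀

    Σᴸ-* : (c : ℤ) (f : A → ℤ) (xs : List A) → Σᴸ (λ x → c * f x) xs ≡ c * Σᴸ f xs
    Σᴸ-* c f []       = sym (ℤ.*-zeroʳ c)
    Σᴸ-* c f (x ∷ xs) = trans (cong (_+_ (c * f x)) (Σᴸ-* c f xs)) (sym (ℤ.*-distribˡ-+ c _ _))

    Σᴸ-neg : (f : A → ℤ) (xs : List A) → Σᴸ (λ x → ℤ.- f x) xs ≡ ℤ.- Σᴸ f xs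
    Σᴸ-neg f []       = refl
    Σᴸ-neg f (x ∷ xs) = trans (cong (_+_ (ℤ.- f x)) (Σᴸ-neg f xs)) (sym (ℤ.neg-distrib-+ (f x) (Σᴸ f xs)))

    Σᴸ-↭ : (f : A → ℤ) {xs ys : List A} → xs ↭ ys → Σᴸ f xs ≡ Σᴸ f ys
    Σᴸ-↭ f refl         = refl
    Σᴸ-↭ f (prep x p)   = cong (_+_ (f x)) (Σᴸ-↭ f p)
    Σᴸ-↭ f (swap x y p) = trans (lem (f x) (f y) _) (cong (λ z → f y + (f x + z)) (Σᴸ-↭ f p))
      where
      lem : ∀ a b c → a + (b + c) ≡ b + (a + c)
      lem = solve-∀
    Σᴸ-↭ f (↭trans p q) = trans (Σᴸ-↭ f p) (Σᴸ-↭ f q)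

    unique-⊆-↭ : ∀ {xs ys : List A} → Unique xs → (∀ {x} → x ∈ xs → x ∈ ys) → ∃ λ zs → ys ↭ xs ++ zs
    unique-⊆-↭ {[]} {ys} [] ⊆ = ys , ↭-refl
    unique-⊆-↭ {x ∷ xs} {ys} (x∉ ∷ u) ⊆ with ∈.∈-∃++ (⊆ (here refl))
    ... | as , bs , refl = let zs , p = unique-⊆-↭ u rest in zs , ↭-trans (↭.shift x as bs) (prep x p)
      where
      rest : ∀ {y} → y ∈ xs → y ∈ as ++ bs
      rest y∈ with ↭.∈-resp-↭ (↭.shift x as bs) (⊆ (there y∈))
      ... | here y≡x = contradiction (sym y≡x) (All.lookup x∉ y∈)
      ... | there y∈′ = y∈′

    unique-⊆-length : ∀ {xs ys : List A} → Unique xs → (∀ {x} → x ∈ xs → x ∈ ys) → length xs ℕ.≤ length ys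
    unique-⊆-length {xs} {ys} u ⊆ with unique-⊆-↭ u ⊆
    ... | zs , p = subst (length xs ℕ.≤_) (sym (trans (↭.↭-length p) (length-++ xs))) (ℕ.m≤m+n _ _)

    module _ {_≺_ : Rel A 0ℓ} (≺-trans : Transitive _≺_) (≺-cmp : Trichotomous _≡_ _≺_) where

      private
        insert : ∀ x ys → AllPairs _≺_ ys → All (x ≢_) ys → ∃ λ zs → zs ↭ x ∷ ys × AllPairs _≺_ zs
        insert x [] [] [] = x ∷ [] , ↭-refl , [] ∷ []
        insert x (y ∷ ys) (y≺ ∷ s) (x≢y ∷ x≢) with ≺-cmp x y
        ... | tri< x≺y _ _ = x ∷ y ∷ ys , ↭-refl , (x≺y ∷ All.map (≺-trans x≺y) y≺) ∷ y≺ ∷ s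
        ... | tri≈ _ x≡y _ = contradiction x≡y x≢y
        ... | tri> _ _ y≺x = let zs , p , s′ = insert x ys s x≢ in
          y ∷ zs , ↭-trans (prep y p) (swap y x ↭-refl) , ↭.All-resp-↭ (↭-sym p) (y≺x ∷ y≺) ∷ s′

      sort : ∀ xs → Unique xs → ∃ λ ys → ys ↭ xs × AllPairs _≺_ ys
      sort [] [] = [] , ↭-refl , []
      sort (x ∷ xs) (x≢ ∷ u) =
        let ys , p , s = sort xs u
            zs , q , s′ = insert x ys s (↭.All-resp-↭ (↭-sym p) x≢)
        in zs , ↭-trans q (prep x p) , s′

  module Scanning {P : Set} (R : Rel P 0ℓ) (R-sym : Symmetric R)
                  (_≺_ : Rel P 0ℓ) (≺-asym : Asymmetric _≺_) where

    Open : (P → Bool) → Pred P 0ℓ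
    Open s p = s p ≡ true

    Later : (P → Bool) → P → Pred P 0ℓ
    Later s v p = s p ≡ true × v ≺ p

    -- Adding v to the open vertices after it changes the number of clusters by at most,
    -- respectively at least, z.
    record Gain≤ (s : P → Bool) (v : P) (z : ℤ) : Set where
      field
        reps     : List P
        adjacent : All (λ r → Later s v r × R r v) reps
        apart    : Apart R R-sym (Later s v) reps
        bound    : 1ℤ ≤ z + + length reps

    record Gain≥ (s : P → Bool) (v : P) (z : ℤ) : Set where
      field
        reps  : List P
        near  : ∀ {w} → Later s v w → R w v → Any (Conn R R-sym (Later s v) w) reps
        bound : z + + length reps ≤ 1ℤ

    module _ (s : P → Bool) (w : P → ℤ) where

      private
        Within : List P → Pred P 0ℓ
        Within xs p = s p ≡ true × p ∈ xs

        -- The invariant that passes to every suffix of the sorted list. It makes `Later s v`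
        -- coincide with the open entries after `v`, so that a gain stated globally applies to the
        -- step at `v`.
        Tail : List P → Set
        Tail xs = ∀ {p} → s p ≡ true → p ∈ xs ⊎ All (p ≺_) xs

        module _ {v ys} (v≺ : All (v ≺_) ys) (tail : Tail (v ∷ ys)) where

          later⇒within : ∀ {p} → Later s v p → Within ys p
          later⇒within (sp , v≺p) with tail sp
          ... | inj₁ (here refl) = contradiction v≺p (≺-asym v≺p)
          ... | inj₁ (there p∈)  = sp , p∈
          ... | inj₂ (p≺v ∷ _)   = contradiction v≺p (≺-asym p≺v)

          within⇒later : ∀ {p} → Within ys p → Later s v p
          within⇒later (sp , p∈) = sp , All.lookup v≺ p∈

          tail′ : Tail ys
          tail′ sp with tail sp
          ... | inj₁ (here refl) = inj₂ v≺
          ... | inj₁ (there p∈)  = inj₁ p∈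
          ... | inj₂ (_ ∷ p≺)    = inj₂ p≺

          insert-v : Insert R R-sym v (Within ys) (Within (v ∷ ys))
          insert-v = (λ (sp , p∈) → sp , there p∈) , λ where
            (sp , here refl) → inj₁ refl
            (sp , there p∈)  → inj₂ (sp , p∈)

          v∉ : ¬ Within ys v
          v∉ z = ≺-asym (proj₂ (within⇒later z)) (proj₂ (within⇒later z))

        drop-v : ∀ {v ys} → s v ≡ false → ∀ {p} → Within (v ∷ ys) p → Within ys p
        drop-v sv (sp , here refl) with () ← trans (sym sv) sp
        drop-v sv (sp , there p∈) = sp , p∈

      -- The list ascends and the recursion treats the rest before the head, so points open from the
      -- last to the first. Closed points do not change the clusters but still carry a weight,
      -- whence the sign condition on it.
      scan-≤ : ∀ xs → AllPairs _≺_ xs → Tail xs →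
               (∀ {v} → v ∈ xs → s v ≡ true → Gain≤ s v (w v)) →
               (∀ {v} → v ∈ xs → s v ≡ false → 0ℤ ≤ w v) →
               ∃ λ k → Covered R R-sym (Within xs) k × + k ≤ Σᴸ w xs
      scan-≤ [] [] tail up off = 0 , ([] , ℕ.z≤n , λ ()) , ℤ.≤-refl
      scan-≤ (v ∷ ys) (v≺ ∷ s≺) tail up off
        with scan-≤ ys s≺ (tail′ v≺ tail) (λ i → up (there i)) (λ i → off (there i)) | s v in sv
      ... | k , c , k≤ | false =
        k , Conn-≐ R R-sym (λ (sp , p∈) → sp , there p∈) (drop-v sv) c ,
        ℤ.≤-trans k≤ (ℤ.≤-trans (ℤ.≤-reflexive (sym (ℤ.+-identityˡ _))) (ℤ.+-monoˡ-≤ _ (off (here refl) sv)))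
      ... | k , c , k≤ | true =
        let k′ , c′ , le = covered-insert R R-sym (insert-v v≺ tail) (sv , here refl) reps
                             (All.map (λ (l , r) → later⇒within v≺ tail l , r) adjacent)
                             (AllPairs.map (λ ¬c c → ¬c (Conn-mono R R-sym (within⇒later v≺ tail) c)) apart) c
        in k′ , c′ , arith (+ k′) (+ length reps) (+ k) (w v) (Σᴸ w ys) (ℤ.+≤+ le) bound k≤
        where
        open Gain≤ (up (here refl) sv)
        arith : ∀ k′ l k z t → k′ + l ≤ 1ℤ + k → 1ℤ ≤ z + l → k ≤ t → k′ ≤ z + t
        arith k′ l k z t p q r = +-cancelʳ-≤ l _ _ (ℤ.≤-trans p (ℤ.≤-trans (ℤ.+-mono-≤ q r) (ℤ.≤-reflexive (lem z l t))))
          where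
          lem : ∀ z l t → z + l + t ≡ z + t + l
          lem = solve-∀

      scan-≥ : ∀ xs → AllPairs _≺_ xs → Tail xs →
               (∀ {v} → v ∈ xs → s v ≡ true → Gain≥ s v (w v)) →
               (∀ {v} → v ∈ xs → s v ≡ false → w v ≤ 0ℤ) →
               ¬ ¬ (∃ λ k → Separated R R-sym (Within xs) k × Σᴸ w xs ≤ + k)
      scan-≥ [] [] tail up off no = no (0 , ([] , ℕ.z≤n , [] , []) , ℤ.≤-refl)
      scan-≥ (v ∷ ys) (v≺ ∷ s≺) tail up off no
        with s v in sv
      ... | false = scan-≥ ys s≺ (tail′ v≺ tail) (λ i → up (there i)) (λ i → off (there i)) λ
        (k , (L , k≤ , inL , L≁) , le) → no (k , (L , k≤ , All.map (λ (sp , p∈) → sp , there p∈) inL ,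
              AllPairs.map (λ ¬c c → ¬c (Conn-mono R R-sym (drop-v sv) c)) L≁) ,
          ℤ.≤-trans (ℤ.+-mono-≤ (off (here refl) sv) le) (ℤ.≤-reflexive (ℤ.+-identityˡ _)))
      ... | true = scan-≥ ys s≺ (tail′ v≺ tail) (λ i → up (there i)) (λ i → off (there i)) λ
        (k , sep , le) → separated-insert R R-sym (insert-v v≺ tail) (sv , here refl) (v∉ v≺ tail) reps
          (λ z r → Any.map (Conn-mono R R-sym (later⇒within v≺ tail)) (near (within⇒later v≺ tail z) r)) sep λ
        (k′ , sep′ , le′) → no (k′ , sep′ , arith (+ k′) (+ length reps) (+ k) (w v) (Σᴸ w ys) (ℤ.+≤+ le′) bound le)
        where
        open Gain≥ (up (here refl) sv)
        arith : ∀ k′ l k z t → 1ℤ + k ≤ k′ + l → z + l ≤ 1ℤ → t ≤ k → z + t ≤ k′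
        arith k′ l k z t p q r = +-cancelʳ-≤ l _ _ (ℤ.≤-trans (ℤ.≤-reflexive (lem z l t)) (ℤ.≤-trans (ℤ.+-mono-≤ q r) p))
          where
          lem : ∀ z l t → z + t + l ≡ z + l + t
          lem = solve-∀

-- Sums over orderings, and counting the orderings that cover a set early.

module Orderings where
  open Scan
  open import Data.Bool.Base using (Bool; true; false; if_then_else_)
  open import Data.Fin.Base using (Fin)
  import Data.Fin.Properties as Fin
  open import Data.Integer.Base as ℤ using (ℤ; +_; 0ℤ; 1ℤ; _+_; _*_; _-_; _≤_)
  import Data.Integer.Properties as ℤ
  open import Data.Integer.Tactic.RingSolver using (solve-∀)
  open import Data.List.Base using (List; []; _∷_; _++_; length; map; allFin; filter)
  open import Data.List.Properties using (length-++; length-tabulate; ++-identityʳ)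
  open import Data.List.Membership.Propositional using (_∈_; _∉_)
  import Data.List.Membership.Propositional.Properties as ∈
  import Data.List.Membership.DecPropositional as DecMembership
  open import Data.List.Relation.Binary.Permutation.Propositional using (_↭_; ↭-sym; ↭-trans; ↭-reflexive)
  import Data.List.Relation.Binary.Permutation.Propositional.Properties as ↭
  open import Data.List.Relation.Unary.All as All using (All; []; _∷_)
  import Data.List.Relation.Unary.All.Properties as All
  open import Data.List.Relation.Unary.AllPairs using ([]; _∷_)
  open import Data.List.Relation.Unary.Any using (here; there)
  open import Data.List.Relation.Unary.Unique.Propositional using (Unique)
  import Data.List.Relation.Unary.Unique.Propositional.Properties as Unique
  open import Data.Nat.Base as ℕ using (ℕ; zero; suc; _∸_; _!)
  open import Data.Nat.Combinatorics.Base using (_P′_)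
  import Data.Nat.Properties as ℕ
  open import Data.Product.Base using (∃; _×_; _,_; proj₁; proj₂)
  open import Data.Sum.Base using (inj₁; inj₂)
  open import Data.Unit.Base using (⊤; tt)
  open import Data.Vec.Base as Vec using (Vec; []; _∷_)
  open import Function.Base using (_∘_)
  open import Relation.Binary.PropositionalEquality
  open import Relation.Nullary.Decidable using (Dec; yes; no; does; ¬?; dec-true; dec-false; _×-dec_)
  open import Relation.Nullary.Negation using (¬_; contradiction)

  *-monoʳ-≤ : ∀ n {i j} → i ≤ j → + n * i ≤ + n * j
  *-monoʳ-≤ n = ℤ.*-monoˡ-≤-nonNeg (+ n)

  square-≥0 : ∀ i → 0ℤ ≤ i * i
  square-≥0 (+ n)      = subst (0ℤ ≤_) (ℤ.pos-* n n) (ℤ.+≤+ ℕ.z≤n)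
  square-≥0 (ℤ.-[1+ n ]) = ℤ.+≤+ ℕ.z≤n

  square-mono : ∀ i b → i ≤ + b → ℤ.- i ≤ + b → i * i ≤ + b * + b
  square-mono (+ n) b (ℤ.+≤+ le) _ =
    subst₂ _≤_ (ℤ.pos-* n n) (ℤ.pos-* b b) (ℤ.+≤+ (ℕ.*-mono-≤ le le))
  square-mono ℤ.-[1+ n ] b _ (ℤ.+≤+ le) =
    subst (ℤ.-[1+ n ] * ℤ.-[1+ n ] ≤_) (ℤ.pos-* b b) (ℤ.+≤+ (ℕ.*-mono-≤ le le))

  m<n⇒mP′n≡0 : ∀ m n → m ℕ.< n → m P′ n ≡ 0
  m<n⇒mP′n≡0 m (suc n) (ℕ.s≤s m≤n) = cong (ℕ._* (m P′ n)) (ℕ.m≤n⇒m∸n≡0 m≤n)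

  -- `m P′ a` is the falling factorial, which vanishes for a > m. Both sides are (m + 1) times
  -- `m P′ a`, with m + 1 written as (a + 1) + (m - a).
  P′-pascal : ∀ m a → suc m P′ suc a ≡ suc a ℕ.* (m P′ a) ℕ.+ m P′ suc a
  P′-pascal m a = trans (absorb a) (trans split (ℕ.*-distribʳ-+ (m P′ a) (suc a) (m ∸ a)))
    where
    absorb : ∀ a → suc m P′ suc a ≡ suc m ℕ.* (m P′ a)
    absorb zero    = refl
    absorb (suc a) = trans (cong (ℕ._*_ (m ∸ a)) (absorb a)) (lem (m ∸ a) (suc m) (m P′ a))
      where
      open import Data.Nat.Tactic.RingSolver using () renaming (solve-∀ to solveℕ)
      lem : ∀ x y z → x ℕ.* (y ℕ.* z) ≡ y ℕ.* (x ℕ.* z)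
      lem = solveℕ
    split : suc m ℕ.* (m P′ a) ≡ (suc a ℕ.+ (m ∸ a)) ℕ.* (m P′ a)
    split with ℕ.≤-total a m
    ... | inj₁ a≤m = cong (λ z → suc z ℕ.* (m P′ a)) (sym (ℕ.m+[n∸m]≡n a≤m))
    ... | inj₂ m≤a with ℕ.m≤n⇒m<n∨m≡n m≤a
    ... | inj₂ refl = cong (λ z → suc z ℕ.* (m P′ a)) (sym (ℕ.m+[n∸m]≡n {m} ℕ.≤-refl))
    ... | inj₁ m<a rewrite m<n⇒mP′n≡0 m a m<a = trans (ℕ.*-zeroʳ m) (sym (ℕ.*-zeroʳ (a ℕ.+ (m ∸ a))))

  module _ {A : Set} where

    Σᴸ-map : {B : Set} (f : B → ℤ) (g : A → B) (xs : List A) → Σᴸ f (map g xs) ≡ Σᴸ (f ∘ g) xs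
    Σᴸ-map f g []       = refl
    Σᴸ-map f g (x ∷ xs) = cong (_+_ (f (g x))) (Σᴸ-map f g xs)

    private
      module _ (m : A → ℤ) (c : ℤ) where
        Σm Σm² : List A → ℤ
        Σm = Σᴸ m
        Σm² = Σᴸ (λ x → m x * m x)

        shift₁ : ∀ xs → Σᴸ (λ x → m x - c) xs ≡ Σm xs - + length xs * c
        shift₁ [] = refl
        shift₁ (x ∷ xs) rewrite shift₁ xs = step (m x) (Σm xs) (+ length xs) c
          where
          step : ∀ a s l c → a - c + (s - l * c) ≡ a + s - (1ℤ + l) * c
          step = solve-∀

        shift₂ : ∀ xs → Σᴸ (λ x → (m x - c) * (m x - c)) xs ≡
                 Σm² xs - + 2 * c * Σm xs + + length xs * (c * c)
        shift₂ [] = sym (base c)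
          where
          base : ∀ c → 0ℤ - + 2 * c * 0ℤ + 0ℤ * (c * c) ≡ 0ℤ
          base = solve-∀
        shift₂ (x ∷ xs) rewrite shift₂ xs = step (m x) (Σm² xs) (Σm xs) (+ length xs) c
          where
          step : ∀ a q s l c → (a - c) * (a - c) + (q - + 2 * c * s + l * (c * c)) ≡
                 a * a + q - + 2 * c * (a + s) + (1ℤ + l) * (c * c)
          step = solve-∀

        expand-shift : ∀ xs → + length xs * Σm² xs - Σm xs * Σm xs ≡
          + length xs * Σᴸ (λ x → (m x - c) * (m x - c)) xs - Σᴸ (λ x → m x - c) xs * Σᴸ (λ x → m x - c) xs
        expand-shift xs rewrite shift₁ xs | shift₂ xs = lem (+ length xs) (Σm² xs) (Σm xs) c
          where
          lem : ∀ l q s c → l * q - s * s ≡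
                l * (q - + 2 * c * s + l * (c * c)) - (s - l * c) * (s - l * c)
          lem = solve-∀

    -- The left side is a scaled variance, hence unchanged when all values are shifted by `c`. After
    -- the shift the subtracted square is dropped and every remaining square is at most `B`.
    variance-≤ : ∀ (m : A → ℤ) c (B : ℤ) xs → (∀ {x} → x ∈ xs → (m x - c) * (m x - c) ≤ B) →
      + length xs * Σᴸ (λ x → m x * m x) xs - Σᴸ m xs * Σᴸ m xs ≤ + length xs * (+ length xs * B)
    variance-≤ m c B xs near = subst (_≤ + length xs * (+ length xs * B)) (sym (expand-shift m c xs))
      (ℤ.≤-trans (drop _ _ (square-≥0 (Σᴸ (λ x → m x - c) xs)))
        (*-monoʳ-≤ (length xs) (subst (Σᴸ (λ x → (m x - c) * (m x - c)) xs ≤_) (Σᴸ-const B xs) (Σᴸ-mono xs near))))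
      where
      drop : ∀ a b → 0ℤ ≤ b → a - b ≤ a
      drop a b b≥0 = ℤ.≤-trans (ℤ.+-monoʳ-≤ a (ℤ.neg-mono-≤ b≥0)) (ℤ.≤-reflexive (ℤ.+-identityʳ a))

  module _ (N : ℕ) where

    open DecMembership (Fin._≟_ {N}) using (_∈?_)

    -- Conditioning on the first letter is one unfolding of this recursion; `L` collects the letters
    -- already used. For k = N and empty `L` the sum is N! times the expectation over a uniform
    -- permutation.
    Σ-orderings : ∀ k → List (Fin N) → (Vec (Fin N) k → ℤ) → ℤ
    Σ-orderings zero    L f = f []
    Σ-orderings (suc k) L f =
      Σᴸ (λ v → if does (v ∈? L) then 0ℤ else Σ-orderings k (v ∷ L) (f ∘ (v ∷_))) (allFin N)

    Fresh : ∀ {k} → List (Fin N) → Vec (Fin N) k → Set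
    Fresh L []      = ⊤
    Fresh L (v ∷ w) = v ∉ L × Fresh (v ∷ L) w

    fresh? : ∀ {k} L (w : Vec (Fin N) k) → Dec (Fresh L w)
    fresh? L []      = yes tt
    fresh? L (v ∷ w) = ¬? (v ∈? L) ×-dec fresh? (v ∷ L) w

    Σ-orderings-mono : ∀ k L {f g} → (∀ w → Fresh L w → f w ≤ g w) → Σ-orderings k L f ≤ Σ-orderings k L g
    Σ-orderings-mono zero L f≤g = f≤g [] tt
    Σ-orderings-mono (suc k) L {f} {g} f≤g = Σᴸ-mono (allFin N) (λ {v} _ → step v)
      where
      step : ∀ v → (if does (v ∈? L) then 0ℤ else Σ-orderings k (v ∷ L) (f ∘ (v ∷_))) ≤
                   (if does (v ∈? L) then 0ℤ else Σ-orderings k (v ∷ L) (g ∘ (v ∷_)))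
      step v with v ∈? L
      ... | yes _ = ℤ.≤-refl
      ... | no v∉ = Σ-orderings-mono k (v ∷ L) (λ w fr → f≤g (v ∷ w) (v∉ , fr))

    Σ-orderings-cong : ∀ k L {f g} → (∀ w → Fresh L w → f w ≡ g w) → Σ-orderings k L f ≡ Σ-orderings k L g
    Σ-orderings-cong k L f≡g = ℤ.≤-antisym
      (Σ-orderings-mono k L (λ w fr → ℤ.≤-reflexive (f≡g w fr)))
      (Σ-orderings-mono k L (λ w fr → ℤ.≤-reflexive (sym (f≡g w fr))))

    Σ-orderings-+ : ∀ k L f g → Σ-orderings k L (λ w → f w + g w) ≡ Σ-orderings k L f + Σ-orderings k L g
    Σ-orderings-+ zero L f g = refl
    Σ-orderings-+ (suc k) L f g = trans (Σᴸ-cong (allFin N) (λ {v} _ → step v)) (Σᴸ-+ _ _ (allFin N))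
      where
      step : ∀ v → (if does (v ∈? L) then 0ℤ else Σ-orderings k (v ∷ L) (λ w → f (v ∷ w) + g (v ∷ w))) ≡
                   (if does (v ∈? L) then 0ℤ else Σ-orderings k (v ∷ L) (f ∘ (v ∷_))) +
                   (if does (v ∈? L) then 0ℤ else Σ-orderings k (v ∷ L) (g ∘ (v ∷_)))
      step v with does (v ∈? L)
      ... | true  = refl
      ... | false = Σ-orderings-+ k (v ∷ L) _ _

    Σ-orderings-* : ∀ k L c f → Σ-orderings k L (λ w → c * f w) ≡ c * Σ-orderings k L f
    Σ-orderings-* zero L c f = refl
    Σ-orderings-* (suc k) L c f = trans (Σᴸ-cong (allFin N) (λ {v} _ → step v)) (Σᴸ-* c _ (allFin N))
      where
      step : ∀ v → (if does (v ∈? L) then 0ℤ else Σ-orderings k (v ∷ L) (λ w → c * f (v ∷ w))) ≡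
                   c * (if does (v ∈? L) then 0ℤ else Σ-orderings k (v ∷ L) (f ∘ (v ∷_)))
      step v with does (v ∈? L)
      ... | true  = sym (ℤ.*-zeroʳ c)
      ... | false = Σ-orderings-* k (v ∷ L) c _

    Σ-orderings-neg : ∀ k L f → Σ-orderings k L (λ w → ℤ.- f w) ≡ ℤ.- Σ-orderings k L f
    Σ-orderings-neg k L f = trans (Σ-orderings-cong k L (λ w _ → sym (ℤ.-1*i≡-i (f w))))
      (trans (Σ-orderings-* k L ℤ.-1ℤ f) (ℤ.-1*i≡-i _))

    Σ-orderings-0 : ∀ k L → Σ-orderings k L (λ _ → 0ℤ) ≡ 0ℤ
    Σ-orderings-0 k L = Σ-orderings-* k L 0ℤ (λ _ → 0ℤ)

    Σ-orderings-Σᴸ : ∀ k L {A : Set} (f : A → Vec (Fin N) k → ℤ) xs →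
      Σ-orderings k L (λ w → Σᴸ (λ a → f a w) xs) ≡ Σᴸ (λ a → Σ-orderings k L (f a)) xs
    Σ-orderings-Σᴸ k L f []       = Σ-orderings-0 k L
    Σ-orderings-Σᴸ k L f (x ∷ xs) = trans (Σ-orderings-+ k L (f x) _) (cong (_+_ (Σ-orderings k L (f x))) (Σ-orderings-Σᴸ k L f xs))

    Fin-↭ : (xs : List (Fin N)) → Unique xs → length xs ≡ N → allFin N ↭ xs
    Fin-↭ xs u len with unique-⊆-↭ {ys = allFin N} u (λ {v} _ → ∈.∈-allFin v)
    ... | [] , p = ↭-trans p (↭-reflexive (++-identityʳ xs))
    ... | z ∷ zs , p = contradiction (trans (sym (trans (↭.↭-length p) (length-++ xs))) (trans (length-tabulate {n = N} (λ i → i)) (sym len)))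
      (λ e → ℕ.1+n≰n (ℕ.≤-trans (ℕ.s≤s (ℕ.m≤m+n (length xs) (length zs))) (ℕ.≤-reflexive (trans (sym (ℕ.+-suc (length xs) (length zs))) e))))

    private
      Unique-resp-↭ : ∀ {A : Set} {xs ys : List A} → xs ↭ ys → Unique xs → Unique ys
      Unique-resp-↭ {A} = Data.List.Relation.Binary.Permutation.Setoid.Properties.Unique-resp-↭ (setoid A) ∘ Data.List.Relation.Binary.Permutation.Propositional.↭⇒↭ₛ
        where import Data.List.Relation.Binary.Permutation.Setoid.Properties
              import Data.List.Relation.Binary.Permutation.Propositional

      unique-++ : ∀ {A : Set} (xs : List A) {ys} → Unique (xs ++ ys) →
                  Unique ys × (∀ {y} → y ∈ ys → y ∉ xs)
      unique-++ [] u = u , λ _ ()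
      unique-++ (x ∷ xs) (x≢ ∷ u) with unique-++ xs u
      ... | uy , disj = uy , λ where
        y∈ (here refl) → All.lookup x≢ (∈.∈-++⁺ʳ xs y∈) refl
        y∈ (there y∈xs) → disj y∈ y∈xs

    record Unused (L : List (Fin N)) (k : ℕ) : Set where
      field
        unused        : List (Fin N)
        unused-unique : Unique unused
        unused-length : length unused ≡ k
        unused-∉      : ∀ {v} → v ∈ unused → v ∉ L
        ∉⇒unused      : ∀ {v} → v ∉ L → v ∈ unused
        partition     : allFin N ↭ L ++ unused

    findUnused : ∀ {L k} → Unique L → length L ℕ.+ k ≡ N → Unused L k
    findUnused {L} {k} u len with unique-⊆-↭ {ys = allFin N} u (λ {v} _ → ∈.∈-allFin v)
    ... | zs , p = record
      { unused        = zs
      ; unused-unique = proj₁ split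
      ; unused-length = ℕ.+-cancelˡ-≡ (length L) _ _
          (trans (sym (length-++ L)) (trans (sym (↭.↭-length p)) (trans (length-tabulate {n = N} (λ i → i)) (sym len))))
      ; unused-∉      = proj₂ split
      ; ∉⇒unused      = λ {v} v∉ → Data.Sum.Base.[ (λ i → contradiction i v∉) , (λ j → j) ]
                          (∈.∈-++⁻ L (↭.∈-resp-↭ p (∈.∈-allFin v)))
      ; partition     = p
      }
      where
      split = unique-++ L (Unique-resp-↭ p (Unique.allFin⁺ N))

    module _ {L k} (U : Unused L k) where
      open Unused U

      Σ-unused : (g : Fin N → ℤ) →
        Σᴸ (λ v → if does (v ∈? L) then 0ℤ else g v) (allFin N) ≡ Σᴸ g unused
      Σ-unused g = trans (Σᴸ-↭ g′ partition) (trans (Σᴸ-++ g′ L unused)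
        (trans (cong₂ _+_ on-L on-unused) (ℤ.+-identityˡ _)))
        where
        g′ : Fin N → ℤ
        g′ v = if does (v ∈? L) then 0ℤ else g v
        on-L : Σᴸ g′ L ≡ 0ℤ
        on-L = trans (Σᴸ-cong L (λ {v} v∈ → cong (λ b → if b then 0ℤ else g v) (dec-true (v ∈? L) v∈)))
                 (trans (Σᴸ-const 0ℤ L) (ℤ.*-zeroʳ (+ length L)))
        on-unused : Σᴸ g′ unused ≡ Σᴸ g unused
        on-unused = Σᴸ-cong unused (λ {v} v∈ → cong (λ b → if b then 0ℤ else g v) (dec-false (v ∈? L) (unused-∉ v∈)))

    fresh-cons : ∀ {L : List (Fin N)} {k v} → v ∉ L → Unique L → length L ℕ.+ suc k ≡ N →
           Unique (v ∷ L) × length (v ∷ L) ℕ.+ k ≡ N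
    fresh-cons {L} {k} {v} v∉ u len = All.¬Any⇒All¬ L v∉ ∷ u , trans (sym (ℕ.+-suc (length L) k)) len

    Σ-orderings-const : ∀ k L c → Unique L → length L ℕ.+ k ≡ N →
                        Σ-orderings k L (λ _ → c) ≡ + (k !) * c
    Σ-orderings-const zero L c u len = sym (ℤ.*-identityˡ c)
    Σ-orderings-const (suc k) L c u len = begin
      Σᴸ (λ v → if does (v ∈? L) then 0ℤ else Σ-orderings k (v ∷ L) (λ _ → c)) (allFin N)
        ≡⟨ Σ-unused U _ ⟩
      Σᴸ (λ v → Σ-orderings k (v ∷ L) (λ _ → c)) unused
        ≡⟨ Σᴸ-cong unused (λ {v} v∈ → let u′ , len′ = fresh-cons (unused-∉ v∈) u len in Σ-orderings-const k (v ∷ L) c u′ len′) ⟩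
      Σᴸ (λ _ → + (k !) * c) unused
        ≡⟨ Σᴸ-const _ unused ⟩
      + length unused * (+ (k !) * c)
        ≡⟨ cong (λ l → + l * (+ (k !) * c)) unused-length ⟩
      + suc k * (+ (k !) * c)
        ≡⟨ ℤ.*-assoc (+ suc k) (+ (k !)) c ⟨
      + suc k * + (k !) * c
        ≡⟨ cong (_* c) (ℤ.pos-* (suc k) (k !)) ⟨
      + (suc k !) * c ∎
      where
      open ≡-Reasoning
      U = findUnused u len
      open Unused U

    -- Only membership in this list matters. It is accumulated on `L` to match the way in which
    -- `Σ-orderings` extends its list of used letters.
    prefix : (m : ℕ) {k : ℕ} → Vec (Fin N) k → List (Fin N) → List (Fin N)
    prefix zero    w       L = L
    prefix (suc m) []      L = L
    prefix (suc m) (v ∷ w) L = prefix m w (v ∷ L)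

    _⊆?_ : ∀ (A B : List (Fin N)) → Dec (All (_∈ B) A)
    A ⊆? B = All.all? (_∈? B) A

    indicator : Bool → ℤ
    indicator b = if b then 1ℤ else 0ℤ

    missing : List (Fin N) → List (Fin N) → List (Fin N)
    missing A L = filter (λ a → ¬? (a ∈? L)) A

    private
      missing-∈ : ∀ {A L v} → v ∈ A → v ∉ L → Unique A →
                  length (missing A L) ≡ suc (length (missing A (v ∷ L)))
      missing-same : ∀ {A L v} → v ∉ A → length (missing A L) ≡ length (missing A (v ∷ L))
      missing-same {[]} v∉ = refl
      missing-same {a ∷ A} {L} {v} v∉ with a Fin.≟ v | a ∈? L
      ... | yes refl | _ = contradiction (here refl) v∉
      ... | no _ | yes _ = missing-same {A} (v∉ ∘ there)
      ... | no _ | no _  = cong suc (missing-same {A} (v∉ ∘ there))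
      missing-∈ {a ∷ A} {L} {v} (here refl) v∉ (a≢ ∷ u) with a Fin.≟ a | a ∈? L
      ... | no a≢a | _ = contradiction refl a≢a
      ... | yes _ | yes a∈ = contradiction a∈ v∉
      ... | yes _ | no _ = cong suc (missing-same {A} (λ v∈ → All.lookup a≢ v∈ refl))
      missing-∈ {a ∷ A} {L} {v} (there v∈) v∉ (a≢ ∷ u) with a Fin.≟ v | a ∈? L
      ... | yes refl | _ = contradiction refl (All.lookup a≢ v∈)
      ... | no _ | yes _ = missing-∈ {A} v∈ v∉ u
      ... | no _ | no _  = cong suc (missing-∈ {A} v∈ v∉ u)

      no-missing : ∀ {A L} → length (missing A L) ≡ 0 → All (_∈ L) A
      no-missing {[]} eq = []
      no-missing {a ∷ A} {L} eq with a ∈? L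
      ... | yes a∈ = a∈ ∷ no-missing eq
      no-missing {a ∷ A} {L} () | no _

      some-missing : ∀ {A L n} → length (missing A L) ≡ suc n → ¬ All (_∈ L) A
      some-missing {a ∷ A} {L} eq (a∈ ∷ all) with a ∈? L
      ... | yes _ = some-missing {A} eq all
      ... | no a∉ = a∉ a∈

    -- The missing elements of `A` must occupy distinct places among the first `m`, and the other
    -- letters are ordered freely. The induction splits by whether the first letter is one of the
    -- missing elements.
    count-covering : ∀ k m A L → m ℕ.≤ k → Unique A → Unique L → length L ℕ.+ k ≡ N →
      Σ-orderings k L (λ w → indicator (does (A ⊆? prefix m w L))) ≡
      + ((m P′ length (missing A L)) ℕ.* (k ∸ length (missing A L)) !)
    count-covering k zero A L _ uA uL len = base (length (missing A L)) refl
      where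
      base : ∀ n → length (missing A L) ≡ n →
        Σ-orderings k L (λ _ → indicator (does (A ⊆? L))) ≡ + ((0 P′ n) ℕ.* (k ∸ n) !)
      base zero eq = trans (Σ-orderings-const k L _ uL len)
        (trans (cong (λ b → + (k !) * indicator b) (dec-true (A ⊆? L) (no-missing eq)))
          (trans (ℤ.*-identityʳ _) (cong +_ (sym (ℕ.*-identityˡ (k !))))))
      base (suc n) eq = trans (Σ-orderings-const k L _ uL len)
        (trans (cong (λ b → + (k !) * indicator b) (dec-false (A ⊆? L) (some-missing {A} eq)))
          (trans (ℤ.*-zeroʳ (+ (k !))) (cong (λ z → + (z ℕ.* (0 P′ n) ℕ.* (k ∸ suc n) !)) (sym (ℕ.0∸n≡0 n)))))
    count-covering (suc k) (suc m) A L (ℕ.s≤s m≤k) uA uL len = begin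
      Σ-orderings (suc k) L (λ w → indicator (does (A ⊆? prefix (suc m) w L)))
        ≡⟨ Σ-unused U _ ⟩
      Σᴸ h unused
        ≡⟨ Σᴸ-↭ h (proj₂ rest) ⟩
      Σᴸ h (missing A L ++ proj₁ rest)
        ≡⟨ Σᴸ-++ h (missing A L) (proj₁ rest) ⟩
      Σᴸ h (missing A L) + Σᴸ h (proj₁ rest)
        ≡⟨ cong₂ _+_ (Σᴸ-cong (missing A L) in-A) (Σᴸ-cong (proj₁ rest) out-A) ⟩
      Σᴸ (λ _ → + ((m P′ (a ∸ 1)) ℕ.* (k ∸ (a ∸ 1)) !)) (missing A L) + Σᴸ (λ _ → + ((m P′ a) ℕ.* (k ∸ a) !)) (proj₁ rest)
        ≡⟨ cong₂ _+_ (Σᴸ-const _ (missing A L)) (Σᴸ-const _ (proj₁ rest)) ⟩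
      + a * + ((m P′ (a ∸ 1)) ℕ.* (k ∸ (a ∸ 1)) !) + + b * + ((m P′ a) ℕ.* (k ∸ a) !)
        ≡⟨ cong₂ _+_ (ℤ.pos-* a _) (ℤ.pos-* b _) ⟨
      + (a ℕ.* ((m P′ (a ∸ 1)) ℕ.* (k ∸ (a ∸ 1)) !) ℕ.+ b ℕ.* ((m P′ a) ℕ.* (k ∸ a) !))
        ≡⟨ cong +_ (arith a b a+b) ⟩
      + ((suc m P′ a) ℕ.* (suc k ∸ a) !) ∎
      where
      open ≡-Reasoning
      U = findUnused uL len
      open Unused U
      h : Fin N → ℤ
      h v = Σ-orderings k (v ∷ L) (λ w → indicator (does (A ⊆? prefix m w (v ∷ L))))
      a = length (missing A L)
      missing-unique : Unique (missing A L)
      missing-unique = Unique.filter⁺ (λ a → ¬? (a ∈? L)) uA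
      missing⇒ : ∀ {v} → v ∈ missing A L → v ∈ A × v ∉ L
      missing⇒ = ∈.∈-filter⁻ (λ a → ¬? (a ∈? L))
      rest : ∃ λ zs → unused ↭ missing A L ++ zs
      rest = unique-⊆-↭ missing-unique (λ v∈ → ∉⇒unused (proj₂ (missing⇒ v∈)))
      b = length (proj₁ rest)
      a+b : a ℕ.+ b ≡ suc k
      a+b = trans (sym (length-++ (missing A L))) (trans (sym (↭.↭-length (proj₂ rest))) unused-length)
      split = unique-++ (missing A L) (Unique-resp-↭ (proj₂ rest) unused-unique)
      value : ∀ {v} → v ∉ L → h v ≡ + ((m P′ length (missing A (v ∷ L))) ℕ.* (k ∸ length (missing A (v ∷ L))) !)
      value {v} v∉ = let u′ , len′ = fresh-cons v∉ uL len in count-covering k m A (v ∷ L) m≤k uA u′ len′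
      in-A : ∀ {v} → v ∈ missing A L → h v ≡ + ((m P′ (a ∸ 1)) ℕ.* (k ∸ (a ∸ 1)) !)
      in-A {v} v∈ = let v∈A , v∉L = missing⇒ v∈ in trans (value v∉L)
        (cong (λ z → + ((m P′ z) ℕ.* (k ∸ z) !)) (sym (cong (_∸ 1) (missing-∈ {A} v∈A v∉L uA))))
      out-A : ∀ {v} → v ∈ proj₁ rest → h v ≡ + ((m P′ a) ℕ.* (k ∸ a) !)
      out-A {v} v∈ = trans (value v∉L)
        (cong (λ z → + ((m P′ z) ℕ.* (k ∸ z) !)) (sym (missing-same {A} v∉A)))
        where
        v∉L : v ∉ L
        v∉L = unused-∉ (↭.∈-resp-↭ (↭-sym (proj₂ rest)) (∈.∈-++⁺ʳ (missing A L) v∈))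
        v∉A : v ∉ A
        v∉A v∈A = proj₂ split v∈ (∈.∈-filter⁺ (λ a → ¬? (a ∈? L)) v∈A v∉L)
      arith : ∀ a b → a ℕ.+ b ≡ suc k →
        a ℕ.* ((m P′ (a ∸ 1)) ℕ.* (k ∸ (a ∸ 1)) !) ℕ.+ b ℕ.* ((m P′ a) ℕ.* (k ∸ a) !) ≡ (suc m P′ a) ℕ.* (suc k ∸ a) !
      arith zero .(suc k) refl = lem (suc k) (k !)
        where
        open import Data.Nat.Tactic.RingSolver using () renaming (solve-∀ to solveℕ)
        lem : ∀ x y → x ℕ.* (1 ℕ.* y) ≡ 1 ℕ.* (x ℕ.* y)
        lem = solveℕ
      arith (suc a) zero eq with refl ← ℕ.suc-injective (trans (sym (ℕ.+-identityʳ (suc a))) eq) =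
        trans (ℕ.+-identityʳ _) (trans (sym (ℕ.*-assoc (suc a) (m P′ a) ((a ∸ a) !))) (cong (ℕ._* (a ∸ a) !) (sym
          (trans (P′-pascal m a) (trans (cong (ℕ._+_ (suc a ℕ.* (m P′ a))) (m<n⇒mP′n≡0 m (suc a) (ℕ.s≤s m≤k))) (ℕ.+-identityʳ _))))))
      arith (suc a) (suc b) eq with refl ← ℕ.suc-injective eq
        rewrite ℕ.m+n∸m≡n a (suc b) | trans (cong (_∸ suc a) (ℕ.+-suc a b)) (ℕ.m+n∸m≡n (suc a) b) =
        trans (lem (suc a) (m P′ a) (suc b) (b !) (m P′ suc a)) (cong (ℕ._* (suc b) !) (sym (P′-pascal m a)))
        where
        open import Data.Nat.Tactic.RingSolver using () renaming (solve-∀ to solveℕ)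
        lem : ∀ a p b f q → a ℕ.* (p ℕ.* (b ℕ.* f)) ℕ.+ b ℕ.* (q ℕ.* f) ≡ (a ℕ.* p ℕ.+ q) ℕ.* (b ℕ.* f)
        lem = solveℕ

-- The variance of a Lipschitz function of a random ordering.

module Variance where
  open import Defs
  open Scan
  open Orderings
  open import Data.Bool.Base using (true; false; if_then_else_)
  open import Data.Fin.Base using (Fin)
  import Data.Fin.Properties as Fin
  open import Data.Fin.Permutation.Components using (transpose; transpose-inverse)
  open import Data.Integer.Base as ℤ using (ℤ; +_; 0ℤ; 1ℤ; _+_; _*_; _-_; _≤_)
  import Data.Integer.Properties as ℤ
  open import Data.Integer.Tactic.RingSolver using (solve-∀)
  open import Data.List.Base using (List; []; _∷_; length; map; allFin; mapMaybe; cartesianProductWith)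
  open import Data.List.Properties using (length-map; length-tabulate)
  open import Data.List.Membership.Propositional using (_∈_; _∉_)
  import Data.List.Membership.Propositional.Properties as ∈
  import Data.List.Membership.DecPropositional as DecMembership
  open import Data.List.Relation.Unary.All as All using (All; []; _∷_)
  import Data.List.Relation.Unary.All.Properties as All
  open import Data.List.Relation.Unary.AllPairs using ([]; _∷_)
  open import Data.List.Relation.Unary.Any using (here; there)
  open import Data.List.Relation.Unary.Unique.Propositional using (Unique)
  import Data.List.Relation.Unary.Unique.Propositional.Properties as Unique
  open import Data.Nat.Base as ℕ using (ℕ; zero; suc; _!)
  import Data.Nat.Properties as ℕ
  open import Data.Product.Base using (_×_; _,_; proj₁)
  open import Data.Refinement.Base using (value)
  open import Data.Unit.Base using (tt)
  open import Data.Vec.Base as Vec using (Vec; []; _∷_)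
  open import Data.Vec.Relation.Unary.All as VecAll using ([]; _∷_)
  open import Data.Vec.Relation.Unary.AllPairs using (allPairs?; []; _∷_)
  import Data.Vec.Relation.Unary.Unique.Propositional as Vec
  open import Function.Base using (_∘_)
  open import Relation.Binary.PropositionalEquality
  open import Relation.Nullary.Decidable using (yes; no; does; ¬?; dec-true; dec-false; does-⇔)
  open import Function.Bundles using (mk⇔)

  transpose-fix : ∀ {n} (i j : Fin n) {k} → k ≢ i → k ≢ j → transpose i j k ≡ k
  transpose-fix i j {k} k≢i k≢j rewrite dec-false (k Fin.≟ i) k≢i | dec-false (k Fin.≟ j) k≢j = refl

  transpose-fst : ∀ {n} (i j : Fin n) → transpose i j i ≡ j
  transpose-fst i j rewrite dec-true (i Fin.≟ i) refl = refl

  module _ (N : ℕ) where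

    open DecMembership (Fin._≟_ {N}) using (_∈?_)

    module _ (π π⁻¹ : Fin N → Fin N) (inverseˡ : ∀ v → π⁻¹ (π v) ≡ v) (inverseʳ : ∀ v → π (π⁻¹ v) ≡ v) where

      private
        π-injective : ∀ {u v} → π u ≡ π v → u ≡ v
        π-injective {u} {v} eq = trans (sym (inverseˡ u)) (trans (cong π⁻¹ eq) (inverseˡ v))

      Σ-orderings-relabel : ∀ k L f →
        Σ-orderings N k (map π L) f ≡ Σ-orderings N k L (f ∘ Vec.map π)
      Σ-orderings-relabel zero    L f = refl
      Σ-orderings-relabel (suc k) L f = trans (Σᴸ-↭ _ (Fin-↭ N (map π (allFin N)) (Unique.map⁺ π-injective (Unique.allFin⁺ N))
          (trans (length-map π (allFin N)) (length-tabulate {n = N} (λ i → i)))))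
        (trans (Σᴸ-map _ π (allFin N)) (Σᴸ-cong (allFin N) (λ {v} _ → step v)))
        where
        ∈-unmap : ∀ {v L} → π v ∈ map π L → v ∈ L
        ∈-unmap i with ∈.∈-map⁻ π i
        ... | u , u∈ , eq = subst (_∈ _) (π-injective (sym eq)) u∈
        step : ∀ v → (if does (π v ∈? map π L) then 0ℤ else Σ-orderings N k (π v ∷ map π L) (f ∘ (π v ∷_))) ≡
                     (if does (v ∈? L) then 0ℤ else Σ-orderings N k (v ∷ L) (f ∘ Vec.map π ∘ (v ∷_)))
        step v = cong₂ (λ b z → if b then 0ℤ else z)
          (does-⇔ (mk⇔ ∈-unmap (∈.∈-map⁺ π)) (π v ∈? map π L) (v ∈? L))
          (Σ-orderings-relabel k (v ∷ L) (f ∘ (π v ∷_)))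

    -- A transposition is its own inverse, so the one inequality bounds the change in both
    -- directions. As only letters outside `L` are exchanged, the condition passes to `f` with its
    -- first letter fixed.
    Lipschitz : ℕ → ∀ {k} → List (Fin N) → (Vec (Fin N) k → ℤ) → Set
    Lipschitz D L f = ∀ u v → u ∉ L → v ∉ L → ∀ w → Fresh N L w →
      f (Vec.map (transpose u v) w) ≤ f w + + D

    private
      lipschitz-tail : ∀ {D k L f v} → v ∉ L → Lipschitz D {suc k} L f → Lipschitz D (v ∷ L) (f ∘ (v ∷_))
      lipschitz-tail {D} {L = L} {f} {v} v∉ lip x y x∉ y∉ w fr =
        subst (λ z → f (z ∷ Vec.map (transpose x y) w) ≤ f (v ∷ w) + + D)
          (transpose-fix x y (λ eq → x∉ (here (sym eq))) (λ eq → y∉ (here (sym eq))))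
          (lip x y (x∉ ∘ there) (y∉ ∘ there) (v ∷ w) (v∉ , fr))

      -- Exchanging `u` and `v` everywhere matches the words that begin with `u` to those that begin
      -- with `v`, and the two sums are then compared term by term.
      group-≤ : ∀ {D k L f} → Unique L → length L ℕ.+ suc k ≡ N → Lipschitz D {suc k} L f →
                ∀ {u v} → u ∉ L → v ∉ L →
                Σ-orderings N k (v ∷ L) (f ∘ (v ∷_)) ≤ Σ-orderings N k (u ∷ L) (f ∘ (u ∷_)) + + (k ! ℕ.* D)
      group-≤ {D} {k} {L} {f} uL len lip {u} {v} u∉ v∉ = begin
        Σ-orderings N k (v ∷ L) (f ∘ (v ∷_))
          ≡⟨ cong₂ (λ x M → Σ-orderings N k (x ∷ M) (f ∘ (x ∷_))) (transpose-fst u v) (fixL L u∉ v∉) ⟨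
        Σ-orderings N k (map π (u ∷ L)) (f ∘ (π u ∷_))
          ≡⟨ Σ-orderings-relabel π (transpose v u) (λ _ → transpose-inverse v u) (λ _ → transpose-inverse u v) k (u ∷ L) _ ⟩
        Σ-orderings N k (u ∷ L) (f ∘ Vec.map π ∘ (u ∷_))
          ≤⟨ Σ-orderings-mono N k (u ∷ L) (λ w fr → lip u v u∉ v∉ (u ∷ w) (u∉ , fr)) ⟩
        Σ-orderings N k (u ∷ L) (λ w → f (u ∷ w) + + D)
          ≡⟨ Σ-orderings-+ N k (u ∷ L) _ _ ⟩
        Σ-orderings N k (u ∷ L) (f ∘ (u ∷_)) + Σ-orderings N k (u ∷ L) (λ _ → + D)
          ≡⟨ cong (_+_ (Σ-orderings N k (u ∷ L) (f ∘ (u ∷_)))) (let u′ , len′ = fresh-cons N u∉ uL len in Σ-orderings-const N k (u ∷ L) (+ D) u′ len′) ⟩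
        Σ-orderings N k (u ∷ L) (f ∘ (u ∷_)) + + (k !) * + D
          ≡⟨ cong (_+_ (Σ-orderings N k (u ∷ L) (f ∘ (u ∷_)))) (ℤ.pos-* (k !) D) ⟨
        Σ-orderings N k (u ∷ L) (f ∘ (u ∷_)) + + (k ! ℕ.* D) ∎
        where
        open ℤ.≤-Reasoning
        π : Fin N → Fin N
        π = transpose u v
        fixL : ∀ M → u ∉ M → v ∉ M → map π M ≡ M
        fixL []      _  _  = refl
        fixL (x ∷ M) u∉ v∉ = cong₂ _∷_
          (transpose-fix u v (λ eq → u∉ (here (sym eq))) (λ eq → v∉ (here (sym eq))))
          (fixL M (u∉ ∘ there) (v∉ ∘ there))

    -- Law of total variance: split according to the first element.
    variance-bound : ∀ D k L f → Unique L → length L ℕ.+ k ≡ N → Lipschitz D L f →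
      + (k !) * Σ-orderings N k L (λ w → f w * f w) - Σ-orderings N k L f * Σ-orderings N k L f ≤
      + (k ℕ.* (D ℕ.* D)) * (+ (k !) * + (k !))
    variance-bound D zero L f _ _ _ = ℤ.≤-reflexive (lem (f []))
      where
      lem : ∀ x → 1ℤ * (x * x) - x * x ≡ 0ℤ
      lem = solve-∀
    variance-bound D (suc k) L f uL len lip = begin
      + (suc k !) * Σ-orderings N (suc k) L (λ w → f w * f w) - Σ-orderings N (suc k) L f * Σ-orderings N (suc k) L f
        ≡⟨ cong₂ (λ a b → + (suc k !) * a - b * b) (Σ-unused N U _) (Σ-unused N U _) ⟩
      + (suc k !) * Σᴸ S unused - Σᴸ m unused * Σᴸ m unused
        ≡⟨ cong (λ z → z * Σᴸ S unused - Σᴸ m unused * Σᴸ m unused) factorial ⟩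
      n * M * Σᴸ S unused - Σᴸ m unused * Σᴸ m unused
        ≤⟨ ℤ.+-monoˡ-≤ _ within ⟩
      n * (Σᴸ (λ v → m v * m v) unused + n * (+ (k ℕ.* (D ℕ.* D)) * (M * M))) - Σᴸ m unused * Σᴸ m unused
        ≡⟨ regroup n (Σᴸ (λ v → m v * m v) unused) (n * (+ (k ℕ.* (D ℕ.* D)) * (M * M))) (Σᴸ m unused) ⟩
      (n * Σᴸ (λ v → m v * m v) unused - Σᴸ m unused * Σᴸ m unused) + n * (n * (+ (k ℕ.* (D ℕ.* D)) * (M * M)))
        ≤⟨ ℤ.+-monoˡ-≤ _ between ⟩
      n * (n * (+ (k ! ℕ.* D) * + (k ! ℕ.* D))) + n * (n * (+ (k ℕ.* (D ℕ.* D)) * (M * M)))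
        ≡⟨ cong₂ (λ x y → n * (n * (x * x)) + n * (n * (y * (M * M)))) (ℤ.pos-* (k !) D) (trans (ℤ.pos-* k (D ℕ.* D)) (cong (+ k *_) (ℤ.pos-* D D))) ⟩
      n * (n * (M * + D * (M * + D))) + n * (n * (+ k * (+ D * + D) * (M * M)))
        ≡⟨ collect n M (+ D) (+ k) ⟩
      (1ℤ + + k) * (+ D * + D) * (n * M * (n * M))
        ≡⟨ cong₂ (λ x y → x * (y * y)) (trans (ℤ.pos-* (suc k) (D ℕ.* D)) (cong (+ suc k *_) (ℤ.pos-* D D))) factorial ⟨
      + (suc k ℕ.* (D ℕ.* D)) * (+ (suc k !) * + (suc k !)) ∎
      where
      open ℤ.≤-Reasoning
      U = findUnused N uL len
      open Unused U
      n M : ℤ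
      n = + suc k
      M = + (k !)
      m S : Fin N → ℤ
      m v = Σ-orderings N k (v ∷ L) (f ∘ (v ∷_))
      S v = Σ-orderings N k (v ∷ L) (λ w → f (v ∷ w) * f (v ∷ w))
      factorial : + (suc k !) ≡ n * M
      factorial = ℤ.pos-* (suc k) (k !)
      B = + (k ℕ.* (D ℕ.* D)) * (M * M)
      regroup : ∀ n a b s → n * (a + b) - s * s ≡ (n * a - s * s) + n * b
      regroup = solve-∀
      collect : ∀ n M D k → n * (n * (M * D * (M * D))) + n * (n * (k * (D * D) * (M * M))) ≡
                (1ℤ + k) * (D * D) * (n * M * (n * M))
      collect = solve-∀
      within : n * M * Σᴸ S unused ≤ n * (Σᴸ (λ v → m v * m v) unused + n * B)
      within = ℤ.≤-trans (ℤ.≤-reflexive (ℤ.*-assoc n M (Σᴸ S unused)))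
        (*-monoʳ-≤ (suc k) (ℤ.≤-trans (ℤ.≤-reflexive (sym (Σᴸ-* M S unused)))
          (ℤ.≤-trans (Σᴸ-mono unused each) (ℤ.≤-reflexive (trans (Σᴸ-+ (λ v → m v * m v) (λ _ → B) unused)
            (cong (_+_ (Σᴸ (λ v → m v * m v) unused)) (trans (Σᴸ-const B unused) (cong (λ l → + l * B) unused-length))))))))
        where
        each : ∀ {v} → v ∈ unused → M * S v ≤ m v * m v + B
        each {v} v∈ = let v∉ = unused-∉ v∈ ; u′ , len′ = fresh-cons N v∉ uL len in
          shift (variance-bound D k (v ∷ L) (f ∘ (v ∷_)) u′ len′ (lipschitz-tail {f = f} v∉ lip))
          where
          shift : ∀ {a b c} → a - b ≤ c → a ≤ b + c
          shift {a} {b} {c} le = ℤ.≤-trans (ℤ.≤-reflexive (lem a b)) (ℤ.+-monoʳ-≤ b le)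
            where
            lem : ∀ a b → a ≡ b + (a - b)
            lem = solve-∀
      between : n * Σᴸ (λ v → m v * m v) unused - Σᴸ m unused * Σᴸ m unused ≤
                n * (n * (+ (k ! ℕ.* D) * + (k ! ℕ.* D)))
      between = subst (λ l → + l * Σᴸ (λ v → m v * m v) unused - Σᴸ m unused * Σᴸ m unused ≤
                             + l * (+ l * (+ (k ! ℕ.* D) * + (k ! ℕ.* D)))) unused-length
        (go unused unused-∉)
        where
        le-minus : ∀ {a b c} → a ≤ b + c → a - b ≤ c
        le-minus {a} {b} {c} le = ℤ.≤-trans (ℤ.+-monoˡ-≤ (ℤ.- b) le) (ℤ.≤-reflexive (lem b c))
          where
          lem : ∀ b c → b + c - b ≡ c
          lem = solve-∀
        go : ∀ us → (∀ {v} → v ∈ us → v ∉ L) →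
          + length us * Σᴸ (λ v → m v * m v) us - Σᴸ m us * Σᴸ m us ≤
          + length us * (+ length us * (+ (k ! ℕ.* D) * + (k ! ℕ.* D)))
        go [] _ = ℤ.≤-refl
        go us@(u ∷ _) ∉L = variance-≤ m (m u) _ us λ {v} v∈ →
          square-mono (m v - m u) (k ! ℕ.* D)
            (le-minus {m v} {m u} (group-≤ {D} {k} {L} {f} uL len lip (∉L (here refl)) (∉L v∈)))
            (subst (_≤ + (k ! ℕ.* D)) (neg (m v) (m u))
              (le-minus {m u} {m v} (group-≤ {D} {k} {L} {f} uL len lip (∉L v∈) (∉L (here refl)))))
          where
          neg : ∀ a b → b - a ≡ ℤ.- (a - b)
          neg = solve-∀

  module _ (G : Graph) where
    open Graph G renaming (order to N)
    open DecMembership (Fin._≟_ {N}) using (_∈?_)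

    private
      restrict : ∀ {k} → List (Fin N) → (Vec (Fin N) k → ℤ) → Vec (Fin N) k → ℤ
      restrict L f w = if does (fresh? N L w) then f w else 0ℤ

      Σ-words : ∀ k L f → Σᴸ (restrict L f) (words G k) ≡ Σ-orderings N k L f
      Σ-words zero L f = ℤ.+-identityʳ _
      Σ-words (suc k) L f = trans (product (allFin N)) (Σᴸ-cong (allFin N) (λ {v} _ → step v))
        where
        product : ∀ xs → Σᴸ (restrict L f) (cartesianProductWith _∷_ xs (words G k)) ≡
                         Σᴸ (λ v → Σᴸ (restrict L f ∘ (v ∷_)) (words G k)) xs
        product []       = refl
        product (x ∷ xs) = trans (Σᴸ-++ (restrict L f) (map (x ∷_) (words G k)) _)
          (cong₂ _+_ (Σᴸ-map (restrict L f) (x ∷_) (words G k)) (product xs))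
        step : ∀ v → Σᴸ (restrict L f ∘ (v ∷_)) (words G k) ≡
                     (if does (v ∈? L) then 0ℤ else Σ-orderings N k (v ∷ L) (f ∘ (v ∷_)))
        step v with does (v ∈? L)
        ... | true  = trans (Σᴸ-const 0ℤ (words G k)) (ℤ.*-zeroʳ (+ length (words G k)))
        ... | false = Σ-words k (v ∷ L) (f ∘ (v ∷_))

      fresh⇒unique : ∀ {k} L (w : Vec (Fin N) k) → Fresh N L w → Vec.Unique w × VecAll.All (_∉ L) w
      fresh⇒unique L []      _         = [] , []
      fresh⇒unique L (v ∷ w) (v∉ , fr) with fresh⇒unique (v ∷ L) w fr
      ... | u , all = VecAll.map (λ x∉ v≡x → x∉ (here (sym v≡x))) all ∷ u , v∉ ∷ VecAll.map (_∘ there) all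

      unique⇒fresh : ∀ {k} L (w : Vec (Fin N) k) → Vec.Unique w → VecAll.All (_∉ L) w → Fresh N L w
      unique⇒fresh L []      _        _          = tt
      unique⇒fresh L (v ∷ w) (v≢ ∷ u) (v∉ ∷ all) = v∉ , unique⇒fresh (v ∷ L) w u
        (VecAll.map (λ (v≢x , x∉) → λ { (here x≡v) → v≢x (sym x≡v) ; (there x∈) → x∉ x∈ }) (VecAll.zip (v≢ , all)))

    fresh⇒Unique : ∀ {k} {w : Vec (Fin N) k} → Fresh N [] w → Vec.Unique w
    fresh⇒Unique {w = w} fr = proj₁ (fresh⇒unique [] w fr)

    -- The bridge from the game to the counting: the game filters all words for repetitions, while
    -- `Σ-orderings` never creates one.
    Σ-permutations : (f : Vec (Fin N) N → ℤ) → Σᴸ (f ∘ value) (permutations G) ≡ Σ-orderings N N [] f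
    Σ-permutations f = trans (unwrap (words G N)) (Σ-words N [] f)
      where
      unwrap : ∀ ws → Σᴸ (f ∘ value) (mapMaybe (asPermutation G) ws) ≡ Σᴸ (restrict [] f) ws
      unwrap [] = refl
      unwrap (w ∷ ws) with allPairs? (λ u v → ¬? (u Fin.≟ v)) w
      ... | yes u rewrite dec-true (fresh? N [] w) (unique⇒fresh [] w u (VecAll.universal (λ _ ()) w)) =
        cong (_+_ (f w)) (unwrap ws)
      ... | no ¬u rewrite dec-false (fresh? N [] w) (λ fr → ¬u (fresh⇒Unique fr)) =
        trans (unwrap ws) (sym (ℤ.+-identityˡ _))

-- Configurations on a drawn lattice, and polynomials that bound their clusters.

module Model where
  open import Defs
  open Clusters
  open Scan
  open Orderings
  open Variance
  open import Data.Bool.Base using (Bool; true; false; if_then_else_; _∧_)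
  open import Data.Bool.ListAction using (all)
  open import Data.Fin.Base as Fin using (Fin; zero; suc; _↑ˡ_; _↑ʳ_; splitAt; inject≤)
  import Data.Fin.Properties as Fin
  open import Data.Fin.Permutation.Components using (transpose; transpose-inverse)
  open import Data.Integer.Base as ℤ using (ℤ; +_; 0ℤ; 1ℤ; _+_; _*_; _-_; _≤_; ∣_∣)
  import Data.Integer.Properties as ℤ
  open import Data.Integer.Tactic.RingSolver using (solve-∀)
  open import Data.List.Base using (List; []; _∷_; length; map; allFin; concatMap; lookup)
  open import Data.List.Properties using (length-++; length-map; length-tabulate)
  open import Data.List.Membership.Propositional using (_∈_)
  import Data.List.Membership.Propositional.Properties as ∈
  import Data.List.Membership.DecPropositional as DecMembership
  import Data.List.Relation.Binary.Permutation.Propositional.Properties as ↭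
  open import Data.List.Relation.Unary.All as All using (All; []; _∷_)
  import Data.List.Relation.Unary.All.Properties as All
  open import Data.List.Relation.Unary.AllPairs as AllPairs using (AllPairs; []; _∷_)
  open import Data.List.Relation.Unary.Any using (here; there)
  open import Data.List.Relation.Unary.Unique.Propositional using (Unique)
  open import Data.Nat.Base as ℕ using (ℕ; zero; suc; _!; _∸_)
  open import Data.Nat.Combinatorics.Base using (_P′_)
  open import Data.Nat.ListAction using (sum)
  import Data.Nat.Properties as ℕ
  open import Data.Product.Base using (∃; _×_; _,_; proj₁; proj₂)
  open import Data.Sum.Base using (_⊎_; inj₁; inj₂)
  open import Data.Vec.Base as Vec using (Vec; []; _∷_)
  import Data.Vec.Properties as Vec
  import Data.Vec.Relation.Unary.Unique.Propositional as Vec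
  import Data.Vec.Relation.Unary.Unique.Propositional.Properties as VecUnique
  open import Function.Base using (_∘_)
  open import Function.Bundles using (mk⇔)
  open import Level using (0ℓ)
  open import Relation.Binary.Core using (Rel)
  open import Relation.Binary.Definitions using (DecidableEquality; Symmetric; Asymmetric; Transitive; Trichotomous)
  open import Relation.Binary.PropositionalEquality
  open import Relation.Nullary.Decidable using (Dec; yes; no; does; dec-true; does-⇔; decidable-stable)
  open import Relation.Nullary.Negation using (contradiction)

  lookup-injective : ∀ {A : Set} {xs : List A} → Unique xs → ∀ {i j} → lookup xs i ≡ lookup xs j → i ≡ j
  lookup-injective {xs = x ∷ xs} (x≢ ∷ u) {zero}  {zero}  eq = refl
  lookup-injective {xs = x ∷ xs} (x≢ ∷ u) {zero}  {suc j} eq = contradiction eq (All.lookup x≢ (∈.∈-lookup j))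
  lookup-injective {xs = x ∷ xs} (x≢ ∷ u) {suc i} {zero}  eq = contradiction (sym eq) (All.lookup x≢ (∈.∈-lookup i))
  lookup-injective {xs = x ∷ xs} (x≢ ∷ u) {suc i} {suc j} eq = cong suc (lookup-injective u eq)

  ∈-prefix⁺ : ∀ N m {k} (le : m ℕ.≤ k) (w : Vec (Fin N) k) L →
              (∀ {v} → v ∈ L → v ∈ prefix N m w L) × (∀ i → Vec.lookup (Vec.truncate le w) i ∈ prefix N m w L)
  ∈-prefix⁺ N zero    le         w       L = (λ v∈ → v∈) , λ ()
  ∈-prefix⁺ N (suc m) (ℕ.s≤s le) (x ∷ w) L with ∈-prefix⁺ N m le w (x ∷ L)
  ... | old , new = (λ v∈ → old (there v∈)) , λ { zero → old (here refl) ; (suc i) → new i }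

  ∈-prefix⁻ : ∀ N m {k} (le : m ℕ.≤ k) (w : Vec (Fin N) k) L {v} → v ∈ prefix N m w L →
              v ∈ L ⊎ (∃ λ i → Vec.lookup (Vec.truncate le w) i ≡ v)
  ∈-prefix⁻ N zero    le         w       L v∈ = inj₁ v∈
  ∈-prefix⁻ N (suc m) (ℕ.s≤s le) (x ∷ w) L v∈ with ∈-prefix⁻ N m le w (x ∷ L) v∈
  ... | inj₁ (here refl)  = inj₂ (zero , refl)
  ... | inj₁ (there v∈L)  = inj₁ v∈L
  ... | inj₂ (i , eq)     = inj₂ (suc i , eq)

  all-true : ∀ {A : Set} (s : A → Bool) xs → all s xs ≡ true → All (λ x → s x ≡ true) xs
  all-true s []       _  = []
  all-true s (x ∷ xs) eq with s x in sx
  ... | true = sx ∷ all-true s xs eq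

  -- A monomial (c , A) is c times the indicator that all vertices in A are open.
  Polynomial : Set → Set
  Polynomial P = List (ℤ × List P)

  evalMonomial : {P : Set} → (P → Bool) → ℤ × List P → ℤ
  evalMonomial s (c , A) = c * (if all s A then 1ℤ else 0ℤ)

  eval : {P : Set} → (P → Bool) → Polynomial P → ℤ
  eval s = Σᴸ (evalMonomial s)

  -- By the symmetry of a random ordering the expectation of a monomial depends only on its degree,
  -- so this is all that survives averaging.
  Profile : Set
  Profile = List (ℤ × ℕ)

  profile : {P : Set} → Polynomial P → Profile
  profile = map (λ (c , A) → c , length A)

  negate : {A : Set} → List (ℤ × A) → List (ℤ × A)
  negate = map (λ (c , A) → ℤ.- c , A)

  norm : {A : Set} → List (ℤ × A) → ℕ
  norm []            = 0
  norm ((c , _) ∷ p) = ∣ c ∣ ℕ.+ norm p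

  module _ {P : Set} (s : P → Bool) where

    eval-negate : ∀ p → eval s (negate p) ≡ ℤ.- eval s p
    eval-negate []            = refl
    eval-negate ((c , A) ∷ p) rewrite eval-negate p = lem c (if all s A then 1ℤ else 0ℤ) (eval s p)
      where
      lem : ∀ a b c → (ℤ.- a) * b + ℤ.- c ≡ ℤ.- (a * b + c)
      lem = solve-∀

    eval-≤-norm : ∀ p → eval s p ≤ + norm p
    eval-≤-norm []            = ℤ.≤-refl
    eval-≤-norm ((c , A) ∷ p) = ℤ.≤-trans (ℤ.+-mono-≤ (step (all s A)) (eval-≤-norm p)) (ℤ.≤-reflexive (sym (ℤ.pos-+ ∣ c ∣ (norm p))))
      where
      ≤∣∣ : ∀ c → c ≤ + ∣ c ∣
      ≤∣∣ (+ n)      = ℤ.≤-refl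
      ≤∣∣ ℤ.-[1+ n ] = ℤ.-≤+
      step : ∀ b → c * (if b then 1ℤ else 0ℤ) ≤ + ∣ c ∣
      step true  = subst (_≤ + ∣ c ∣) (sym (ℤ.*-identityʳ c)) (≤∣∣ c)
      step false = subst (_≤ + ∣ c ∣) (sym (ℤ.*-zeroʳ c)) (ℤ.+≤+ ℕ.z≤n)

  profile-negate : {P : Set} (p : Polynomial P) → profile (negate p) ≡ negate (profile p)
  profile-negate []            = refl
  profile-negate ((c , A) ∷ p) = cong (_ ∷_) (profile-negate p)

  -- N! times the expectation of a polynomial with the given profile when m of the N
  -- vertices are open.
  moment : ℕ → ℕ → Profile → ℤ
  moment N m = Σᴸ (λ (c , a) → c * + ((m P′ a) ℕ.* (N ∸ a) !))

  total : (G : Graph) → (𝒮 G → Time G) → ℕ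
  total G τ = sum (map (λ σ → C̃ G (τ σ) σ) (permutations G))

  clustersOf : (G : Graph) → ∀ {m} → m ℕ.≤ Graph.order G → Vec (Graph.Vertex G) (Graph.order G) → ℕ
  clustersOf G le w = components (induced G (Vec.truncate le w))

  -- The graphs of the game number their vertices. A drawing moves the arguments to coordinates,
  -- where neighbourhoods are translates of each other, and lets a handier relation replace the
  -- adjacency.
  record Drawing {P : Set} (G : Graph) (vs : List P) (R : Rel P 0ℓ) : Set where
    open Graph G
    field
      ℓ           : Vertex → P
      ℓ-injective : ∀ {i j} → ℓ i ≡ ℓ j → i ≡ j
      ℓ-∈         : ∀ i → ℓ i ∈ vs
      ℓ-onto      : ∀ {p} → p ∈ vs → ∃ λ i → ℓ i ≡ p
      vs-length   : length vs ≡ order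
      adj⇒        : ∀ {i j} → Adj i j → R (ℓ i) (ℓ j)
      adj⇐        : ∀ {i j} → R (ℓ i) (ℓ j) → Adj i j

  module OnPoints {P : Set} (_≟_ : DecidableEquality P) (vs : List P) (vs! : Unique vs)
                  (R : Rel P 0ℓ) (R-sym : Symmetric R) (G : Graph) (drawing : Drawing G vs R) where

    open Graph G using () renaming (order to N)
    open Drawing drawing
    open DecMembership _≟_ using () renaming (_∈?_ to _∈ᴾ?_)
    open DecMembership (Fin._≟_ {N}) using (_∈?_)

    opened : ∀ {m} → m ℕ.≤ N → Vec (Fin N) N → P → Bool
    opened {m} le w p = does (p ∈ᴾ? map ℓ (prefix N m w []))

    does⇒ : ∀ {A : Set} (d : Dec A) → does d ≡ true → A
    does⇒ (yes a) _ = a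

    module _ {m} (le : m ℕ.≤ N) (w : Vec (Fin N) N) where

      Occupied : P → Set
      Occupied p = ∃ λ i → ℓ (Vec.lookup (Vec.truncate le w) i) ≡ p

      occupied⇒opened : ∀ {p} → Occupied p → opened le w p ≡ true
      occupied⇒opened (i , refl) = dec-true (_ ∈ᴾ? map ℓ (prefix N m w []))
        (∈.∈-map⁺ ℓ (proj₂ (∈-prefix⁺ N m le w []) i))

      opened⇒occupied : ∀ {p} → opened le w p ≡ true → Occupied p
      opened⇒occupied {p} eq with ∈.∈-map⁻ ℓ (does⇒ (p ∈ᴾ? map ℓ (prefix N m w [])) eq)
      ... | v , v∈ , refl with ∈-prefix⁻ N m le w [] v∈
      ... | inj₂ (i , refl) = i , refl

      opened⇒∈ : ∀ p → opened le w p ≡ true → p ∈ vs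
      opened⇒∈ p eq with opened⇒occupied eq
      ... | i , refl = ℓ-∈ (Vec.lookup (Vec.truncate le w) i)

      module _ (w! : Vec.Unique w) where

        private
          inj : ∀ {i j} → ℓ (Vec.lookup (Vec.truncate le w) i) ≡ ℓ (Vec.lookup (Vec.truncate le w) j) → i ≡ j
          inj {i} {j} eq = Fin.inject≤-injective le le i j (VecUnique.lookup-injective w! _ _
            (trans (sym (Vec.lookup-truncate le w i)) (trans (ℓ-injective eq) (Vec.lookup-truncate le w j))))

        clusters-≤ : ∀ {k} → Covered R R-sym Occupied k → clustersOf G le w ℕ.≤ k
        clusters-≤ = components-≤ R R-sym _ _ inj adj⇒ adj⇐

        clusters-≥ : ∀ {k} → Separated R R-sym Occupied k → k ℕ.≤ clustersOf G le w
        clusters-≥ = components-≥ R R-sym _ _ inj adj⇒ adj⇐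

        clusters-covered : Covered R R-sym Occupied (clustersOf G le w)
        clusters-covered = components-covered R R-sym _ _ inj adj⇒ adj⇐

    covered-≤ : ∀ {X k k′} → k ℕ.≤ k′ → Covered R R-sym X k → Covered R R-sym X k′
    covered-≤ k≤ (L , L≤ , cov) = L , ℕ.≤-trans L≤ k≤ , cov

    -- Each of the `d` new vertices is added to the covering list as its own representative.
    clusters-step : ∀ a d (le : a ℕ.+ d ℕ.≤ N) (le′ : a ℕ.≤ N) w → Vec.Unique w →
                    clustersOf G le w ℕ.≤ d ℕ.+ clustersOf G le′ w
    clusters-step a d le le′ w w! = clusters-≤ le w w! (covered-≤
      (ℕ.≤-reflexive (cong (ℕ._+ clustersOf G le′ w) (trans (length-map new (allFin d)) (length-tabulate {n = d} (λ i → i)))))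
      (covered-extend R R-sym (map new (allFin d)) old⊆ ⊆new (clusters-covered le′ w w!)))
      where
      new : Fin d → P
      new j = ℓ (Vec.lookup (Vec.truncate le w) (a ↑ʳ j))
      same : ∀ j → Vec.lookup (Vec.truncate le w) (j ↑ˡ d) ≡ Vec.lookup (Vec.truncate le′ w) j
      same j = trans (Vec.lookup-truncate le w _) (trans
        (cong (Vec.lookup w) (Fin.toℕ-injective (trans (Fin.toℕ-inject≤ _ le) (trans (Fin.toℕ-↑ˡ j d) (sym (Fin.toℕ-inject≤ j le′))))))
        (sym (Vec.lookup-truncate le′ w j)))
      old⊆ : ∀ {p} → Occupied le′ w p → Occupied le w p
      old⊆ (j , refl) = j ↑ˡ d , cong ℓ (same j)
      ⊆new : ∀ {p} → Occupied le w p → p ∈ map new (allFin d) ⊎ Occupied le′ w p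
      ⊆new (i , refl) with splitAt a i in eq
      ... | inj₁ j rewrite sym (Fin.splitAt⁻¹-↑ˡ eq) = inj₂ (j , cong ℓ (sym (same j)))
      ... | inj₂ j rewrite sym (Fin.splitAt⁻¹-↑ʳ eq) = inj₁ (∈.∈-map⁺ new (∈.∈-allFin j))

    module _ (nb : P → List P) (nb-length : ∀ p → length (nb p) ℕ.≤ 6) (nb-∈ : ∀ {p q} → R q p → q ∈ nb p) where

      -- Exchanging u and v deletes at most two vertices (6 new clusters each) and adds at most two.
      clusters-lipschitz : ∀ {m} (le : m ℕ.≤ N) → Lipschitz N 14 [] (λ w → + clustersOf G le w)
      clusters-lipschitz le u v _ _ w fr = subst (+ clustersOf G le w′ ≤_) (trans (ℤ.pos-+ 14 c) (ℤ.+-comm (+ 14) (+ c)))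
        (ℤ.+≤+ (clusters-≤ le w′ w′! (covered-extend R R-sym (ℓ u ∷ ℓ v ∷ []) Z⊆Y Y⊆
          (delete (ℓ v) (delete (ℓ u) (clusters-covered le w w!))))))
        where
        c = clustersOf G le w
        π = transpose u v
        w′ = Vec.map π w
        w! = fresh⇒Unique G fr
        w′! = VecUnique.map⁺ (λ eq → trans (sym (transpose-inverse v u)) (trans (cong (transpose v u) eq) (transpose-inverse v u))) w!
        X Y Z : P → Set
        X = Occupied le w
        Y = Occupied le w′
        _without_ : (P → Set) → P → P → Set
        (S without q) p = S p × p ≢ q
        Z = (X without ℓ u) without ℓ v
        delete : ∀ {S k} q → Covered R R-sym S k → Covered R R-sym (S without q) (6 ℕ.+ k)
        delete {S} {k} q = covered-≤ (ℕ.+-monoˡ-≤ k (nb-length q)) ∘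
          covered-delete R R-sym (proj₁ , λ {p} sp → split p sp) (nb q) nb-∈
          where
          split : ∀ p → S p → p ≡ q ⊎ (S without q) p
          split p sp with p ≟ q
          ... | yes eq = inj₁ eq
          ... | no ne  = inj₂ (sp , ne)
        truncate-map : ∀ i → Vec.lookup (Vec.truncate le w′) i ≡ π (Vec.lookup (Vec.truncate le w) i)
        truncate-map i = trans (Vec.lookup-truncate le w′ i) (trans (Vec.lookup-map (inject≤ i le) π w)
          (cong π (sym (Vec.lookup-truncate le w i))))
        Z⊆Y : ∀ {p} → Z p → Y p
        Z⊆Y (((i , refl) , ≢u) , ≢v) = i , cong ℓ (trans (truncate-map i) (transpose-fix u v (≢u ∘ cong ℓ) (≢v ∘ cong ℓ)))
        Y⊆ : ∀ {p} → Y p → p ∈ ℓ u ∷ ℓ v ∷ [] ⊎ Z p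
        Y⊆ (i , refl) with Vec.lookup (Vec.truncate le w′) i in eq
        ... | y with y Fin.≟ u | y Fin.≟ v
        ... | yes refl | _ = inj₁ (here refl)
        ... | no _ | yes refl = inj₁ (there (here refl))
        ... | no y≢u | no y≢v = inj₂ (((i , cong ℓ x≡y) , y≢u ∘ ℓ-injective) , y≢v ∘ ℓ-injective)
          where
          x≡y : Vec.lookup (Vec.truncate le w) i ≡ y
          x≡y = trans (sym (transpose-inverse v u)) (trans (cong (transpose v u) (trans (sym (truncate-map i)) eq)) (transpose-fix v u y≢v y≢u))

    Supported : (P → Bool) → Set
    Supported s = ∀ p → s p ≡ true → p ∈ vs

    -- A repeated point would overstate the degree of the monomial, and a point outside the lattice
    -- is never open; either would falsify the moment formula.
    Valid : List P → Set
    Valid A = Unique A × All (_∈ vs) A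

    Σ-monomial : ∀ {m} (le : m ℕ.≤ N) A → Valid A →
      Σ-orderings N N [] (λ w → if all (opened le w) A then 1ℤ else 0ℤ) ≡ + ((m P′ length A) ℕ.* (N ∸ length A) !)
    Σ-monomial {m} le A (uA , A⊆) = subst
      (λ B → Σ-orderings N N [] (λ w → if all (opened le w) B then 1ℤ else 0ℤ) ≡ + ((m P′ length B) ℕ.* (N ∸ length B) !))
      (index-lookup A⊆)
      (trans (Σ-orderings-cong N N [] (λ w _ → cong (λ b → if b then 1ℤ else 0ℤ) (all-map w I)))
        (trans (count-covering N N m I [] le (index-unique uA A⊆) [] refl)
          (cong (λ l → + ((m P′ l) ℕ.* (N ∸ l) !)) (trans (none I) (sym (length-map ℓ I))))))
      where
      index : ∀ {A} → All (_∈ vs) A → List (Fin N)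
      index []       = []
      index (i ∷ is) = proj₁ (ℓ-onto i) ∷ index is
      I = index A⊆
      index-lookup : ∀ {A} (is : All (_∈ vs) A) → map ℓ (index is) ≡ A
      index-lookup []       = refl
      index-lookup (i ∷ is) = cong₂ _∷_ (proj₂ (ℓ-onto i)) (index-lookup is)
      index-unique : ∀ {A} → Unique A → (is : All (_∈ vs) A) → Unique (index is)
      index-unique [] [] = []
      index-unique (a≢ ∷ u) (i ∷ is) = fresh a≢ is ∷ index-unique u is
        where
        fresh : ∀ {B} → All (_ ≢_) B → (js : All (_∈ vs) B) → All (proj₁ (ℓ-onto i) ≢_) (index js)
        fresh [] [] = []
        fresh (a≢b ∷ a≢) (j ∷ js) = (λ eq → a≢b (trans (sym (proj₂ (ℓ-onto i))) (trans (cong ℓ eq) (proj₂ (ℓ-onto j))))) ∷ fresh a≢ js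
      all-map : ∀ w I → all (opened le w) (map ℓ I) ≡ does (_⊆?_ N I (prefix N m w []))
      all-map w []      = refl
      all-map w (i ∷ I) = cong₂ _∧_
        (does-⇔ (mk⇔ unmap (∈.∈-map⁺ ℓ)) (ℓ i ∈ᴾ? map ℓ (prefix N m w [])) (i ∈? prefix N m w []))
        (all-map w I)
        where
        unmap : ℓ i ∈ map ℓ (prefix N m w []) → i ∈ prefix N m w []
        unmap ∈map with ∈.∈-map⁻ ℓ ∈map
        ... | j , j∈ , eq = subst (_∈ _) (sym (ℓ-injective eq)) j∈
      none : ∀ I → length (missing N I []) ≡ length I
      none []      = refl
      none (i ∷ I) = cong suc (none I)

    Σ-eval : ∀ {m} (le : m ℕ.≤ N) p → All (λ (c , A) → Valid A) p →
             Σ-orderings N N [] (λ w → eval (opened le w) p) ≡ moment N m (profile p)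
    Σ-eval le [] [] = Σ-orderings-0 N N []
    Σ-eval le ((c , A) ∷ p) (v ∷ vp) = trans
      (Σ-orderings-+ N N [] (λ w → c * (if all (opened le w) A then 1ℤ else 0ℤ)) (λ w → eval (opened le w) p))
      (cong₂ _+_ (trans (Σ-orderings-* N N [] c _) (cong (c *_) (Σ-monomial le A v))) (Σ-eval le p vp))

    -- A cell is one period of the weights: one vertex on the grids, two on the hexagonal lattice.
    -- Vertices in no cell make up the margin and are estimated by the norm of their weight.
    record Cells : Set₁ where
      field
        Cell    : Set
        cells   : List Cell
        members : Cell → List P
        unique  : Unique (concatMap members cells)
        within  : ∀ {v} → v ∈ concatMap members cells → v ∈ vs

      margin : ℕ
      margin = length (proj₁ (unique-⊆-↭ unique within))

      size : length (concatMap members cells) ℕ.+ margin ≡ N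
      size = trans (sym (length-++ (concatMap members cells))) (trans (sym (↭.↭-length (proj₂ (unique-⊆-↭ unique within)))) vs-length)

    module _ (C : Cells) where
      open Cells C

      record CellBound (weight : P → Polynomial P) (prof : Profile) (b : ℕ) : Set where
        field
          cellWeight : Cell → Polynomial P
          cell-≤     : ∀ {κ} → κ ∈ cells → ∀ s → Supported s →
                       Σᴸ (λ v → eval s (weight v)) (members κ) ≤ eval s (cellWeight κ)
          valid      : ∀ {κ} → κ ∈ cells → All (λ (c , A) → Valid A) (cellWeight κ)
          shape      : ∀ κ → profile (cellWeight κ) ≡ prof
          norm-≤     : ∀ v → norm (weight v) ℕ.≤ b

      -- All cells share one profile and hence one expected weight. With a general `f` the statement
      -- also yields the lower bound, applied to minus the number of clusters and to negated
      -- weights.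
      Σ-clusters-≤ : ∀ {m} (le : m ℕ.≤ N) (f : Vec (Fin N) N → ℤ) (weight : P → Polynomial P) {prof b} →
        CellBound weight prof b →
        (∀ w → Vec.Unique w → f w ≤ Σᴸ (λ v → eval (opened le w) (weight v)) vs) →
        Σ-orderings N N [] f ≤ + length cells * moment N m prof + + (N !) * + (margin ℕ.* b)
      Σ-clusters-≤ {m} le f weight {prof} {b} bd f≤ = begin
        Σ-orderings N N [] f
          ≤⟨ Σ-orderings-mono N N [] (λ w fr → ℤ.≤-trans (f≤ w (fresh⇒Unique G fr)) (pointwise w)) ⟩
        Σ-orderings N N [] (λ w → Σᴸ (λ κ → eval (opened le w) (cellWeight κ)) cells + + (margin ℕ.* b))
          ≡⟨ Σ-orderings-+ N N [] _ _ ⟩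
        Σ-orderings N N [] (λ w → Σᴸ (λ κ → eval (opened le w) (cellWeight κ)) cells) + Σ-orderings N N [] (λ _ → + (margin ℕ.* b))
          ≡⟨ cong₂ _+_ (Σ-orderings-Σᴸ N N [] (λ κ w → eval (opened le w) (cellWeight κ)) cells) (Σ-orderings-const N N [] _ [] refl) ⟩
        Σᴸ (λ κ → Σ-orderings N N [] (λ w → eval (opened le w) (cellWeight κ))) cells + + (N !) * + (margin ℕ.* b)
          ≡⟨ cong (_+ + (N !) * + (margin ℕ.* b)) (trans
               (Σᴸ-cong cells (λ {κ} κ∈ → trans (Σ-eval le (cellWeight κ) (valid κ∈)) (cong (moment N m) (shape κ))))
               (Σᴸ-const (moment N m prof) cells)) ⟩
        + length cells * moment N m prof + + (N !) * + (margin ℕ.* b) ∎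
        where
        open ℤ.≤-Reasoning
        open CellBound bd
        rest = proj₁ (unique-⊆-↭ unique within)
        pointwise : ∀ w → Σᴸ (λ v → eval (opened le w) (weight v)) vs ≤
                          Σᴸ (λ κ → eval (opened le w) (cellWeight κ)) cells + + (margin ℕ.* b)
        pointwise w = begin
          Σᴸ g vs
            ≡⟨ trans (Σᴸ-↭ g (proj₂ (unique-⊆-↭ unique within))) (Σᴸ-++ g (concatMap members cells) rest) ⟩
          Σᴸ g (concatMap members cells) + Σᴸ g rest
            ≤⟨ ℤ.+-mono-≤ (grouped cells (λ κ∈ → κ∈))
                 (Σᴸ-mono rest (λ {v} _ → ℤ.≤-trans (eval-≤-norm s (weight v)) (ℤ.+≤+ (norm-≤ v)))) ⟩
          Σᴸ (λ κ → eval s (cellWeight κ)) cells + Σᴸ (λ _ → + b) rest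
            ≡⟨ cong (_+_ (Σᴸ (λ κ → eval s (cellWeight κ)) cells)) (trans (Σᴸ-const (+ b) rest) (sym (ℤ.pos-* margin b))) ⟩
          Σᴸ (λ κ → eval s (cellWeight κ)) cells + + (margin ℕ.* b) ∎
          where
          s = opened le w
          g : P → ℤ
          g v = eval s (weight v)
          grouped : ∀ κs → (∀ {κ} → κ ∈ κs → κ ∈ cells) →
                    Σᴸ g (concatMap members κs) ≤ Σᴸ (λ κ → eval s (cellWeight κ)) κs
          grouped []       _ = ℤ.≤-refl
          grouped (κ ∷ κs) ⊆ = ℤ.≤-trans (ℤ.≤-reflexive (Σᴸ-++ g (members κ) (concatMap members κs)))
            (ℤ.+-mono-≤ (cell-≤ (⊆ (here refl)) s (opened⇒∈ le w)) (grouped κs (⊆ ∘ there)))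

    module Ordered (_≺_ : Rel P 0ℓ) (≺-trans : Transitive _≺_) (≺-asym : Asymmetric _≺_) (≺-cmp : Trichotomous _≡_ _≺_) where

      open Scanning R R-sym _≺_ ≺-asym public

      private
        sorted = sort ≺-trans ≺-cmp vs vs!
        xs = proj₁ sorted
        xs↭vs = proj₁ (proj₂ sorted)
        ∈xs : ∀ {p} → p ∈ vs → p ∈ xs
        ∈xs = ↭.∈-resp-↭ (Data.List.Relation.Binary.Permutation.Propositional.↭-sym xs↭vs)
          where import Data.List.Relation.Binary.Permutation.Propositional
        ∈vs : ∀ {p} → p ∈ xs → p ∈ vs
        ∈vs = ↭.∈-resp-↭ xs↭vs

      module _ {m} (le : m ℕ.≤ N) (w : Vec (Fin N) N) (w! : Vec.Unique w) (weight : P → ℤ) where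

        private
          s = opened le w

        clusters-≤-weight : (∀ {v} → v ∈ vs → s v ≡ true → Gain≤ s v (weight v)) →
                            (∀ {v} → v ∈ vs → s v ≡ false → 0ℤ ≤ weight v) →
                            + clustersOf G le w ≤ Σᴸ weight vs
        clusters-≤-weight gain off
          with scan-≤ s weight xs (proj₂ (proj₂ sorted)) (λ sp → inj₁ (∈xs (opened⇒∈ le w _ sp))) (gain ∘ ∈vs) (off ∘ ∈vs)
        ... | k , cov , k≤ = ℤ.≤-trans
          (ℤ.+≤+ (clusters-≤ le w w! (Conn-≐ R R-sym (λ (sp , _) → opened⇒occupied le w sp)
            (λ o → let sp = occupied⇒opened le w o in sp , ∈xs (opened⇒∈ le w _ sp)) cov)))
          (subst (+ k ≤_) (Σᴸ-↭ weight xs↭vs) k≤)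

        -- The conclusion compares two integers and is therefore decidable, which removes the double
        -- negation of `scan-≥`.
        clusters-≥-weight : (∀ {v} → v ∈ vs → s v ≡ true → Gain≥ s v (weight v)) →
                            (∀ {v} → v ∈ vs → s v ≡ false → weight v ≤ 0ℤ) →
                            Σᴸ weight vs ≤ + clustersOf G le w
        clusters-≥-weight gain off = decidable-stable (Σᴸ weight vs ℤ.≤? + clustersOf G le w) λ no →
          scan-≥ s weight xs (proj₂ (proj₂ sorted)) (λ sp → inj₁ (∈xs (opened⇒∈ le w _ sp))) (gain ∘ ∈vs) (off ∘ ∈vs)
            λ (k , (L , k≤ , inL , apart) , le′) → no (ℤ.≤-trans (subst (_≤ + k) (Σᴸ-↭ weight xs↭vs) le′)
              (ℤ.+≤+ (clusters-≥ le w w! (L , k≤ , All.map (λ (sp , _) → opened⇒occupied le w sp) inL ,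
                AllPairs.map (λ ¬c c → ¬c (Conn-mono R R-sym
                  (λ o → let sp = occupied⇒opened le w o in sp , ∈xs (opened⇒∈ le w _ sp)) c)) apart))))

-- Falling factorials against powers, and interval arithmetic in the density.

module Estimates where
  open Scan
  open Orderings
  open Model
  open import Data.Bool.Base using (Bool; true; _∧_; T)
  open import Data.Integer.Base as ℤ using (ℤ; +_; 1ℤ; _+_; _*_; _-_; _≤_; _≤ᵇ_)
  import Data.Integer.Properties as ℤ
  open import Data.Integer.Tactic.RingSolver using (solve-∀)
  open import Data.List.Base using ([]; _∷_)
  open import Data.List.Relation.Unary.All as All using (All; []; _∷_)
  open import Data.Nat.Base as ℕ using (ℕ; zero; suc; _!; _∸_; _^_; NonZero; s≤s)
  open import Data.Nat.Combinatorics.Base using (_P′_)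
  open import Data.Nat.DivMod using (_/_; _%_; m≡m%n+[m/n]*n; m%n<n; m/n*n≤m; m*n/n≡m; /-monoˡ-≤)
  import Data.Nat.Properties as ℕ
  import Data.Nat.Tactic.RingSolver as ℕRing
  open import Data.Product.Base using (∃; _×_; _,_; proj₁; proj₂)
  open import Data.Sum.Base using (inj₁; inj₂)
  open import Data.Unit.Base using (tt)
  open import Relation.Binary.PropositionalEquality

  P′-factorial : ∀ N a → a ℕ.≤ N → (N P′ a) ℕ.* (N ∸ a) ! ≡ N !
  P′-factorial N zero    _  = ℕ.+-identityʳ (N !)
  P′-factorial N (suc a) a<N = begin
    (N ∸ a) ℕ.* (N P′ a) ℕ.* (N ∸ suc a) !     ≡⟨ lem (N ∸ a) (N P′ a) ((N ∸ suc a) !) ⟩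
    (N P′ a) ℕ.* ((N ∸ a) ℕ.* (N ∸ suc a) !)   ≡⟨ cong (λ z → (N P′ a) ℕ.* (z ℕ.* (N ∸ suc a) !)) N∸a ⟩
    (N P′ a) ℕ.* (suc (N ∸ suc a)) !           ≡⟨ cong (λ z → (N P′ a) ℕ.* z !) N∸a ⟨
    (N P′ a) ℕ.* (N ∸ a) !                     ≡⟨ P′-factorial N a (ℕ.<⇒≤ a<N) ⟩
    N ! ∎
    where
    open ≡-Reasoning
    lem : ∀ x y z → x ℕ.* y ℕ.* z ≡ y ℕ.* (x ℕ.* z)
    lem = ℕRing.solve-∀
    N∸a : N ∸ a ≡ suc (N ∸ suc a)
    N∸a = sym (trans (sym (ℕ.+-∸-assoc 1 a<N)) refl)

  module _ (N m K : ℕ) .{{_ : NonZero N}} where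

    -- Factor by factor: (m - a) / (N - a) ≤ m / N ≤ hi / K, where the first inequality holds
    -- because m ≤ N.
    P′-≤ : ∀ {hi} → m ℕ.≤ N → K ℕ.* m ℕ.≤ hi ℕ.* N → ∀ a → K ^ a ℕ.* (m P′ a) ℕ.≤ hi ^ a ℕ.* (N P′ a)
    P′-≤ {hi} m≤N Km≤ zero    = ℕ.≤-refl
    P′-≤ {hi} m≤N Km≤ (suc a) = begin
      K ℕ.* K ^ a ℕ.* ((m ∸ a) ℕ.* (m P′ a))        ≡⟨ lem K (K ^ a) (m ∸ a) (m P′ a) ⟩
      K ℕ.* (m ∸ a) ℕ.* (K ^ a ℕ.* (m P′ a))        ≤⟨ ℕ.*-mono-≤ step (P′-≤ m≤N Km≤ a) ⟩
      hi ℕ.* (N ∸ a) ℕ.* (hi ^ a ℕ.* (N P′ a))      ≡⟨ lem hi (hi ^ a) (N ∸ a) (N P′ a) ⟨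
      hi ℕ.* hi ^ a ℕ.* ((N ∸ a) ℕ.* (N P′ a))      ∎
      where
      open ℕ.≤-Reasoning
      lem : ∀ k p x y → k ℕ.* p ℕ.* (x ℕ.* y) ≡ k ℕ.* x ℕ.* (p ℕ.* y)
      lem = ℕRing.solve-∀
      swap : ∀ k x n → k ℕ.* x ℕ.* n ≡ k ℕ.* (x ℕ.* n)
      swap = ℕRing.solve-∀
      swap′ : ∀ h n x → h ℕ.* n ℕ.* x ≡ h ℕ.* x ℕ.* n
      swap′ = ℕRing.solve-∀
      step : K ℕ.* (m ∸ a) ℕ.≤ hi ℕ.* (N ∸ a)
      step = ℕ.*-cancelʳ-≤ (K ℕ.* (m ∸ a)) (hi ℕ.* (N ∸ a)) N (begin
        K ℕ.* (m ∸ a) ℕ.* N             ≡⟨ swap K (m ∸ a) N ⟩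
        K ℕ.* ((m ∸ a) ℕ.* N)           ≡⟨ cong (K ℕ.*_) (ℕ.*-distribʳ-∸ N m a) ⟩
        K ℕ.* (m ℕ.* N ∸ a ℕ.* N)       ≤⟨ ℕ.*-monoʳ-≤ K (ℕ.∸-monoʳ-≤ (m ℕ.* N) (ℕ.≤-trans (ℕ.≤-reflexive (ℕ.*-comm m a)) (ℕ.*-monoʳ-≤ a m≤N))) ⟩
        K ℕ.* (m ℕ.* N ∸ m ℕ.* a)       ≡⟨ cong (K ℕ.*_) (ℕ.*-distribˡ-∸ m N a) ⟨
        K ℕ.* (m ℕ.* (N ∸ a))           ≡⟨ swap K m (N ∸ a) ⟨
        K ℕ.* m ℕ.* (N ∸ a)             ≤⟨ ℕ.*-monoˡ-≤ (N ∸ a) Km≤ ⟩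
        hi ℕ.* N ℕ.* (N ∸ a)            ≡⟨ swap′ hi N (N ∸ a) ⟩
        hi ℕ.* (N ∸ a) ℕ.* N            ∎)

    -- For a ≤ D the factor (m - a) / (N - a) is at least (m - D) / N, so a single condition serves
    -- all degrees up to `D`.
    P′-≥ : ∀ {lo} D → lo ℕ.* N ℕ.≤ K ℕ.* (m ∸ D) → ∀ a → a ℕ.≤ D → lo ^ a ℕ.* (N P′ a) ℕ.≤ K ^ a ℕ.* (m P′ a)
    P′-≥ {lo} D lo≤ zero    _   = ℕ.≤-refl
    P′-≥ {lo} D lo≤ (suc a) a<D = begin
      lo ℕ.* lo ^ a ℕ.* ((N ∸ a) ℕ.* (N P′ a))      ≡⟨ lem lo (lo ^ a) (N ∸ a) (N P′ a) ⟩
      lo ℕ.* (N ∸ a) ℕ.* (lo ^ a ℕ.* (N P′ a))      ≤⟨ ℕ.*-mono-≤ step (P′-≥ D lo≤ a (ℕ.<⇒≤ a<D)) ⟩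
      K ℕ.* (m ∸ a) ℕ.* (K ^ a ℕ.* (m P′ a))        ≡⟨ lem K (K ^ a) (m ∸ a) (m P′ a) ⟨
      K ℕ.* K ^ a ℕ.* ((m ∸ a) ℕ.* (m P′ a))        ∎
      where
      open ℕ.≤-Reasoning
      lem : ∀ k p x y → k ℕ.* p ℕ.* (x ℕ.* y) ≡ k ℕ.* x ℕ.* (p ℕ.* y)
      lem = ℕRing.solve-∀
      step : lo ℕ.* (N ∸ a) ℕ.≤ K ℕ.* (m ∸ a)
      step = ℕ.≤-trans (ℕ.*-monoʳ-≤ lo (ℕ.m∸n≤m N a)) (ℕ.≤-trans lo≤ (ℕ.*-monoʳ-≤ K (ℕ.∸-monoʳ-≤ m (ℕ.<⇒≤ a<D))))

  -- The sign of the coefficient selects the worse end of the density interval; `K ^ (D ∸ a)` brings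
  -- all degrees to the denominator `K ^ D`, so that the numerical checks run on integers.
  extremeTerm : (K D lo hi : ℕ) → ℤ × ℕ → ℤ
  extremeTerm K D lo hi (+ n        , a) = + (n ℕ.* (hi ^ a ℕ.* K ^ (D ∸ a)))
  extremeTerm K D lo hi (ℤ.-[1+ n ] , a) = ℤ.- (+ (suc n ℕ.* (lo ^ a ℕ.* K ^ (D ∸ a))))

  -- K ^ D times the largest value of a polynomial whose monomials of degree a
  -- lie between (lo / K) ^ a and (hi / K) ^ a.
  extreme : (K D lo hi : ℕ) → Profile → ℤ
  extreme K D lo hi = Σᴸ (extremeTerm K D lo hi)

  module _ (N m K D lo hi : ℕ) .{{_ : NonZero N}} (D≤N : D ℕ.≤ N) (m≤N : m ℕ.≤ N)
           (Km≤ : K ℕ.* m ℕ.≤ hi ℕ.* N) (lo≤ : lo ℕ.* N ℕ.≤ K ℕ.* (m ∸ D)) where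

    private
      q : ℕ → ℕ
      q a = (m P′ a) ℕ.* (N ∸ a) !

      q-≤ : ∀ a → a ℕ.≤ D → K ^ a ℕ.* q a ℕ.≤ hi ^ a ℕ.* N !
      q-≤ a a≤D = subst₂ ℕ._≤_ (ℕ.*-assoc (K ^ a) _ _)
        (trans (ℕ.*-assoc (hi ^ a) _ _) (cong (hi ^ a ℕ.*_) (P′-factorial N a (ℕ.≤-trans a≤D D≤N))))
        (ℕ.*-monoˡ-≤ ((N ∸ a) !) (P′-≤ N m K m≤N Km≤ a))

      q-≥ : ∀ a → a ℕ.≤ D → lo ^ a ℕ.* N ! ℕ.≤ K ^ a ℕ.* q a
      q-≥ a a≤D = subst₂ ℕ._≤_
        (trans (ℕ.*-assoc (lo ^ a) _ _) (cong (lo ^ a ℕ.*_) (P′-factorial N a (ℕ.≤-trans a≤D D≤N))))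
        (ℕ.*-assoc (K ^ a) _ _)
        (ℕ.*-monoˡ-≤ ((N ∸ a) !) (P′-≥ N m K D lo≤ a a≤D))

      K^D : ∀ {a} → a ℕ.≤ D → K ^ D ≡ K ^ a ℕ.* K ^ (D ∸ a)
      K^D {a} a≤D = trans (cong (K ^_) (sym (ℕ.m+[n∸m]≡n a≤D))) (ℕ.^-distribˡ-+-* K a (D ∸ a))

      assemble : ∀ n x k f → n ℕ.* x ℕ.* (k ℕ.* f) ≡ f ℕ.* (n ℕ.* (k ℕ.* x))
      assemble = ℕRing.solve-∀
      assemble′ : ∀ k x n q → k ℕ.* x ℕ.* (n ℕ.* q) ≡ n ℕ.* x ℕ.* (k ℕ.* q)
      assemble′ = ℕRing.solve-∀

    moment-extreme : ∀ p → All (λ (_ , a) → a ℕ.≤ D) p →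
                     + (K ^ D) * moment N m p ≤ + (N !) * extreme K D lo hi p
    moment-extreme [] [] = ℤ.≤-reflexive (trans (ℤ.*-zeroʳ (+ (K ^ D))) (sym (ℤ.*-zeroʳ (+ (N !)))))
    moment-extreme ((c , a) ∷ p) (a≤D ∷ bd) = subst₂ _≤_
      (sym (ℤ.*-distribˡ-+ (+ (K ^ D)) (c * + q a) (moment N m p)))
      (sym (ℤ.*-distribˡ-+ (+ (N !)) (extremeTerm K D lo hi (c , a)) (extreme K D lo hi p)))
      (ℤ.+-mono-≤ (single c) (moment-extreme p bd))
      where
      single⁺ : ∀ n → K ^ D ℕ.* (n ℕ.* q a) ℕ.≤ N ! ℕ.* (n ℕ.* (hi ^ a ℕ.* K ^ (D ∸ a)))
      single⁺ n = begin
        K ^ D ℕ.* (n ℕ.* q a)                         ≡⟨ cong (ℕ._* (n ℕ.* q a)) (K^D a≤D) ⟩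
        K ^ a ℕ.* K ^ (D ∸ a) ℕ.* (n ℕ.* q a)         ≡⟨ assemble′ (K ^ a) (K ^ (D ∸ a)) n (q a) ⟩
        n ℕ.* K ^ (D ∸ a) ℕ.* (K ^ a ℕ.* q a)         ≤⟨ ℕ.*-monoʳ-≤ (n ℕ.* K ^ (D ∸ a)) (q-≤ a a≤D) ⟩
        n ℕ.* K ^ (D ∸ a) ℕ.* (hi ^ a ℕ.* N !)        ≡⟨ assemble n (K ^ (D ∸ a)) (hi ^ a) (N !) ⟩
        N ! ℕ.* (n ℕ.* (hi ^ a ℕ.* K ^ (D ∸ a)))      ∎
        where open ℕ.≤-Reasoning
      single⁻ : ∀ n → N ! ℕ.* (n ℕ.* (lo ^ a ℕ.* K ^ (D ∸ a))) ℕ.≤ K ^ D ℕ.* (n ℕ.* q a)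
      single⁻ n = begin
        N ! ℕ.* (n ℕ.* (lo ^ a ℕ.* K ^ (D ∸ a)))      ≡⟨ assemble n (K ^ (D ∸ a)) (lo ^ a) (N !) ⟨
        n ℕ.* K ^ (D ∸ a) ℕ.* (lo ^ a ℕ.* N !)        ≤⟨ ℕ.*-monoʳ-≤ (n ℕ.* K ^ (D ∸ a)) (q-≥ a a≤D) ⟩
        n ℕ.* K ^ (D ∸ a) ℕ.* (K ^ a ℕ.* q a)         ≡⟨ assemble′ (K ^ a) (K ^ (D ∸ a)) n (q a) ⟨
        K ^ a ℕ.* K ^ (D ∸ a) ℕ.* (n ℕ.* q a)         ≡⟨ cong (ℕ._* (n ℕ.* q a)) (K^D a≤D) ⟨
        K ^ D ℕ.* (n ℕ.* q a)                         ∎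
        where open ℕ.≤-Reasoning
      neg : ∀ x n y → x * (ℤ.- n * y) ≡ ℤ.- (x * (n * y))
      neg = solve-∀
      single : ∀ c → + (K ^ D) * (c * + q a) ≤ + (N !) * extremeTerm K D lo hi (c , a)
      single (+ n) = subst₂ _≤_
        (trans (ℤ.pos-* (K ^ D) _) (cong (+ (K ^ D) *_) (ℤ.pos-* n (q a)))) (ℤ.pos-* (N !) _)
        (ℤ.+≤+ (single⁺ n))
      single ℤ.-[1+ n ] = subst₂ _≤_
        (trans (cong ℤ.-_ (trans (ℤ.pos-* (K ^ D) _) (cong (+ (K ^ D) *_) (ℤ.pos-* (suc n) (q a)))))
          (sym (neg (+ (K ^ D)) (+ suc n) (+ q a))))
        (trans (cong ℤ.-_ (ℤ.pos-* (N !) _)) (ℤ.neg-distribʳ-* (+ (N !)) _))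
        (ℤ.neg-mono-≤ (ℤ.+≤+ (single⁻ (suc n))))

    moment-≤ : ∀ p → All (λ (_ , a) → a ℕ.≤ D) p → .{{_ : NonZero (K ^ D)}} → ∀ X (Y : ℤ) →
               + X * extreme K D lo hi p ≤ Y * + (K ^ D) → + X * moment N m p ≤ + (N !) * Y
    moment-≤ p bd X Y ex≤ = ℤ.*-cancelʳ-≤-pos _ _ (+ (K ^ D)) {{ℤ.positive (ℤ.+<+ (ℕ.>-nonZero⁻¹ (K ^ D)))}} (begin
      + X * moment N m p * + (K ^ D)              ≡⟨ shuffle (+ X) (moment N m p) (+ (K ^ D)) ⟩
      + X * (+ (K ^ D) * moment N m p)            ≤⟨ *-monoʳ-≤ X (moment-extreme p bd) ⟩
      + X * (+ (N !) * extreme K D lo hi p)       ≡⟨ shuffle′ (+ X) (+ (N !)) (extreme K D lo hi p) ⟩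
      + (N !) * (+ X * extreme K D lo hi p)       ≤⟨ *-monoʳ-≤ (N !) ex≤ ⟩
      + (N !) * (Y * + (K ^ D))                   ≡⟨ ℤ.*-assoc (+ (N !)) Y (+ (K ^ D)) ⟨
      + (N !) * Y * + (K ^ D)                     ∎)
      where
      open ℤ.≤-Reasoning
      shuffle : ∀ x m k → x * m * k ≡ x * (k * m)
      shuffle = solve-∀
      shuffle′ : ∀ x f e → x * (f * e) ≡ f * (x * e)
      shuffle′ = solve-∀

  allBelow : (ℕ → Bool) → ℕ → Bool
  allBelow f zero    = true
  allBelow f (suc n) = f n ∧ allBelow f n

  allBelow-sound : ∀ f n → T (allBelow f n) → ∀ j → j ℕ.< n → T (f j)
  allBelow-sound f (suc n) all j (s≤s j≤n) with f n in fn
  ... | true with ℕ.m≤n⇒m<n∨m≡n j≤n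
  ... | inj₁ j<n  = allBelow-sound f n all j j<n
  ... | inj₂ refl = subst T (sym fn) tt

  -- The interval [0 , 1] is covered by the intervals [j / K , (j + 2) / K] with j ≤ K.
  gridCheck : (K D X Y : ℕ) → Profile → ℕ → Bool
  gridCheck K D X Y p j = + X * extreme K D j (2 ℕ.+ j) p ≤ᵇ + Y * + (K ^ D)

  -- The witness is the quotient of K (m - D) by N. Measured in units of 1 / K, rounding down costs
  -- at most one and the shift by `D` at most K D / N ≤ 1; hence the intervals of width 2 / K.
  grid-cell : ∀ N m K D .{{_ : NonZero N}} → m ℕ.≤ N → K ℕ.* D ℕ.≤ N →
              ∃ λ j → j ℕ.≤ K × j ℕ.* N ℕ.≤ K ℕ.* (m ∸ D) × K ℕ.* m ℕ.≤ (2 ℕ.+ j) ℕ.* N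
  grid-cell N m K D m≤N KD≤N = j , j≤K , m/n*n≤m x N , (begin
    K ℕ.* m                        ≤⟨ ℕ.*-monoʳ-≤ K (ℕ.m≤n+m∸n m D) ⟩
    K ℕ.* (D ℕ.+ (m ∸ D))          ≡⟨ ℕ.*-distribˡ-+ K D (m ∸ D) ⟩
    K ℕ.* D ℕ.+ x                  ≤⟨ ℕ.+-mono-≤ KD≤N (ℕ.≤-reflexive (m≡m%n+[m/n]*n x N)) ⟩
    N ℕ.+ (x % N ℕ.+ j ℕ.* N)      ≤⟨ ℕ.+-monoʳ-≤ N (ℕ.+-monoˡ-≤ (j ℕ.* N) (ℕ.<⇒≤ (m%n<n x N))) ⟩
    N ℕ.+ (N ℕ.+ j ℕ.* N)          ∎)
    where
    open ℕ.≤-Reasoning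
    x j : ℕ
    x = K ℕ.* (m ∸ D)
    j = x / N
    j≤K : j ℕ.≤ K
    j≤K = ℕ.≤-trans (/-monoˡ-≤ N (ℕ.*-monoʳ-≤ K (ℕ.≤-trans (ℕ.m∸n≤m m D) m≤N))) (ℕ.≤-reflexive (m*n/n≡m K N))

  module _ (N M d margin b X bnd : ℕ) (size : d ℕ.* M ℕ.+ margin ≡ N) where

    private
      pos-*₃ : ∀ a b c → + (a ℕ.* (b ℕ.* c)) ≡ + a * (+ b * + c)
      pos-*₃ a b c = trans (ℤ.pos-* a _) (cong (+ a *_) (ℤ.pos-* b c))

      dM≤N : d ℕ.* M ℕ.≤ N
      dM≤N = ℕ.m+n≤o⇒m≤o (d ℕ.* M) (ℕ.≤-reflexive size)

    -- The check establishes Y / X per cell with `Y` one less than d bnd; the unit saved pays for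
    -- the margin as soon as X d margin b ≤ N.
    upper-estimate : ∀ p K D m (t : ℤ) {Y} .{{_ : NonZero d}} .{{_ : NonZero N}} .{{_ : NonZero (K ^ D)}} →
      All (λ (_ , a) → a ℕ.≤ D) p → m ℕ.≤ N → K ℕ.* D ℕ.≤ N → D ℕ.≤ N →
      d ℕ.* bnd ≡ suc Y → X ℕ.* (d ℕ.* (margin ℕ.* b)) ℕ.≤ N →
      T (allBelow (gridCheck K D X Y p) (suc K)) →
      t ≤ + M * moment N m p + + (N !) * + (margin ℕ.* b) →
      + X * t ≤ + (bnd ℕ.* (N ℕ.* N !))
    upper-estimate p K D m t {Y} deg m≤N KD≤N D≤N Y≡ margin≤ check t≤ =
      ℤ.*-cancelˡ-≤-pos (+ X * t) _ (+ d) {{ℤ.positive (ℤ.+<+ (ℕ.>-nonZero⁻¹ d))}} (begin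
        + d * (+ X * t)
          ≤⟨ *-monoʳ-≤ d (*-monoʳ-≤ X t≤) ⟩
        + d * (+ X * (+ M * moment N m p + F * + (margin ℕ.* b)))
          ≡⟨ expand (+ d) (+ X) (+ M) (moment N m p) F (+ (margin ℕ.* b)) ⟩
        + d * + M * (+ X * moment N m p) + F * (+ X * (+ d * + (margin ℕ.* b)))
          ≤⟨ ℤ.+-monoˡ-≤ _ (subst (λ z → z * (+ X * moment N m p) ≤ z * (F * + Y)) (ℤ.pos-* d M) (*-monoʳ-≤ (d ℕ.* M) main)) ⟩
        + d * + M * (F * + Y) + F * (+ X * (+ d * + (margin ℕ.* b)))
          ≡⟨ cong₂ (λ x y → x * (F * + Y) + F * y) (ℤ.pos-* d M) (pos-*₃ X d (margin ℕ.* b)) ⟨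
        + (d ℕ.* M) * (F * + Y) + F * + (X ℕ.* (d ℕ.* (margin ℕ.* b)))
          ≤⟨ ℤ.+-mono-≤ (subst (λ z → + (d ℕ.* M) * z ≤ + N * z) (ℤ.pos-* (N !) Y)
               (subst₂ _≤_ (ℤ.pos-* (d ℕ.* M) _) (ℤ.pos-* N _) (ℤ.+≤+ (ℕ.*-monoˡ-≤ (N ! ℕ.* Y) dM≤N))))
               (*-monoʳ-≤ (N !) (ℤ.+≤+ margin≤)) ⟩
        + N * (F * + Y) + F * + N
          ≡⟨ collect (+ N) F (+ Y) ⟩
        + suc Y * (+ N * F)
          ≡⟨ cong (λ z → + z * (+ N * F)) Y≡ ⟨
        + (d ℕ.* bnd) * (+ N * F)
          ≡⟨ trans (cong (_* (+ N * F)) (ℤ.pos-* d bnd)) (ℤ.*-assoc (+ d) (+ bnd) (+ N * F)) ⟩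
        + d * (+ bnd * (+ N * F))
          ≡⟨ cong (+ d *_) (pos-*₃ bnd N (N !)) ⟨
        + d * + (bnd ℕ.* (N ℕ.* N !)) ∎)
      where
      open ℤ.≤-Reasoning
      F = + (N !)
      cell = grid-cell N m K D m≤N KD≤N
      j = proj₁ cell
      main : + X * moment N m p ≤ F * + Y
      main = moment-≤ N m K D j (2 ℕ.+ j) D≤N m≤N (proj₂ (proj₂ (proj₂ cell))) (proj₁ (proj₂ (proj₂ cell)))
        p deg X (+ Y) (ℤ.≤ᵇ⇒≤ (allBelow-sound (gridCheck K D X Y p) (suc K) check j (s≤s (proj₁ (proj₂ cell)))))
      expand : ∀ d x m q f y → d * (x * (m * q + f * y)) ≡ d * m * (x * q) + f * (x * (d * y))
      expand = solve-∀
      collect : ∀ n f y → n * (f * y) + f * n ≡ (1ℤ + y) * (n * f)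
      collect = solve-∀

    -- Here `Y` is one more than d bnd. The extra unit pays for the crude bound on the margin and
    -- also for the contribution margin Y that the margin fails to make.
    lower-estimate : ∀ p K D m lo hi (t : ℤ) {Y} .{{_ : NonZero d}} .{{_ : NonZero N}} .{{_ : NonZero (K ^ D)}} →
      All (λ (_ , a) → a ℕ.≤ D) p → m ℕ.≤ N → D ℕ.≤ N → K ℕ.* m ℕ.≤ hi ℕ.* N → lo ℕ.* N ℕ.≤ K ℕ.* (m ∸ D) →
      suc (d ℕ.* bnd) ≡ Y → margin ℕ.* Y ℕ.+ X ℕ.* (d ℕ.* (margin ℕ.* b)) ℕ.≤ N →
      T (+ X * extreme K D lo hi p ≤ᵇ ℤ.- + Y * + (K ^ D)) →
      ℤ.- t ≤ + M * moment N m p + + (N !) * + (margin ℕ.* b) →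
      + (bnd ℕ.* (N ℕ.* N !)) ≤ + X * t
    lower-estimate p K D m lo hi t {Y} deg m≤N D≤N Km≤ lo≤ Y≡ margin≤ check t≤ =
      ℤ.*-cancelˡ-≤-pos _ (+ X * t) (+ d) {{ℤ.positive (ℤ.+<+ (ℕ.>-nonZero⁻¹ d))}} (begin
        + d * + (bnd ℕ.* (N ℕ.* N !))
          ≡⟨ cong (+ d *_) (pos-*₃ bnd N (N !)) ⟩
        + d * (+ bnd * (+ N * F))
          ≡⟨ step₁ (+ d) (+ bnd) (+ N) F ⟩
        F * (+ N * (1ℤ + + d * + bnd) - + N)
          ≤⟨ *-monoʳ-≤ (N !) (ℤ.+-monoʳ-≤ (+ N * (1ℤ + + d * + bnd)) (ℤ.neg-mono-≤ (subst (_≤ + N) (trans (ℤ.pos-+ (margin ℕ.* Y) _) (cong₂ _+_ (ℤ.pos-* margin Y) (pos-*₃ X d (margin ℕ.* b)))) (ℤ.+≤+ margin≤)))) ⟩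
        F * (+ N * (1ℤ + + d * + bnd) - (+ margin * + Y + + X * (+ d * + (margin ℕ.* b))))
          ≡⟨ cong₂ (λ x y → F * (x * y - (+ margin * + Y + + X * (+ d * + (margin ℕ.* b))))) N≡ Y≡′ ⟩
        F * ((+ d * + M + + margin) * + Y - (+ margin * + Y + + X * (+ d * + (margin ℕ.* b))))
          ≡⟨ step₂ F (+ d) (+ M) (+ margin) (+ Y) (+ X) (+ (margin ℕ.* b)) ⟩
        ℤ.- (+ d * + M * (F * ℤ.- + Y) + F * (+ X * (+ d * + (margin ℕ.* b))))
          ≤⟨ ℤ.neg-mono-≤ (ℤ.+-monoˡ-≤ _ (subst (λ z → z * (+ X * moment N m p) ≤ z * (F * ℤ.- + Y)) (ℤ.pos-* d M) (*-monoʳ-≤ (d ℕ.* M) main))) ⟩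
        ℤ.- (+ d * + M * (+ X * moment N m p) + F * (+ X * (+ d * + (margin ℕ.* b))))
          ≡⟨ cong ℤ.-_ (expand (+ d) (+ X) (+ M) (moment N m p) F (+ (margin ℕ.* b))) ⟨
        ℤ.- (+ d * (+ X * (+ M * moment N m p + F * + (margin ℕ.* b))))
          ≤⟨ ℤ.neg-mono-≤ (*-monoʳ-≤ d (*-monoʳ-≤ X t≤)) ⟩
        ℤ.- (+ d * (+ X * ℤ.- t))
          ≡⟨ step₃ (+ d) (+ X) t ⟩
        + d * (+ X * t) ∎)
      where
      open ℤ.≤-Reasoning
      F = + (N !)
      main : + X * moment N m p ≤ F * ℤ.- + Y
      main = moment-≤ N m K D lo hi D≤N m≤N Km≤ lo≤ p deg X (ℤ.- + Y) (ℤ.≤ᵇ⇒≤ check)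
      N≡ : + N ≡ + d * + M + + margin
      N≡ = trans (cong +_ (sym size)) (trans (ℤ.pos-+ (d ℕ.* M) margin) (cong (_+ + margin) (ℤ.pos-* d M)))
      Y≡′ : 1ℤ + + d * + bnd ≡ + Y
      Y≡′ = trans (cong (_+_ 1ℤ) (sym (ℤ.pos-* d bnd))) (cong +_ Y≡)
      expand : ∀ d x m q f y → d * (x * (m * q + f * y)) ≡ d * m * (x * q) + f * (x * (d * y))
      expand = solve-∀
      step₁ : ∀ d b n f → d * (b * (n * f)) ≡ f * (n * (1ℤ + d * b) - n)
      step₁ = solve-∀
      step₂ : ∀ f d m g y x z → f * ((d * m + g) * y - (g * y + x * (d * z))) ≡
              ℤ.- (d * m * (f * ℤ.- y) + f * (x * (d * z)))
      step₂ = solve-∀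
      step₃ : ∀ d x t → ℤ.- (d * (x * ℤ.- t)) ≡ d * (x * t)
      step₃ = solve-∀

  -- 13 is the largest degree in the lower polynomials. The number `suc m` of open vertices exceeds
  -- the rounded lo N / K by 14, so it stays above lo N / K after 13 are subtracted, while the
  -- excess in density is at most 14 / K because K ≤ N.
  density-witness : ∀ N K lo → .{{_ : NonZero K}} → lo ℕ.+ 14 ℕ.≤ K → K ℕ.≤ N →
                    ∃ λ m → suc m ℕ.≤ N × K ℕ.* suc m ℕ.≤ (lo ℕ.+ 14) ℕ.* N × lo ℕ.* N ℕ.≤ K ℕ.* (suc m ∸ 13)
  density-witness N K lo lo≤K K≤N = m , sm≤N , Km≤ , lo≤
    where
    open ℕ.≤-Reasoning
    q m : ℕ
    q = lo ℕ.* N / K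
    m = q ℕ.+ 13
    Km≤ : K ℕ.* suc m ℕ.≤ (lo ℕ.+ 14) ℕ.* N
    Km≤ = begin
      K ℕ.* suc (q ℕ.+ 13)             ≡⟨ lem K q ⟩
      q ℕ.* K ℕ.+ 14 ℕ.* K             ≤⟨ ℕ.+-mono-≤ (m/n*n≤m (lo ℕ.* N) K) (ℕ.*-monoʳ-≤ 14 K≤N) ⟩
      lo ℕ.* N ℕ.+ 14 ℕ.* N            ≡⟨ ℕ.*-distribʳ-+ N lo 14 ⟨
      (lo ℕ.+ 14) ℕ.* N                ∎
      where
      lem : ∀ k q → k ℕ.* (1 ℕ.+ (q ℕ.+ 13)) ≡ q ℕ.* k ℕ.+ 14 ℕ.* k
      lem = ℕRing.solve-∀
    sm≤N : suc m ℕ.≤ N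
    sm≤N = ℕ.*-cancelˡ-≤ K (ℕ.≤-trans Km≤ (ℕ.*-monoˡ-≤ N lo≤K))
    lo≤ : lo ℕ.* N ℕ.≤ K ℕ.* (suc m ∸ 13)
    lo≤ = begin
      lo ℕ.* N                         ≡⟨ m≡m%n+[m/n]*n (lo ℕ.* N) K ⟩
      lo ℕ.* N % K ℕ.+ q ℕ.* K         ≤⟨ ℕ.+-monoˡ-≤ (q ℕ.* K) (ℕ.<⇒≤ (m%n<n (lo ℕ.* N) K)) ⟩
      K ℕ.+ q ℕ.* K                    ≡⟨ ℕ.*-comm (suc q) K ⟩
      K ℕ.* suc q                      ≡⟨ cong (K ℕ.*_) (ℕ.m+n∸n≡m (suc q) 13) ⟨
      K ℕ.* (suc m ∸ 13)               ∎

-- Translation-invariant weights on the integer grid.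

module Grids where
  open import Defs
  open Scan
  open Orderings
  open Variance
  open Model
  open import Data.Bool.Base using (true; false)
  open import Data.Bool.ListAction using (all)
  open import Data.Integer.Base as ℤ using (ℤ; +_; -[1+_]; 0ℤ)
  import Data.Integer.Properties as ℤ
  open import Data.List.Base using (List; []; _∷_; length; map; applyUpTo; cartesianProduct; concatMap; lookup)
  open import Data.List.Properties using (length-++; length-map; length-applyUpTo)
  open import Data.List.Membership.Propositional using (_∈_; _∉_)
  import Data.List.Membership.Propositional.Properties as ∈
  import Data.List.Membership.DecPropositional as DecMembership
  open import Data.List.Relation.Unary.All as All using (All; []; _∷_)
  import Data.List.Relation.Unary.All.Properties as All
  open import Data.List.Relation.Unary.AllPairs as AllPairs using (AllPairs; []; _∷_)
  open import Data.List.Relation.Unary.Any using (here; there)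
  open import Data.List.Relation.Unary.Unique.Propositional using (Unique)
  import Data.List.Relation.Unary.Unique.Propositional.Properties as Unique
  open import Data.Nat.Base as ℕ using (ℕ; zero; suc; _!; _+_; _*_; _≤_; z≤n; s≤s; ∣_-_∣)
  import Data.Nat.Properties as ℕ
  import Data.Nat.Tactic.RingSolver as ℕRing
  open import Data.Product.Base using (∃; _×_; _,_; proj₁; proj₂)
  open import Data.Product.Properties using (≡-dec)
  open import Data.Sum.Base using (_⊎_; inj₁; inj₂)
  open import Data.Vec.Base using (Vec)
  import Data.Vec.Relation.Unary.Unique.Propositional as Vec
  open import Function.Base using (_∘_)
  open import Level using (0ℓ)
  open import Relation.Binary.Core using (Rel)
  open import Relation.Binary.Definitions using (Decidable; DecidableEquality; Symmetric; Asymmetric; Transitive; Trichotomous; tri<; tri≈; tri>)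
  open import Relation.Binary.PropositionalEquality
  open import Relation.Nullary.Decidable using (Dec; ¬?)
  open import Relation.Nullary.Negation using (¬_; contradiction)

  -- The estimates for one lattice; U and L are the profiles of the weight of a cell in the
  -- upper and in the lower bound, and d is the number of vertices of a cell.
  record Analysed (G : Graph) (d b : ℕ) (U L : Profile) : Set where
    private
      N = Graph.order G
    field
      M margin  : ℕ
      size      : d * M + margin ≡ N
      upper     : ∀ {m} (le : m ≤ N) → Σ-orderings N N [] (λ w → + clustersOf G le w) ℤ.≤
                  + M ℤ.* moment N m U ℤ.+ + (N !) ℤ.* + (margin * b)
      lower     : ∀ {m} (le : m ≤ N) → ℤ.- Σ-orderings N N [] (λ w → + clustersOf G le w) ℤ.≤
                  + M ℤ.* moment N m (negate L) ℤ.+ + (N !) ℤ.* + (margin * b)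
      lipschitz : ∀ {m} (le : m ≤ N) → Lipschitz N 14 [] (λ w → + clustersOf G le w)
      step      : ∀ a k (le : a + k ≤ N) (le′ : a ≤ N) w → Vec.Unique w →
                  clustersOf G le w ≤ k + clustersOf G le′ w

  -- `small` expresses that the margin is o(N): this is how the boundary disappears for large N.
  record Family (L : Lattice) (d b : ℕ) (U D : Profile) : Set where
    field
      least : ℕ
      model : ∀ n → least ≤ Graph.order (lattice L n) → Analysed (lattice L n) d b U D
      small : ∀ C → ∃ λ N₀ → ∀ n (h : least ≤ Graph.order (lattice L n)) →
              N₀ ≤ Graph.order (lattice L n) → C * Analysed.margin (model n h) ≤ Graph.order (lattice L n)

  module Lex {A : Set} {_⊏_ : Rel A 0ℓ} (⊏-trans : Transitive _⊏_) (⊏-asym : Asymmetric _⊏_)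
             (⊏-cmp : Trichotomous _≡_ _⊏_) where

    infix 4 _≺_
    _≺_ : Rel (A × A) 0ℓ
    (i , j) ≺ (k , l) = i ⊏ k ⊎ (i ≡ k × j ⊏ l)

    ≺-trans : Transitive _≺_
    ≺-trans (inj₁ p)          (inj₁ q)          = inj₁ (⊏-trans p q)
    ≺-trans (inj₁ p)          (inj₂ (refl , _)) = inj₁ p
    ≺-trans (inj₂ (refl , _)) (inj₁ q)          = inj₁ q
    ≺-trans (inj₂ (refl , p)) (inj₂ (refl , q)) = inj₂ (refl , ⊏-trans p q)

    ⊏-irrefl : ∀ {i} → ¬ (i ⊏ i)
    ⊏-irrefl p = ⊏-asym p p

    ≺-asym : Asymmetric _≺_
    ≺-asym (inj₁ p)          (inj₁ q)          = ⊏-asym p q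
    ≺-asym (inj₁ p)          (inj₂ (refl , _)) = ⊏-irrefl p
    ≺-asym (inj₂ (refl , _)) (inj₁ q)          = ⊏-irrefl q
    ≺-asym (inj₂ (refl , p)) (inj₂ (_ , q))    = ⊏-asym p q

    ≺-cmp : Trichotomous _≡_ _≺_
    ≺-cmp (i , j) (k , l) with ⊏-cmp i k
    ... | tri< i<k i≢k _ = tri< (inj₁ i<k) (i≢k ∘ cong proj₁) (≺-asym (inj₁ i<k))
    ... | tri> _ i≢k k<i = tri> (≺-asym (inj₁ k<i)) (i≢k ∘ cong proj₁) (inj₁ k<i)
    ... | tri≈ _ refl _ with ⊏-cmp j l
    ... | tri< j<l j≢l _ = tri< (inj₂ (refl , j<l)) (j≢l ∘ cong proj₂) (≺-asym (inj₂ (refl , j<l)))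
    ... | tri> _ j≢l l<j = tri> (≺-asym (inj₂ (refl , l<j))) (j≢l ∘ cong proj₂) (inj₂ (refl , l<j))
    ... | tri≈ _ refl _ = tri≈ (λ p → ≺-asym p p) refl (λ p → ≺-asym p p)

  ⊞_ ⊟_ : {A : Set} → A → ℤ × A
  ⊞ A = + 1 , A
  ⊟ A = -[1+ 0 ] , A

  instantiate : {O P : Set} → (O → P) → Polynomial O → Polynomial P
  instantiate f = map (λ (c , A) → c , map f A)

  instantiate-negate : {O P : Set} (f : O → P) → ∀ p → instantiate f (negate p) ≡ negate (instantiate f p)
  instantiate-negate f []            = refl
  instantiate-negate f ((c , A) ∷ p) = cong (_ ∷_) (instantiate-negate f p)

  module Window {O P : Set} (_≟_ : DecidableEquality O) where
    open DecMembership _≟_ using (_∈?_)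

    unique? : (A : List O) → Dec (Unique A)
    unique? = AllPairs.allPairs? (λ a b → ¬? (a ≟ b))

    Within : List O → Polynomial O → Set
    Within W p = All (λ (_ , A) → Unique A × All (_∈ W) A) p

    within? : ∀ W p → Dec (Within W p)
    within? W = All.all? (λ (_ , A) → unique? A Relation.Nullary.Decidable.×-dec All.all? (_∈? W) A)
      where import Relation.Nullary.Decidable

    instantiate-valid : ∀ {vs : List P} (f : O → P) → (∀ {a b} → f a ≡ f b → a ≡ b) → ∀ {W p} →
      All (λ o → f o ∈ vs) W → Within W p → All (λ (_ , A) → Unique A × All (_∈ vs) A) (instantiate f p)
    instantiate-valid f inj all w = All.map⁺ (All.map (λ (u , i) → Unique.map⁺ inj u , All.map⁺ (All.map (All.lookup all) i)) w)

    norm-instantiate : (f : O → P) → ∀ p → norm (instantiate f p) ≡ norm p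
    norm-instantiate f []            = refl
    norm-instantiate f ((c , _) ∷ p) = cong (_+_ ℤ.∣ c ∣) (norm-instantiate f p)

  Lattice² : Set
  Lattice² = ℕ × ℕ

  open Lex ℕ.<-trans ℕ.<-asym ℕ.<-cmp public using () renaming (_≺_ to _≺ᴺ_; ≺-trans to ≺ᴺ-trans; ≺-asym to ≺ᴺ-asym; ≺-cmp to ≺ᴺ-cmp)

  _≟ᴺ_ : DecidableEquality Lattice²
  _≟ᴺ_ = ≡-dec ℕ._≟_ ℕ._≟_

  open Window {Lattice²} {Lattice²} _≟ᴺ_ public

  shift : Lattice² → Lattice² → Lattice²
  shift (i , j) (a , b) = a + i , b + j

  shift-injective : ∀ κ {a b} → shift κ a ≡ shift κ b → a ≡ b
  shift-injective (i , j) eq = cong₂ _,_ (ℕ.+-cancelʳ-≡ i _ _ (cong proj₁ eq)) (ℕ.+-cancelʳ-≡ j _ _ (cong proj₂ eq))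

  length-cartesianProduct : ∀ {A B : Set} (xs : List A) (ys : List B) → length (cartesianProduct xs ys) ≡ length xs * length ys
  length-cartesianProduct []       ys = refl
  length-cartesianProduct (x ∷ xs) ys = trans (length-++ (map (x ,_) ys)) (cong₂ _+_ (length-map (x ,_) ys) (length-cartesianProduct xs ys))

  range : ℕ → List ℕ
  range = applyUpTo suc

  range-unique : ∀ n → Unique (range n)
  range-unique n = Unique.applyUpTo⁺₁ suc n (λ i<j _ eq → ℕ.<⇒≢ i<j (ℕ.suc-injective eq))

  ∈-range⁺ : ∀ {i n} → 1 ≤ i → i ≤ n → i ∈ range n
  ∈-range⁺ {suc i} _ i≤n = ∈.∈-applyUpTo⁺ suc i≤n

  ∈-range⁻ : ∀ {i n} → i ∈ range n → 1 ≤ i × i ≤ n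
  ∈-range⁻ i∈ with ∈.∈-applyUpTo⁻ suc i∈
  ... | _ , i<n , refl = s≤s z≤n , i<n

  grid-unique : ∀ n → Unique (grid n)
  grid-unique n = Unique.cartesianProduct⁺ (range-unique n) (range-unique n)

  grid-length : ∀ n → length (grid n) ≡ n * n
  grid-length n = trans (length-cartesianProduct (range n) (range n)) (cong₂ _*_ (length-applyUpTo suc n) (length-applyUpTo suc n))

  ∉-grid-bottom : ∀ {n i} → (i , 0) ∉ grid n
  ∉-grid-bottom {n} i∈ with () ← proj₁ (∈-range⁻ (proj₂ (∈.∈-cartesianProduct⁻ (range n) (range n) i∈)))

  -- The weighted vertex sits at (0 , 1) and not at the origin: the polynomials also use (1 , 0),
  -- one row below it, and coordinates are natural numbers.
  gridWindow : List Lattice²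
  gridWindow = cartesianProduct (0 ∷ 1 ∷ 2 ∷ []) (0 ∷ 1 ∷ 2 ∷ 3 ∷ [])

  -- The weight of the vertex (i , suc j) is a fixed polynomial shifted by (i , j).
  record GridWeights (R : Rel Lattice² 0ℓ) (R-sym : Symmetric R) : Set where
    open Scanning R R-sym _≺ᴺ_ ≺ᴺ-asym
    field
      upperPoly lowerPoly : Polynomial Lattice²
      upper-within        : Within gridWindow upperPoly
      lower-within        : Within gridWindow (negate lowerPoly)
      nb                  : Lattice² → List Lattice²
      nb-length           : ∀ p → length (nb p) ≤ 6
      nb-∈                : ∀ {p q} → R q p → q ∈ nb p
      gain-≤              : ∀ s κ → s (shift κ (0 , 1)) ≡ true →
                            Gain≤ s (shift κ (0 , 1)) (eval s (instantiate (shift κ) upperPoly))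
      gain-≥              : ∀ s κ → s (shift κ (0 , 1)) ≡ true →
                            Gain≥ s (shift κ (0 , 1)) (eval s (instantiate (shift κ) lowerPoly))
      closed-≤            : ∀ s κ → s (shift κ (0 , 1)) ≡ false → 0ℤ ℤ.≤ eval s (instantiate (shift κ) upperPoly)
      closed-≥            : ∀ s κ → s (shift κ (0 , 1)) ≡ false → eval s (instantiate (shift κ) lowerPoly) ℤ.≤ 0ℤ

  module GridModel {R : Rel Lattice² 0ℓ} {R-sym : Symmetric R} (W : GridWeights R R-sym)
                   (n k : ℕ) (n≡ : n ≡ 3 + k) (G : Graph) (drawing : Drawing G (grid n) R) where
    open GridWeights W

    private
      N = Graph.order G

      ≤n : ∀ {x} → x ≤ 3 + k → x ≤ n
      ≤n = subst (_ ≤_) (sym n≡)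

    open OnPoints _≟ᴺ_ (grid n) (grid-unique n) R R-sym G drawing
    open Ordered _≺ᴺ_ ≺ᴺ-trans ≺ᴺ-asym ≺ᴺ-cmp

    private
      weight : Polynomial Lattice² → Lattice² → Polynomial Lattice²
      -- A default value: grid coordinates start at 1, so no vertex has second coordinate zero.
      weight p (i , zero)  = []
      weight p (i , suc j) = instantiate (shift (i , j)) p

      norm-weight : ∀ p v → norm (weight p v) ≤ norm p
      norm-weight p (i , zero)  = z≤n
      norm-weight p (i , suc j) = ℕ.≤-reflexive (norm-instantiate (shift (i , j)) p)

      bases : List Lattice²
      -- These ranges leave room for the window, which extends by two in the first coordinate and by
      -- three in the second.
      bases = cartesianProduct (range (1 + k)) (range k)

      ∈-bases : ∀ {i j} → (i , j) ∈ bases → (1 ≤ i × i ≤ 1 + k) × (1 ≤ j × j ≤ k)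
      ∈-bases κ∈ = let i∈ , j∈ = ∈.∈-cartesianProduct⁻ (range (1 + k)) (range k) κ∈ in ∈-range⁻ i∈ , ∈-range⁻ j∈

      window-∈ : ∀ {κ} → κ ∈ bases → ∀ {o} → o ∈ gridWindow → shift κ o ∈ grid n
      window-∈ {i , j} κ∈ {a , b} o∈ =
        let (1≤i , i≤) , (1≤j , j≤) = ∈-bases κ∈
            a∈ , b∈ = ∈.∈-cartesianProduct⁻ (0 ∷ 1 ∷ 2 ∷ []) (0 ∷ 1 ∷ 2 ∷ 3 ∷ []) o∈
        in ∈.∈-cartesianProduct⁺
          (∈-range⁺ (ℕ.≤-trans 1≤i (ℕ.m≤n+m i a))
            (≤n (ℕ.+-mono-≤ (All.lookup {P = _≤ 2} (z≤n ∷ s≤s z≤n ∷ s≤s (s≤s z≤n) ∷ []) a∈) i≤)))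
          (∈-range⁺ (ℕ.≤-trans 1≤j (ℕ.m≤n+m j b))
            (≤n (ℕ.+-mono-≤ (All.lookup {P = _≤ 3} (z≤n ∷ s≤s z≤n ∷ s≤s (s≤s z≤n) ∷ s≤s (s≤s (s≤s z≤n)) ∷ []) b∈) j≤)))

      member : Lattice² → List Lattice²
      member κ = shift κ (0 , 1) ∷ []

      concatMap-member : ∀ κs → concatMap member κs ≡ map (λ κ → shift κ (0 , 1)) κs
      concatMap-member []       = refl
      concatMap-member (κ ∷ κs) = cong (_ ∷_) (concatMap-member κs)

      gridCells : Cells
      gridCells = record
        { Cell    = Lattice²
        ; cells   = bases
        ; members = member
        ; unique  = subst Unique (sym (concatMap-member bases))
                      (Unique.map⁺ (λ eq → cong₂ _,_ (cong proj₁ eq) (ℕ.suc-injective (cong proj₂ eq)))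
                        (Unique.cartesianProduct⁺ (range-unique (1 + k)) (range-unique k)))
        ; within  = λ {v} v∈ → let κ , κ∈ , eq = ∈.∈-map⁻ (λ κ → shift κ (0 , 1)) (subst (v ∈_) (concatMap-member bases) v∈)
                               in subst (_∈ grid n) (sym eq) (window-∈ κ∈ {0 , 1} (there (here refl)))
        }

      cellBound : ∀ p → Within gridWindow p → ∀ {b} → norm p ≤ b → CellBound gridCells (weight p) (profile p) b
      cellBound p w le = record
        { cellWeight = λ κ → instantiate (shift κ) p
        ; cell-≤     = λ {κ} _ s _ → ℤ.≤-reflexive (ℤ.+-identityʳ (eval s (instantiate (shift κ) p)))
        ; valid      = λ {κ} κ∈ → instantiate-valid (shift κ) (shift-injective κ) (All.tabulate (window-∈ κ∈)) w
        ; shape      = λ κ → same (shift κ) p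
        ; norm-≤     = λ v → ℕ.≤-trans (norm-weight p v) le
        }
        where
        same : (f : Lattice² → Lattice²) → ∀ p → profile (instantiate f p) ≡ profile p
        same f []            = refl
        same f ((c , A) ∷ p) = cong₂ _∷_ (cong (c ,_) (length-map f A)) (same f p)

      ∈-suc : ∀ {i} {P : Set} → (i , 0) ∈ grid n → P
      ∈-suc i∈ = contradiction i∈ (∉-grid-bottom {n})

      open Cells gridCells using (margin)

      cells-length : length bases ≡ (1 + k) * k
      cells-length = trans (length-cartesianProduct (range (1 + k)) (range k)) (cong₂ _*_ (length-applyUpTo suc (1 + k)) (length-applyUpTo suc k))

      size : 1 * length bases + margin ≡ N
      size = trans (cong (_+ margin) (trans (ℕ.*-identityˡ (length bases)) (sym (trans (cong length (concatMap-member bases)) (length-map _ bases))))) (Cells.size gridCells)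

    margin-≡ : margin ≡ 5 * k + 9
    margin-≡ = ℕ.+-cancelˡ-≡ ((1 + k) * k) _ _ (trans
      (trans (cong (_+ margin) (trans (sym cells-length) (sym (ℕ.*-identityˡ (length bases))))) (trans size (trans (sym (Drawing.vs-length drawing)) (trans (grid-length n) (cong (λ n → n * n) n≡)))))
      (lem k))
      where
      lem : ∀ k → (3 + k) * (3 + k) ≡ (1 + k) * k + (5 * k + 9)
      lem = ℕRing.solve-∀

    private
      -- The gain bounds hold at boundary vertices too, since points outside the grid simply count
      -- as closed. The margin matters only for the averages.
      weights-≤ : ∀ {m} (le : m ≤ N) w → Vec.Unique w →
                  + clustersOf G le w ℤ.≤ Σᴸ (λ v → eval (opened le w) (weight upperPoly v)) (grid n)
      weights-≤ le w w! = clusters-≤-weight le w w! (λ v → eval (opened le w) (weight upperPoly v))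
        (λ { {i , zero} v∈ → ∈-suc v∈ ; {i , suc j} v∈ → gain-≤ (opened le w) (i , j) })
        (λ { {i , zero} v∈ → ∈-suc v∈ ; {i , suc j} v∈ → closed-≤ (opened le w) (i , j) })

      weights-≥ : ∀ {m} (le : m ≤ N) w → Vec.Unique w →
                  Σᴸ (λ v → eval (opened le w) (weight lowerPoly v)) (grid n) ℤ.≤ + clustersOf G le w
      weights-≥ le w w! = clusters-≥-weight le w w! (λ v → eval (opened le w) (weight lowerPoly v))
        (λ { {i , zero} v∈ → ∈-suc v∈ ; {i , suc j} v∈ → gain-≥ (opened le w) (i , j) })
        (λ { {i , zero} v∈ → ∈-suc v∈ ; {i , suc j} v∈ → closed-≥ (opened le w) (i , j) })

    analysed : ∀ b → norm upperPoly ≤ b → norm (negate lowerPoly) ≤ b →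
               Analysed G 1 b (profile upperPoly) (profile lowerPoly)
    analysed b norm-U norm-L = record
      { M         = length bases
      ; margin    = margin
      ; size      = size
      ; upper     = λ le → Σ-clusters-≤ gridCells le (λ w → + clustersOf G le w) (weight upperPoly)
                      (cellBound upperPoly upper-within norm-U) (weights-≤ le)
      ; lower     = λ le → subst₂ (λ x p → x ℤ.≤ + length bases ℤ.* moment N _ p ℤ.+ + (N !) ℤ.* + (margin * b))
                      (Σ-orderings-neg N N [] _) (profile-negate lowerPoly)
                      (Σ-clusters-≤ gridCells le (λ w → ℤ.- (+ clustersOf G le w)) (weight (negate lowerPoly))
                        (cellBound (negate lowerPoly) lower-within norm-L)
                        (λ w w! → subst (ℤ.- (+ clustersOf G le w) ℤ.≤_)
                          (sym (negated (opened le w) (grid n))) (ℤ.neg-mono-≤ (weights-≥ le w w!))))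
      ; lipschitz = clusters-lipschitz nb nb-length nb-∈
      ; step      = clusters-step
      }
      where
      weight-negate : ∀ s v → eval s (weight (negate lowerPoly) v) ≡ ℤ.- eval s (weight lowerPoly v)
      weight-negate s (i , zero)  = refl
      weight-negate s (i , suc j) = trans (cong (eval s) (instantiate-negate (shift (i , j)) lowerPoly)) (eval-negate s (instantiate (shift (i , j)) lowerPoly))
      negated : ∀ s vs → Σᴸ (λ v → eval s (weight (negate lowerPoly) v)) vs ≡ ℤ.- Σᴸ (λ v → eval s (weight lowerPoly v)) vs
      negated s vs = trans (Σᴸ-cong vs (λ {v} _ → weight-negate s v)) (Σᴸ-neg _ vs)

-- The square lattice.

module Squares where
  open import Defs
  open Clusters
  open Scan
  open Model
  open import Data.Bool.Base using (Bool; true; false)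
  open import Data.Bool.ListAction using (all)
  open import Data.Integer.Base as ℤ using (ℤ; +_; 0ℤ; 1ℤ)
  import Data.Integer.Properties as ℤ
  open import Data.List.Base using (List; []; _∷_; map; lookup)
  open import Data.List.Membership.Propositional using (_∈_)
  import Data.List.Membership.Propositional.Properties as ∈
  open import Data.List.Relation.Unary.All using ([]; _∷_)
  open import Data.List.Relation.Unary.AllPairs using ([]; _∷_)
  open import Data.List.Relation.Unary.Any as Any using (Any; here; there)
  import Data.List.Relation.Unary.Any.Properties as Any
  open import Data.Nat.Base as ℕ using (ℕ; zero; suc; pred; _+_; _≤_; z≤n; s≤s; ∣_-_∣)
  import Data.Nat.Properties as ℕ
  open import Data.Product.Base using (_×_; _,_; proj₁)
  open import Data.Sum.Base using (_⊎_; inj₁; inj₂)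
  open import Level using (0ℓ)
  open import Relation.Binary.Construct.Closure.ReflexiveTransitive using (ε; _◅_)
  open import Relation.Binary.Core using (Rel)
  open import Relation.Binary.Definitions using (Symmetric)
  open import Relation.Binary.PropositionalEquality
  open import Relation.Nullary.Decidable using (from-yes)
  open import Relation.Nullary.Negation using (¬_; contradiction)
  open Grids

  -- Unit distance spelled out as four steps, so that the neighbours of a vertex are found by
  -- matching. A constructor names the direction from the first point to the second.
  data Near : Rel Lattice² 0ℓ where
    east  : ∀ {i j} → Near (i , j) (suc i , j)
    north : ∀ {i j} → Near (i , j) (i , suc j)
    west  : ∀ {i j} → Near (suc i , j) (i , j)
    south : ∀ {i j} → Near (i , suc j) (i , j)

  Near-sym : Symmetric Near
  Near-sym east  = west
  Near-sym north = south
  Near-sym west  = east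
  Near-sym south = north

  private
    ∣-∣≡1 : ∀ i k → ∣ i - k ∣ ≡ 1 → k ≡ suc i ⊎ i ≡ suc k
    ∣-∣≡1 zero    (suc k) refl = inj₁ refl
    ∣-∣≡1 (suc i) zero    refl = inj₂ refl
    ∣-∣≡1 (suc i) (suc k) eq with ∣-∣≡1 i k eq
    ... | inj₁ refl = inj₁ refl
    ... | inj₂ refl = inj₂ refl

    ∣n-1+n∣ : ∀ n → ∣ n - suc n ∣ ≡ 1
    ∣n-1+n∣ zero    = refl
    ∣n-1+n∣ (suc n) = ∣n-1+n∣ n

    ∣1+n-n∣ : ∀ n → ∣ suc n - n ∣ ≡ 1
    ∣1+n-n∣ zero    = refl
    ∣1+n-n∣ (suc n) = ∣1+n-n∣ n

    sum-of-squares≡1 : ∀ a b → a ℕ.^ 2 + b ℕ.^ 2 ≡ 1 → (a ≡ 0 × b ≡ 1) ⊎ (a ≡ 1 × b ≡ 0)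
    sum-of-squares≡1 zero          (suc zero)    _  = inj₁ (refl , refl)
    sum-of-squares≡1 (suc zero)    zero          _  = inj₂ (refl , refl)
    sum-of-squares≡1 zero          zero          ()
    sum-of-squares≡1 zero          (suc (suc b)) ()
    sum-of-squares≡1 (suc zero)    (suc b)       ()
    sum-of-squares≡1 (suc (suc a)) b             ()

  unit⇒near : ∀ p q → UnitDistance p q → Near p q
  unit⇒near (i , j) (k , l) eq with sum-of-squares≡1 ∣ i - k ∣ ∣ j - l ∣ eq
  ... | inj₁ (i≡k , jl) with refl ← ℕ.∣m-n∣≡0⇒m≡n {i} {k} i≡k with ∣-∣≡1 j l jl
  ... | inj₁ refl = north
  ... | inj₂ refl = south
  unit⇒near (i , j) (k , l) eq | inj₂ (ik , j≡l) with refl ← ℕ.∣m-n∣≡0⇒m≡n {j} {l} j≡l with ∣-∣≡1 i k ik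
  ... | inj₁ refl = east
  ... | inj₂ refl = west

  near⇒unit : ∀ {p q} → Near p q → UnitDistance p q
  near⇒unit (east  {i} {j}) rewrite ∣n-1+n∣ i | ℕ.∣n-n∣≡0 j = refl
  near⇒unit (north {i} {j}) rewrite ∣n-1+n∣ j | ℕ.∣n-n∣≡0 i = refl
  near⇒unit (west  {i} {j}) rewrite ∣1+n-n∣ i | ℕ.∣n-n∣≡0 j = refl
  near⇒unit (south {i} {j}) rewrite ∣1+n-n∣ j | ℕ.∣n-n∣≡0 i = refl

  squareDrawing : ∀ n → Drawing (square n) (grid n) Near
  squareDrawing n = record
    { ℓ           = lookup (grid n)
    ; ℓ-injective = lookup-injective (grid-unique n)
    ; ℓ-∈         = ∈.∈-lookup
    ; ℓ-onto      = λ p∈ → Any.index p∈ , sym (Any.lookup-index p∈)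
    ; vs-length   = refl
    ; adj⇒        = unit⇒near _ _
    ; adj⇐        = near⇒unit
    }

  private
    ring : List Lattice²
    ring = (0 , 3) ∷ (1 , 3) ∷ (2 , 3) ∷ (2 , 2) ∷ (2 , 1) ∷ []

  -- With d = (0 , 2) and l = (1 , 1) the later neighbours of the vertex (0 , 1) and c = (1 , 2) the
  -- fourth corner of their square: if d and l are open and c is not, a path from d to l must leave d
  -- through (0 , 3) and enter l through (1 , 0) or (2 , 1); and the ring around c is such a path.
  squareUpper squareLower : Polynomial Lattice²
  squareUpper =
    ⊞ ((0 , 1) ∷ []) ∷ ⊟ ((0 , 1) ∷ (1 , 1) ∷ []) ∷ ⊟ ((0 , 1) ∷ (0 , 2) ∷ []) ∷
    ⊞ ((0 , 1) ∷ (1 , 1) ∷ (0 , 2) ∷ (1 , 2) ∷ []) ∷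
    ⊞ ((0 , 1) ∷ (1 , 1) ∷ (0 , 2) ∷ (0 , 3) ∷ (2 , 1) ∷ []) ∷
    ⊞ ((0 , 1) ∷ (1 , 1) ∷ (0 , 2) ∷ (0 , 3) ∷ (1 , 0) ∷ []) ∷
    ⊟ ((0 , 1) ∷ (1 , 1) ∷ (0 , 2) ∷ (0 , 3) ∷ (2 , 1) ∷ (1 , 0) ∷ []) ∷
    ⊟ ((0 , 1) ∷ (1 , 1) ∷ (0 , 2) ∷ (1 , 2) ∷ (0 , 3) ∷ (2 , 1) ∷ []) ∷
    ⊟ ((0 , 1) ∷ (1 , 1) ∷ (0 , 2) ∷ (1 , 2) ∷ (0 , 3) ∷ (1 , 0) ∷ []) ∷
    ⊞ ((0 , 1) ∷ (1 , 1) ∷ (0 , 2) ∷ (1 , 2) ∷ (0 , 3) ∷ (2 , 1) ∷ (1 , 0) ∷ []) ∷ []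
  squareLower =
    ⊞ ((0 , 1) ∷ []) ∷ ⊟ ((0 , 1) ∷ (1 , 1) ∷ []) ∷ ⊟ ((0 , 1) ∷ (0 , 2) ∷ []) ∷
    ⊞ ((0 , 1) ∷ (1 , 1) ∷ (0 , 2) ∷ (1 , 2) ∷ []) ∷
    ⊞ ((0 , 1) ∷ (1 , 1) ∷ (0 , 2) ∷ ring) ∷
    ⊟ ((0 , 1) ∷ (1 , 1) ∷ (0 , 2) ∷ (1 , 2) ∷ ring) ∷ []

  private
    open Scanning Near Near-sym _≺ᴺ_ ≺ᴺ-asym

    nb : Lattice² → List Lattice²
    nb (i , j) = (suc i , j) ∷ (i , suc j) ∷ (pred i , j) ∷ (i , pred j) ∷ []

    nb-∈ : ∀ {p q} → Near q p → p ∈ nb q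
    nb-∈ east  = here refl
    nb-∈ north = there (here refl)
    nb-∈ west  = there (there (here refl))
    nb-∈ south = there (there (there (here refl)))

    module _ (s : Lattice² → Bool) (i j : ℕ) where
      v l d c : Lattice²
      v = (i , 1 + j)
      l = (1 + i , 1 + j)
      d = (i , 2 + j)
      c = (1 + i , 2 + j)

      weightU weightL : ℤ
      weightU = eval s (instantiate (shift (i , j)) squareUpper)
      weightL = eval s (instantiate (shift (i , j)) squareLower)

      column≻ : ∀ {a b} → v ≺ᴺ (suc a + i , b)
      column≻ {a} = inj₁ (s≤s (ℕ.m≤n+m i a))

      row≻ : ∀ {b} → v ≺ᴺ (i , suc (suc b) + j)
      row≻ {b} = inj₂ (refl , s≤s (s≤s (ℕ.m≤n+m j b)))

      U-closed : s v ≡ false → 0ℤ ℤ.≤ weightU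
      U-closed sv rewrite sv = ℤ.≤-refl
      -- The digits are the states of `l` and `d`. Each of these finite checks compares the weight
      -- with the number of representatives that `upper-gain` uses in that case.
      U00 : s v ≡ true → s l ≡ false → s d ≡ false → 1ℤ ℤ.≤ weightU ℤ.+ + 0
      U00 sv sl sd rewrite sv | sl | sd = ℤ.≤-refl
      U10 : s v ≡ true → s l ≡ true → s d ≡ false → 1ℤ ℤ.≤ weightU ℤ.+ + 1
      U10 sv sl sd rewrite sv | sl | sd = ℤ.≤-refl
      U01 : s v ≡ true → s l ≡ false → s d ≡ true → 1ℤ ℤ.≤ weightU ℤ.+ + 1
      U01 sv sl sd rewrite sv | sl | sd = ℤ.≤-refl
      U11 : s v ≡ true → s l ≡ true → s d ≡ true → s c ≡ true → 1ℤ ℤ.≤ weightU ℤ.+ + 1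
      U11 sv sl sd sc rewrite sv | sl | sd | sc with s (i , 3 + j) | s (2 + i , 1 + j) | s (1 + i , j)
      ... | false | _     | _     = ℤ.≤-refl
      ... | true  | false | false = ℤ.≤-refl
      ... | true  | false | true  = ℤ.≤-refl
      ... | true  | true  | false = ℤ.≤-refl
      ... | true  | true  | true  = ℤ.≤-refl

      C : Rel Lattice² 0ℓ
      C = Conn Near Near-sym (Later s v)

      path : ∀ {p q r} → Later s v p → Later s v q → Near p q → C q r → C p r
      path p q r c = (p , q , r) ◅ c

      -- For a later `w` the direction `west` means w = l and `south` means w = d; the other two
      -- directions would put `w` before `v`.
      only-l : s l ≡ true → s d ≡ false ⊎ C d l → ∀ {w} → Later s v w → Near w v →
               Any (C w) (l ∷ [])
      only-l sl _             (sw , _)               west  = here ε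
      only-l sl (inj₁ sd)     (sw , _)               south = contradiction (trans (sym sd) sw) λ ()
      only-l sl (inj₂ d~l)    (sw , _)               south = here d~l
      only-l sl _             (_ , w≻)               north = contradiction w≻ λ { (inj₁ p) → ℕ.<-irrefl refl p ; (inj₂ (_ , p)) → ℕ.<-irrefl refl (ℕ.<-trans (ℕ.n<1+n _) p) }
      only-l sl _             (_ , inj₁ p)           east  = contradiction (ℕ.<-trans (ℕ.n<1+n _) p) (ℕ.<-irrefl refl)
      only-l sl _             (_ , inj₂ (() , _))    east

      near-both : ∀ {w} → Later s v w → Near w v → Any (C w) (l ∷ d ∷ [])
      near-both (sw , _)            west  = here ε
      near-both (sw , _)            south = there (here ε)
      near-both (_ , w≻)            north = contradiction w≻ λ { (inj₁ p) → ℕ.<-irrefl refl p ; (inj₂ (_ , p)) → ℕ.<-irrefl refl (ℕ.<-trans (ℕ.n<1+n _) p) }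
      near-both (_ , inj₁ p)        east  = contradiction (ℕ.<-trans (ℕ.n<1+n _) p) (ℕ.<-irrefl refl)
      near-both (_ , inj₂ (() , _)) east

      later-l : s l ≡ true → Later s v l
      later-l sl = sl , column≻ {0}
      later-d : s d ≡ true → Later s v d
      later-d sd = sd , row≻ {0}

      d-isolated : s c ≡ false → s (i , 3 + j) ≡ false → ∀ {w} → Later s v w → ¬ Near d w
      d-isolated sc sdd (sw , _) east  = contradiction (trans (sym sc) sw) λ ()
      d-isolated sc sdd (sw , _) north = contradiction (trans (sym sdd) sw) λ ()
      d-isolated sc sdd (_ , inj₁ p) west  = ℕ.<-irrefl refl (ℕ.<-trans (ℕ.n<1+n _) p)
      d-isolated sc sdd (_ , inj₂ (() , _)) west
      d-isolated sc sdd (_ , v≺v) south = ≺ᴺ-asym v≺v v≺v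

      l-isolated : s c ≡ false → s (2 + i , 1 + j) ≡ false → s (1 + i , j) ≡ false → ∀ {w} → Later s v w → ¬ Near l w
      l-isolated sc s₁ s₂ (sw , _) east  = contradiction (trans (sym s₁) sw) λ ()
      l-isolated sc s₁ s₂ (sw , _) north = contradiction (trans (sym sc) sw) λ ()
      l-isolated sc s₁ s₂ (_ , v≺v) west = ≺ᴺ-asym v≺v v≺v
      l-isolated sc s₁ s₂ (sw , _) south = contradiction (trans (sym s₂) sw) λ ()

      -- With `v`, `l` and `d` open the weight is -1 plus the indicator of a possible link, hence at
      -- least -1 in every case.
      U11-apart : s v ≡ true → s l ≡ true → s d ≡ true → 1ℤ ℤ.≤ weightU ℤ.+ + 2
      U11-apart sv sl sd rewrite sv | sl | sd with s (1 + i , 2 + j) | s (i , 3 + j) | s (2 + i , 1 + j) | s (1 + i , j)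
      ... | false | false | _     | _     = ℤ.≤-refl
      ... | false | true  | false | false = ℤ.≤-refl
      ... | false | true  | false | true  = ℤ.+≤+ (s≤s z≤n)
      ... | false | true  | true  | false = ℤ.+≤+ (s≤s z≤n)
      ... | false | true  | true  | true  = ℤ.+≤+ (s≤s z≤n)
      ... | true  | false | _     | _     = ℤ.+≤+ (s≤s z≤n)
      ... | true  | true  | false | false = ℤ.+≤+ (s≤s z≤n)
      ... | true  | true  | false | true  = ℤ.+≤+ (s≤s z≤n)
      ... | true  | true  | true  | false = ℤ.+≤+ (s≤s z≤n)
      ... | true  | true  | true  | true  = ℤ.+≤+ (s≤s z≤n)
      U11-link : s v ≡ true → s l ≡ true → s d ≡ true → s (i , 3 + j) ≡ true → s (2 + i , 1 + j) ≡ true ⊎ s (1 + i , j) ≡ true →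
                 1ℤ ℤ.≤ weightU ℤ.+ + 1
      U11-link sv sl sd sdd (inj₁ s₁) rewrite sv | sl | sd | sdd | s₁ with s (1 + i , 2 + j) | s (1 + i , j)
      ... | false | false = ℤ.≤-refl
      ... | false | true  = ℤ.≤-refl
      ... | true  | false = ℤ.≤-refl
      ... | true  | true  = ℤ.≤-refl
      U11-link sv sl sd sdd (inj₂ s₂) rewrite sv | sl | sd | sdd | s₂ with s (1 + i , 2 + j) | s (2 + i , 1 + j)
      ... | false | false = ℤ.≤-refl
      ... | false | true  = ℤ.≤-refl
      ... | true  | false = ℤ.≤-refl
      ... | true  | true  = ℤ.≤-refl

      -- If a link is possible, one representative gives the bound. Otherwise `d` or `l` is isolated
      -- among the later open vertices, so the two are certainly apart.
      upper-gain : s v ≡ true → Gain≤ s v weightU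
      upper-gain sv = go (s l) (s d) (s c) (s (i , 3 + j)) (s (2 + i , 1 + j)) (s (1 + i , j)) refl refl refl refl refl refl
        where
        one-l : s l ≡ true → 1ℤ ℤ.≤ weightU ℤ.+ + 1 → Gain≤ s v weightU
        one-l sl bd = record { reps = l ∷ [] ; adjacent = (later-l sl , west) ∷ [] ; apart = [] ∷ [] ; bound = bd }
        two : s l ≡ true → s d ≡ true → ¬ C l d → Gain≤ s v weightU
        two sl sd l≁d = record
          { reps = l ∷ d ∷ [] ; adjacent = (later-l sl , west) ∷ (later-d sd , south) ∷ []
          ; apart = (l≁d ∷ []) ∷ [] ∷ [] ; bound = U11-apart sv sl sd }
        l≢d : l ≢ d
        l≢d eq = ℕ.1+n≢n (cong proj₁ eq)
        go : ∀ bl bd bc bdd b₁ b₂ → s l ≡ bl → s d ≡ bd → s c ≡ bc → s (i , 3 + j) ≡ bdd → s (2 + i , 1 + j) ≡ b₁ →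
             s (1 + i , j) ≡ b₂ → Gain≤ s v weightU
        go false false _ _ _ _ sl sd _ _ _ _ = record { reps = [] ; adjacent = [] ; apart = [] ; bound = U00 sv sl sd }
        go true  false _ _ _ _ sl sd _ _ _ _ = one-l sl (U10 sv sl sd)
        go false true  _ _ _ _ sl sd _ _ _ _ = record
          { reps = d ∷ [] ; adjacent = (later-d sd , south) ∷ [] ; apart = [] ∷ [] ; bound = U01 sv sl sd }
        go true true true  _     _     _     sl sd sc _ _ _ = one-l sl (U11 sv sl sd sc)
        go true true false false _     _     sl sd sc sdd _ _ =
          two sl sd (λ p → l≢d (sym (isolated Near Near-sym (d-isolated sc sdd) (Conn-sym Near Near-sym p))))
        go true true false true  false false sl sd sc _ s₁ s₂ =
          two sl sd (λ p → l≢d (isolated Near Near-sym (l-isolated sc s₁ s₂) p))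
        go true true false true  true  _     sl sd _ sdd s₁ _ = one-l sl (U11-link sv sl sd sdd (inj₁ s₁))
        go true true false true  false true  sl sd _ sdd _ s₂ = one-l sl (U11-link sv sl sd sdd (inj₂ s₂))

      ringᵛ : List Lattice²
      ringᵛ = map (shift (i , j)) ring

      L-closed : s v ≡ false → weightL ℤ.≤ 0ℤ
      L-closed sv rewrite sv = ℤ.≤-refl
      L00 : s v ≡ true → s l ≡ false → s d ≡ false → weightL ℤ.+ + 0 ℤ.≤ 1ℤ
      L00 sv sl sd rewrite sv | sl | sd = ℤ.≤-refl
      L10 : s v ≡ true → s l ≡ true → s d ≡ false → weightL ℤ.+ + 1 ℤ.≤ 1ℤ
      L10 sv sl sd rewrite sv | sl | sd = ℤ.≤-refl
      L01 : s v ≡ true → s l ≡ false → s d ≡ true → weightL ℤ.+ + 1 ℤ.≤ 1ℤ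
      L01 sv sl sd rewrite sv | sl | sd = ℤ.≤-refl
      L11 : s v ≡ true → s l ≡ true → s d ≡ true → weightL ℤ.+ + 1 ℤ.≤ 1ℤ
      L11 sv sl sd rewrite sv | sl | sd with s (1 + i , 2 + j) | all s ringᵛ
      ... | false | false = ℤ.+≤+ z≤n
      ... | false | true  = ℤ.≤-refl
      ... | true  | false = ℤ.≤-refl
      ... | true  | true  = ℤ.≤-refl
      L11-apart : s v ≡ true → s l ≡ true → s d ≡ true → s c ≡ false → all s ringᵛ ≡ false → weightL ℤ.+ + 2 ℤ.≤ 1ℤ
      L11-apart sv sl sd sc sr rewrite sv | sl | sd | sc | sr = ℤ.≤-refl

      -- A walk through `c` or along the ring makes one representative enough. In the remaining case
      -- both neighbours are listed, which is safe even if they happen to be connected, since a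
      -- longer list only weakens the bound.
      lower-gain : s v ≡ true → Gain≥ s v weightL
      lower-gain sv = go (s l) (s d) (s c) (all s ringᵛ) refl refl refl refl
        where
        go : ∀ bl bd bc br → s l ≡ bl → s d ≡ bd → s c ≡ bc → all s ringᵛ ≡ br → Gain≥ s v weightL
        go false false _ _ sl sd _ _ = record { reps = [] ; near = λ lw r → none lw (near-both lw r) ; bound = L00 sv sl sd }
          where
          none : ∀ {w} → Later s v w → Any (C w) (l ∷ d ∷ []) → Any (C w) []
          none lw (here c)         = contradiction (trans (sym sl) (proj₁ (Conn-target Near Near-sym lw c))) λ ()
          none lw (there (here c)) = contradiction (trans (sym sd) (proj₁ (Conn-target Near Near-sym lw c))) λ ()
        go true false _ _ sl sd _ _ = record { reps = l ∷ [] ; near = only-l sl (inj₁ sd) ; bound = L10 sv sl sd }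
        go false true _ _ sl sd _ _ = record { reps = d ∷ [] ; near = λ lw r → drop-l lw (near-both lw r) ; bound = L01 sv sl sd }
          where
          drop-l : ∀ {w} → Later s v w → Any (C w) (l ∷ d ∷ []) → Any (C w) (d ∷ [])
          drop-l lw (here c)  = contradiction (trans (sym sl) (proj₁ (Conn-target Near Near-sym lw c))) λ ()
          drop-l lw (there i) = i
        go true true true _ sl sd sc _ = record
          { reps = l ∷ [] ; bound = L11 sv sl sd
          ; near = only-l sl (inj₂ (path (later-d sd) (sc , column≻ {0}) east (path (sc , column≻ {0}) (later-l sl) south ε))) }
        go true true false false sl sd sc sr = record { reps = l ∷ d ∷ [] ; near = near-both ; bound = L11-apart sv sl sd sc sr }
        go true true false true sl sd sc sr with all-true s ringᵛ sr
        ... | s₁ ∷ s₂ ∷ s₃ ∷ s₄ ∷ s₅ ∷ [] = record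
          { reps = l ∷ [] ; bound = L11 sv sl sd
          ; near = only-l sl (inj₂
              (path (later-d sd) p₁ north (path p₁ p₂ east (path p₂ p₃ east (path p₃ p₄ south
                (path p₄ p₅ south (path p₅ (later-l sl) west ε))))))) }
          where
          p₁ = s₁ , row≻ {1}
          p₂ = s₂ , column≻ {0}
          p₃ = s₃ , column≻ {1}
          p₄ = s₄ , column≻ {1}
          p₅ = s₅ , column≻ {1}

  squareWeights : GridWeights Near Near-sym
  squareWeights = record
    { upperPoly    = squareUpper
    ; lowerPoly    = squareLower
    ; upper-within = from-yes (within? gridWindow squareUpper)
    ; lower-within = from-yes (within? gridWindow (negate squareLower))
    ; nb           = nb
    ; nb-length    = λ _ → s≤s (s≤s (s≤s (s≤s z≤n)))
    ; nb-∈         = λ r → nb-∈ (Near-sym r)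
    ; gain-≤       = λ s (i , j) → upper-gain s i j
    ; gain-≥       = λ s (i , j) → lower-gain s i j
    ; closed-≤     = λ s (i , j) → U-closed s i j
    ; closed-≥     = λ s (i , j) → L-closed s i j
    }

-- The triangular lattice.

module Triangles where
  open import Defs
  open Clusters
  open Scan
  open Model
  open import Data.Bool.Base using (Bool; true; false)
  open import Data.Bool.ListAction using (all)
  open import Data.Integer.Base as ℤ using (ℤ; +_; 0ℤ; 1ℤ)
  import Data.Integer.Properties as ℤ
  open import Data.List.Base using (List; []; _∷_; map; lookup)
  open import Data.List.Membership.Propositional using (_∈_)
  import Data.List.Membership.Propositional.Properties as ∈
  open import Data.List.Relation.Unary.All using ([]; _∷_)
  open import Data.List.Relation.Unary.AllPairs using ([]; _∷_)
  open import Data.List.Relation.Unary.Any as Any using (Any; here; there)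
  import Data.List.Relation.Unary.Any.Properties as Any
  open import Data.Nat.Base as ℕ using (ℕ; suc; pred; _+_; _≤_; z≤n; s≤s)
  import Data.Nat.Properties as ℕ
  open import Data.Product.Base using (_,_; proj₁)
  open import Data.Sum.Base using (_⊎_; inj₁; inj₂)
  open import Level using (0ℓ)
  open import Relation.Binary.Construct.Closure.ReflexiveTransitive using (ε; _◅_)
  open import Relation.Binary.Construct.Closure.Symmetric as Sym using (SymClosure; fwd; bwd)
  open import Relation.Binary.Core using (Rel)
  open import Relation.Binary.Definitions using (Symmetric)
  open import Relation.Binary.PropositionalEquality
  open import Relation.Nullary.Decidable using (from-yes)
  open import Relation.Nullary.Negation using (¬_; contradiction)
  open Grids

  private
    R : Rel Lattice² 0ℓ
    R = SymClosure TriangularStep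

    R-sym : Symmetric R
    R-sym = Sym.symmetric TriangularStep

  triangularDrawing : ∀ n → Drawing (triangular n) (grid n) (SymClosure TriangularStep)
  triangularDrawing n = record
    { ℓ           = lookup (grid n)
    ; ℓ-injective = lookup-injective (grid-unique n)
    ; ℓ-∈         = ∈.∈-lookup
    ; ℓ-onto      = λ p∈ → Any.index p∈ , sym (Any.lookup-index p∈)
    ; vs-length   = refl
    ; adj⇒        = λ r → r
    ; adj⇐        = λ r → r
    }

  private
    ring : List Lattice²
    ring = (1 , 2) ∷ (2 , 1) ∷ (2 , 0) ∷ []

  -- The later neighbours a = (0 , 2), b = (1 , 1), c = (1 , 0) of the vertex (0 , 1) form a path. If a
  -- and c are open and b is not, a path from a to c must leave a through (0 , 3) or (1 , 2); and the
  -- ring around b is such a path.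
  triangularUpper triangularLower : Polynomial Lattice²
  triangularUpper =
    ⊞ ((0 , 1) ∷ []) ∷ ⊟ ((0 , 1) ∷ (0 , 2) ∷ []) ∷ ⊟ ((0 , 1) ∷ (1 , 1) ∷ []) ∷ ⊟ ((0 , 1) ∷ (1 , 0) ∷ []) ∷
    ⊞ ((0 , 1) ∷ (0 , 2) ∷ (1 , 1) ∷ []) ∷ ⊞ ((0 , 1) ∷ (1 , 1) ∷ (1 , 0) ∷ []) ∷
    ⊞ ((0 , 1) ∷ (0 , 2) ∷ (1 , 0) ∷ (0 , 3) ∷ []) ∷
    ⊞ ((0 , 1) ∷ (0 , 2) ∷ (1 , 0) ∷ (1 , 2) ∷ []) ∷
    ⊟ ((0 , 1) ∷ (0 , 2) ∷ (1 , 0) ∷ (0 , 3) ∷ (1 , 2) ∷ []) ∷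
    ⊟ ((0 , 1) ∷ (0 , 2) ∷ (1 , 0) ∷ (1 , 1) ∷ (0 , 3) ∷ []) ∷
    ⊟ ((0 , 1) ∷ (0 , 2) ∷ (1 , 0) ∷ (1 , 1) ∷ (1 , 2) ∷ []) ∷
    ⊞ ((0 , 1) ∷ (0 , 2) ∷ (1 , 0) ∷ (1 , 1) ∷ (0 , 3) ∷ (1 , 2) ∷ []) ∷ []
  triangularLower =
    ⊞ ((0 , 1) ∷ []) ∷ ⊟ ((0 , 1) ∷ (0 , 2) ∷ []) ∷ ⊟ ((0 , 1) ∷ (1 , 1) ∷ []) ∷ ⊟ ((0 , 1) ∷ (1 , 0) ∷ []) ∷
    ⊞ ((0 , 1) ∷ (0 , 2) ∷ (1 , 1) ∷ []) ∷ ⊞ ((0 , 1) ∷ (1 , 1) ∷ (1 , 0) ∷ []) ∷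
    ⊞ ((0 , 1) ∷ (0 , 2) ∷ (1 , 0) ∷ ring) ∷
    ⊟ ((0 , 1) ∷ (0 , 2) ∷ (1 , 0) ∷ (1 , 1) ∷ ring) ∷ []

  private
    open Scanning R R-sym _≺ᴺ_ ≺ᴺ-asym

    nb : Lattice² → List Lattice²
    nb (i , j) = (suc i , j) ∷ (i , suc j) ∷ (suc i , pred j) ∷ (pred i , j) ∷ (i , pred j) ∷ (pred i , suc j) ∷ []

    nb-∈ : ∀ {p q} → R q p → p ∈ nb q
    nb-∈ (fwd right)     = here refl
    nb-∈ (fwd up)        = there (here refl)
    nb-∈ (fwd rightDown) = there (there (here refl))
    nb-∈ (bwd right)     = there (there (there (here refl)))
    nb-∈ (bwd up)        = there (there (there (there (here refl))))
    nb-∈ (bwd rightDown) = there (there (there (there (there (here refl)))))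

    module _ (s : Lattice² → Bool) (i j : ℕ) where
      v a b c : Lattice²
      v = (i , 1 + j)
      a = (i , 2 + j)
      b = (1 + i , 1 + j)
      c = (1 + i , j)

      ringᵛ : List Lattice²
      ringᵛ = map (shift (i , j)) ring

      weightU weightL : ℤ
      weightU = eval s (instantiate (shift (i , j)) triangularUpper)
      weightL = eval s (instantiate (shift (i , j)) triangularLower)

      C : Rel Lattice² 0ℓ
      C = Conn R R-sym (Later s v)

      column≻ : ∀ {x y} → v ≺ᴺ (suc x + i , y)
      column≻ {x} = inj₁ (s≤s (ℕ.m≤n+m i x))

      row≻ : ∀ {y} → v ≺ᴺ (i , suc (suc y) + j)
      row≻ {y} = inj₂ (refl , s≤s (s≤s (ℕ.m≤n+m j y)))

      later-a : s a ≡ true → Later s v a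
      later-a sa = sa , row≻ {0}
      later-b : s b ≡ true → Later s v b
      later-b sb = sb , column≻ {0}
      later-c : s c ≡ true → Later s v c
      later-c sc = sc , column≻ {0}

      data Adjacent (w : Lattice²) : Set where
        is-a : w ≡ a → Adjacent w
        is-b : w ≡ b → Adjacent w
        is-c : w ≡ c → Adjacent w

    later-adjacent : ∀ s i j {w} → Later s (i , 1 + j) w → R w (i , 1 + j) → Adjacent s i j w
    later-adjacent s i j (_ , inj₁ p)        (fwd right)     = contradiction (ℕ.<-trans (ℕ.n<1+n _) p) (ℕ.<-irrefl refl)
    later-adjacent s i j (_ , inj₂ (() , _)) (fwd right)
    later-adjacent s i j (_ , inj₁ p)        (fwd up)        = contradiction p (ℕ.<-irrefl refl)
    later-adjacent s i j (_ , inj₂ (_ , p))  (fwd up)        = contradiction (ℕ.<-trans (ℕ.n<1+n _) p) (ℕ.<-irrefl refl)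
    later-adjacent s i j (_ , inj₁ p)        (fwd rightDown) = contradiction (ℕ.<-trans (ℕ.n<1+n _) p) (ℕ.<-irrefl refl)
    later-adjacent s i j (_ , inj₂ (() , _)) (fwd rightDown)
    later-adjacent s i j _                   (bwd right)     = is-b refl
    later-adjacent s i j _                   (bwd up)        = is-a refl
    later-adjacent s i j _                   (bwd rightDown) = is-c refl

    -- Besides `b` the only later neighbours of `a` are (0 , 3) and (1 , 2), the two exits that the
    -- upper polynomial tests.
    a-isolated : ∀ s i j → s (1 + i , 1 + j) ≡ false → s (i , 3 + j) ≡ false → s (1 + i , 2 + j) ≡ false →
                 ∀ {w} → Later s (i , 1 + j) w → ¬ R (i , 2 + j) w
    a-isolated s i j sb s₁ s₂ (sw , _)          (fwd right)     = contradiction (trans (sym s₂) sw) λ ()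
    a-isolated s i j sb s₁ s₂ (sw , _)          (fwd up)        = contradiction (trans (sym s₁) sw) λ ()
    a-isolated s i j sb s₁ s₂ (sw , _)          (fwd rightDown) = contradiction (trans (sym sb) sw) λ ()
    a-isolated s i j sb s₁ s₂ (_ , inj₁ p)      (bwd right)     = ℕ.<-irrefl refl (ℕ.<-trans (ℕ.n<1+n _) p)
    a-isolated s i j sb s₁ s₂ (_ , inj₂ (() , _)) (bwd right)
    a-isolated s i j sb s₁ s₂ (_ , v≺v)         (bwd up)        = ≺ᴺ-asym v≺v v≺v
    a-isolated s i j sb s₁ s₂ (_ , inj₁ p)      (bwd rightDown) = ℕ.<-irrefl refl (ℕ.<-trans (ℕ.n<1+n _) p)
    a-isolated s i j sb s₁ s₂ (_ , inj₂ (() , _)) (bwd rightDown)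

    module _ (s : Lattice² → Bool) (i j : ℕ) where
      private
        v′ = v s i j
        a′ = a s i j
        b′ = b s i j
        c′ = c s i j
        wU = weightU s i j
        wL = weightL s i j

      U-closed : s v′ ≡ false → 0ℤ ℤ.≤ wU
      U-closed sv rewrite sv = ℤ.≤-refl
      U000 : s v′ ≡ true → s a′ ≡ false → s b′ ≡ false → s c′ ≡ false → 1ℤ ℤ.≤ wU ℤ.+ + 0
      U000 sv sa sb sc rewrite sv | sa | sb | sc = ℤ.≤-refl
      U100 : s v′ ≡ true → s a′ ≡ true → s b′ ≡ false → s c′ ≡ false → 1ℤ ℤ.≤ wU ℤ.+ + 1
      U100 sv sa sb sc rewrite sv | sa | sb | sc = ℤ.≤-refl
      U001 : s v′ ≡ true → s a′ ≡ false → s b′ ≡ false → s c′ ≡ true → 1ℤ ℤ.≤ wU ℤ.+ + 1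
      U001 sv sa sb sc rewrite sv | sa | sb | sc = ℤ.≤-refl
      -- An open `b` is adjacent to both `a` and `c` and absorbs them. In the polynomial the terms
      -- of `a` and `c` cancel against their products with `b`, which leaves 0.
      U-b : s v′ ≡ true → s b′ ≡ true → 1ℤ ℤ.≤ wU ℤ.+ + 1
      U-b sv sb rewrite sv | sb with s (i , 2 + j) | s (1 + i , j) | s (i , 3 + j) | s (1 + i , 2 + j)
      ... | false | false | _     | _     = ℤ.≤-refl
      ... | false | true  | _     | _     = ℤ.≤-refl
      ... | true  | false | _     | _     = ℤ.≤-refl
      ... | true  | true  | false | false = ℤ.≤-refl
      ... | true  | true  | false | true  = ℤ.≤-refl
      ... | true  | true  | true  | false = ℤ.≤-refl
      ... | true  | true  | true  | true  = ℤ.≤-refl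
      U-apart : s v′ ≡ true → s a′ ≡ true → s b′ ≡ false → s c′ ≡ true → s (i , 3 + j) ≡ false → s (1 + i , 2 + j) ≡ false →
                1ℤ ℤ.≤ wU ℤ.+ + 2
      U-apart sv sa sb sc s₁ s₂ rewrite sv | sa | sb | sc | s₁ | s₂ = ℤ.≤-refl
      U-link : s v′ ≡ true → s a′ ≡ true → s b′ ≡ false → s c′ ≡ true → s (i , 3 + j) ≡ true ⊎ s (1 + i , 2 + j) ≡ true →
               1ℤ ℤ.≤ wU ℤ.+ + 1
      U-link sv sa sb sc (inj₁ s₁) rewrite sv | sa | sb | sc | s₁ with s (1 + i , 2 + j)
      ... | false = ℤ.≤-refl
      ... | true  = ℤ.≤-refl
      U-link sv sa sb sc (inj₂ s₂) rewrite sv | sa | sb | sc | s₂ with s (i , 3 + j)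
      ... | false = ℤ.≤-refl
      ... | true  = ℤ.≤-refl

      -- Since a, b, c form a path, the number of clusters they meet is in doubt only when `a` and
      -- `c` are open and `b` is closed; then two representatives are used exactly when both exits
      -- of `a` are closed.
      upper-gain : s v′ ≡ true → Gain≤ s v′ wU
      upper-gain sv = go (s a′) (s b′) (s c′) (s (i , 3 + j)) (s (1 + i , 2 + j)) refl refl refl refl refl
        where
        one-a : s a′ ≡ true → 1ℤ ℤ.≤ wU ℤ.+ + 1 → Gain≤ s v′ wU
        one-a sa bd = record { reps = a′ ∷ [] ; adjacent = (later-a s i j sa , bwd up) ∷ [] ; apart = [] ∷ [] ; bound = bd }
        go : ∀ ba bb bc b₁ b₂ → s a′ ≡ ba → s b′ ≡ bb → s c′ ≡ bc → s (i , 3 + j) ≡ b₁ → s (1 + i , 2 + j) ≡ b₂ → Gain≤ s v′ wU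
        go _ true _ _ _ _ sb _ _ _ =
          record { reps = b′ ∷ [] ; adjacent = (later-b s i j sb , bwd right) ∷ [] ; apart = [] ∷ [] ; bound = U-b sv sb }
        go false false false _ _ sa sb sc _ _ = record { reps = [] ; adjacent = [] ; apart = [] ; bound = U000 sv sa sb sc }
        go true  false false _ _ sa sb sc _ _ = one-a sa (U100 sv sa sb sc)
        go false false true  _ _ sa sb sc _ _ =
          record { reps = c′ ∷ [] ; adjacent = (later-c s i j sc , bwd rightDown) ∷ [] ; apart = [] ∷ [] ; bound = U001 sv sa sb sc }
        go true false true false false sa sb sc s₁ s₂ = record
          { reps = a′ ∷ c′ ∷ [] ; adjacent = (later-a s i j sa , bwd up) ∷ (later-c s i j sc , bwd rightDown) ∷ []
          ; apart = ((λ p → ℕ.1+n≢n (sym (cong proj₁ (isolated R R-sym (a-isolated s i j sb s₁ s₂) p)))) ∷ []) ∷ [] ∷ []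
          ; bound = U-apart sv sa sb sc s₁ s₂ }
        go true false true true  _    sa sb sc s₁ _ = one-a sa (U-link sv sa sb sc (inj₁ s₁))
        go true false true false true sa sb sc _ s₂ = one-a sa (U-link sv sa sb sc (inj₂ s₂))

      L-closed : s v′ ≡ false → wL ℤ.≤ 0ℤ
      L-closed sv rewrite sv = ℤ.≤-refl
      L000 : s v′ ≡ true → s a′ ≡ false → s b′ ≡ false → s c′ ≡ false → wL ℤ.+ + 0 ℤ.≤ 1ℤ
      L000 sv sa sb sc rewrite sv | sa | sb | sc = ℤ.≤-refl
      L100 : s v′ ≡ true → s a′ ≡ true → s b′ ≡ false → s c′ ≡ false → wL ℤ.+ + 1 ℤ.≤ 1ℤ
      L100 sv sa sb sc rewrite sv | sa | sb | sc = ℤ.≤-refl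
      L001 : s v′ ≡ true → s a′ ≡ false → s b′ ≡ false → s c′ ≡ true → wL ℤ.+ + 1 ℤ.≤ 1ℤ
      L001 sv sa sb sc rewrite sv | sa | sb | sc = ℤ.≤-refl
      L-b : s v′ ≡ true → s b′ ≡ true → wL ℤ.+ + 1 ℤ.≤ 1ℤ
      L-b sv sb rewrite sv | sb with s (i , 2 + j) | s (1 + i , j) | all s (ringᵛ s i j)
      ... | false | false | _     = ℤ.≤-refl
      ... | false | true  | _     = ℤ.≤-refl
      ... | true  | false | _     = ℤ.≤-refl
      ... | true  | true  | false = ℤ.≤-refl
      ... | true  | true  | true  = ℤ.≤-refl
      L-ring : s v′ ≡ true → s a′ ≡ true → s b′ ≡ false → s c′ ≡ true → wL ℤ.+ + 1 ℤ.≤ 1ℤ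
      L-ring sv sa sb sc rewrite sv | sa | sb | sc with all s (ringᵛ s i j)
      ... | false = ℤ.+≤+ z≤n
      ... | true  = ℤ.≤-refl
      L-apart : s v′ ≡ true → s a′ ≡ true → s b′ ≡ false → s c′ ≡ true → all s (ringᵛ s i j) ≡ false → wL ℤ.+ + 2 ℤ.≤ 1ℤ
      L-apart sv sa sb sc sr rewrite sv | sa | sb | sc | sr = ℤ.≤-refl

      lower-gain : s v′ ≡ true → Gain≥ s v′ wL
      lower-gain sv = go (s a′) (s b′) (s c′) (all s (ringᵛ s i j)) refl refl refl refl
        where
        Near-one : List Lattice² → Set
        Near-one reps = ∀ {w} → Later s v′ w → R w v′ → Any (C s i j w) reps
        near : ∀ {reps} → (s a′ ≡ true → Any (C s i j a′) reps) → (s b′ ≡ true → Any (C s i j b′) reps) →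
               (s c′ ≡ true → Any (C s i j c′) reps) → Near-one reps
        near fa fb fc lw r with later-adjacent s i j lw r
        ... | is-a refl = fa (proj₁ lw)
        ... | is-b refl = fb (proj₁ lw)
        ... | is-c refl = fc (proj₁ lw)
        shut : ∀ {p} {A : Set} → s p ≡ false → s p ≡ true → A
        shut f t = contradiction (trans (sym f) t) λ ()
        go : ∀ ba bb bc br → s a′ ≡ ba → s b′ ≡ bb → s c′ ≡ bc → all s (ringᵛ s i j) ≡ br → Gain≥ s v′ wL
        go _ true _ _ _ sb _ _ = record
          { reps = b′ ∷ [] ; bound = L-b sv sb
          ; near = near (λ sa → here ((later-a s i j sa , later-b s i j sb , fwd rightDown) ◅ ε)) (λ _ → here ε)
                        (λ sc → here ((later-c s i j sc , later-b s i j sb , fwd up) ◅ ε)) }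
        go false false false _ sa sb sc _ = record { reps = [] ; near = near (shut sa) (shut sb) (shut sc) ; bound = L000 sv sa sb sc }
        go true  false false _ sa sb sc _ = record { reps = a′ ∷ [] ; near = near (λ _ → here ε) (shut sb) (shut sc) ; bound = L100 sv sa sb sc }
        go false false true  _ sa sb sc _ = record { reps = c′ ∷ [] ; near = near (shut sa) (shut sb) (λ _ → here ε) ; bound = L001 sv sa sb sc }
        go true false true false sa sb sc sr = record
          { reps = a′ ∷ c′ ∷ [] ; near = near (λ _ → here ε) (shut sb) (λ _ → there (here ε)) ; bound = L-apart sv sa sb sc sr }
        go true false true true sa sb sc sr with all-true s (ringᵛ s i j) sr
        ... | s₁ ∷ s₂ ∷ s₃ ∷ [] = record
          { reps = c′ ∷ [] ; bound = L-ring sv sa sb sc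
          ; near = near (λ _ → here ((later-a s i j sa , p₁ , fwd right) ◅ (p₁ , p₂ , fwd rightDown) ◅ (p₂ , p₃ , bwd up) ◅
                                     (p₃ , later-c s i j sc , bwd right) ◅ ε)) (shut sb) (λ _ → here ε) }
          where
          p₁ = s₁ , column≻ s i j {0}
          p₂ = s₂ , column≻ s i j {1}
          p₃ = s₃ , column≻ s i j {1}

  triangularWeights : GridWeights (SymClosure TriangularStep) (Sym.symmetric TriangularStep)
  triangularWeights = record
    { upperPoly    = triangularUpper
    ; lowerPoly    = triangularLower
    ; upper-within = from-yes (within? gridWindow triangularUpper)
    ; lower-within = from-yes (within? gridWindow (negate triangularLower))
    ; nb           = nb
    ; nb-length    = λ _ → s≤s (s≤s (s≤s (s≤s (s≤s (s≤s z≤n)))))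
    ; nb-∈         = λ r → nb-∈ (R-sym r)
    ; gain-≤       = λ s (i , j) → upper-gain s i j
    ; gain-≥       = λ s (i , j) → lower-gain s i j
    ; closed-≤     = λ s (i , j) → U-closed s i j
    ; closed-≥     = λ s (i , j) → L-closed s i j
    }

-- The hexagonal lattice, in coordinates around the centre of a hexagon.

module Hexagons where
  open import Defs hiding (right; up; rightDown)
  open Clusters
  open Scan
  open Orderings
  open Model
  open import Data.Bool.Base using (Bool; true; false)
  open import Data.Bool.ListAction using (all)
  open import Data.Empty using (⊥)
  open import Data.Integer.Base as ℤ using (ℤ; +_; -[1+_]; 0ℤ; 1ℤ)
  import Data.Integer.Properties as ℤ
  open import Data.List.Base using (List; []; _∷_; _++_; length; map; cartesianProduct; concatMap; lookup)
  open import Data.List.Properties using (length-map)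
  open import Data.List.Membership.Propositional using (_∈_; _∉_; lose; find)
  import Data.List.Membership.Propositional.Properties as ∈
  import Data.List.Membership.DecPropositional as DecMembership
  open import Data.List.Relation.Unary.All as All using (All; []; _∷_)
  import Data.List.Relation.Unary.All.Properties as All
  open import Data.List.Relation.Unary.AllPairs using ([]; _∷_)
  open import Data.List.Relation.Unary.Any as Any using (Any; here; there)
  import Data.List.Relation.Unary.Any.Properties as Any
  open import Data.List.Relation.Unary.Unique.Propositional using (Unique)
  import Data.List.Relation.Unary.Unique.Propositional.Properties as Unique
  open import Data.Nat.Base as ℕ using (ℕ; zero; suc; pred; _!; _+_; _*_; _≤_; _<_; z≤n; s≤s)
  import Data.Nat.Properties as ℕ
  import Data.Nat.Tactic.RingSolver as ℕRing
  open import Data.Product.Base using (∃; _×_; _,_; proj₁; proj₂)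
  open import Data.Sum.Base using (_⊎_; inj₁; inj₂)
  open import Data.Vec.Base using (Vec)
  import Data.Vec.Relation.Unary.Unique.Propositional as Vec
  open import Function.Base using (_∘_)
  open import Level using (0ℓ)
  open import Relation.Binary.Construct.Closure.ReflexiveTransitive using (ε; _◅_)
  open import Relation.Binary.Construct.Closure.Symmetric as Sym using (SymClosure; fwd; bwd)
  open import Relation.Binary.Core using (Rel)
  open import Relation.Binary.Definitions using (Symmetric; tri<; tri≈; tri>)
  open import Relation.Binary.PropositionalEquality
  open import Relation.Nullary.Negation using (¬_; contradiction)
  open Grids hiding (Within; within?; instantiate-valid; norm-instantiate)
  open import Data.Integer.Tactic.RingSolver using (solve-∀)
  open import Data.List.Base using (deduplicate; upTo; filter)
  open import Data.List.Properties using (map-++; length-upTo)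
  open import Data.Nat.DivMod using (_%_; [m+kn]%n≡m%n)
  open import Relation.Nullary.Decidable using (Dec; yes; no; from-yes; True; toWitness; _⊎-dec_; _×-dec_)

  open Lex ℤ.<-trans ℤ.<-asym ℤ.<-cmp using () renaming (_≺_ to _≺ᴾ_; ≺-trans to ≺ᴾ-trans; ≺-asym to ≺ᴾ-asym; ≺-cmp to ≺ᴾ-cmp)
  open Window {Point} {Point} _≟ᴾ_ using (Within; within?; instantiate-valid; norm-instantiate)

  private
    E NE NW W SW SE : Point
    E  = + 2 , + 0
    NE = + 1 , + 1
    NW = -[1+ 0 ] , + 1
    W  = -[1+ 1 ] , + 0
    SW = -[1+ 0 ] , -[1+ 0 ]
    SE = + 1 , -[1+ 0 ]

    _≺ᴾ?_ : ∀ p q → Dec (p ≺ᴾ q)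
    (i , j) ≺ᴾ? (k , l) = (i ℤ.<? k) ⊎-dec ((i ℤ.≟ k) ×-dec (j ℤ.<? l))

    ⊕-assoc : ∀ p q r → (p ⊕ q) ⊕ r ≡ p ⊕ (q ⊕ r)
    ⊕-assoc (a , b) (c , d) (e , f) = cong₂ _,_ (ℤ.+-assoc a c e) (ℤ.+-assoc b d f)

    ⊕-identityʳ : ∀ p → p ⊕ (+ 0 , + 0) ≡ p
    ⊕-identityʳ (a , b) = cong₂ _,_ (ℤ.+-identityʳ a) (ℤ.+-identityʳ b)

    +-cancelˡ : ∀ a {b c} → a ℤ.+ b ≡ a ℤ.+ c → b ≡ c
    +-cancelˡ a {b} {c} eq = trans (lem a b) (trans (cong (ℤ._+_ (ℤ.- a)) eq) (sym (lem a c)))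
      where
      lem : ∀ a b → b ≡ ℤ.- a ℤ.+ (a ℤ.+ b)
      lem = solve-∀

    ⊕-injective : ∀ c {p q} → c ⊕ p ≡ c ⊕ q → p ≡ q
    ⊕-injective (a , b) eq = cong₂ _,_ (+-cancelˡ a (cong proj₁ eq)) (+-cancelˡ b (cong proj₂ eq))

    ⊕-cancelʳ : ∀ o {c c′} → c ⊕ o ≡ c′ ⊕ o → c ≡ c′
    ⊕-cancelʳ (a , b) {x , y} {x′ , y′} eq = cong₂ _,_
      (+-cancelˡ a (trans (ℤ.+-comm a x) (trans (cong proj₁ eq) (ℤ.+-comm x′ a))))
      (+-cancelˡ b (trans (ℤ.+-comm b y) (trans (cong proj₂ eq) (ℤ.+-comm y′ b))))

    ⊕-mono-≺ : ∀ c {p q} → p ≺ᴾ q → c ⊕ p ≺ᴾ c ⊕ q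
    ⊕-mono-≺ (a , b) (inj₁ p)          = inj₁ (ℤ.+-monoʳ-< a p)
    ⊕-mono-≺ (a , b) (inj₂ (refl , p)) = inj₂ (refl , ℤ.+-monoʳ-< b p)

    ⊕-cancel-≺ : ∀ c {p q} → c ⊕ p ≺ᴾ c ⊕ q → p ≺ᴾ q
    ⊕-cancel-≺ c {p} {q} lt with ≺ᴾ-cmp p q
    ... | tri< p≺q _ _ = p≺q
    ... | tri≈ _ refl _ = contradiction lt (≺ᴾ-asym lt)
    ... | tri> _ _ q≺p = contradiction (⊕-mono-≺ c q≺p) (≺ᴾ-asym lt)

    directions : List Point
    directions = E ∷ NE ∷ SE ∷ W ∷ SW ∷ NW ∷ []

    parity : ∀ j → (j % 2 ≡ 0 × suc j % 2 ≡ 1) ⊎ (j % 2 ≡ 1 × suc j % 2 ≡ 0)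
    parity zero          = inj₁ (refl , refl)
    parity (suc zero)    = inj₂ (refl , refl)
    parity (suc (suc j)) = parity j

    centre : ℕ → ℕ → Point
    centre j i = + (3 * j) , + (2 * i + j % 2)

    3∣-remainder : ∀ a b r → 3 * a ≡ 3 * b + suc r → r < 2 → ⊥
    3∣-remainder a b r eq r<2 = ℕ.1+n≢0 (trans (sym (small r r<2)) (trans (sym (mod b (suc r)))
      (trans (cong (_% 3) (trans (ℕ.+-comm (suc r) (b * 3)) (trans (cong (_+ suc r) (ℕ.*-comm b 3)) (trans (sym eq) (ℕ.*-comm 3 a))))) (mod a 0))))
      where
      mod : ∀ b r → (r + b * 3) % 3 ≡ r % 3
      mod b r = [m+kn]%n≡m%n r b 3
      small : ∀ r → r < 2 → suc r % 3 ≡ suc r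
      small zero       _ = refl
      small (suc zero) _ = refl
      small (suc (suc r)) (s≤s (s≤s ()))

    -- Centres have first coordinate divisible by 3 and corners differ from them by 1 or 2. So no
    -- vertex lies in a column of centres, which rules out three of the six directions at each
    -- vertex.
    corner-x : ∀ j c y → c ∈ corners y → ∀ b → proj₁ y ≡ + (3 * b) → proj₁ c ≢ + (3 * j)
    corner-x j c (x , y) c∈ b refl eq = go c∈
      where
      up-by : ∀ r → r < 2 → + (3 * b) ℤ.+ + suc r ≢ + (3 * j)
      up-by r r<2 e = 3∣-remainder j b r (sym (ℤ.+-injective e)) r<2
      down-by : ∀ r → r < 2 → + (3 * b) ℤ.+ -[1+ r ] ≢ + (3 * j)
      down-by r r<2 e = 3∣-remainder b j r (ℤ.+-injective (trans (lem (+ (3 * b)) (+ suc r)) (cong (ℤ._+ + suc r) e))) r<2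
        where
        lem : ∀ a c → a ≡ a ℤ.+ ℤ.- c ℤ.+ c
        lem = solve-∀
      go : c ∈ corners (+ (3 * b) , y) → ⊥
      go (here refl)                                         = up-by 1 (s≤s (s≤s z≤n)) eq
      go (there (here refl))                                 = up-by 0 (s≤s z≤n) eq
      go (there (there (here refl)))                         = down-by 0 (s≤s z≤n) eq
      go (there (there (there (here refl))))                 = down-by 1 (s≤s (s≤s z≤n)) eq
      go (there (there (there (there (here refl)))))         = down-by 0 (s≤s z≤n) eq
      go (there (there (there (there (there (here refl)))))) = up-by 0 (s≤s z≤n) eq

    ring hexagon : List Point
    ring = NE ∷ (+ 2 , + 2) ∷ (+ 4 , + 2) ∷ (+ 5 , + 1) ∷ (+ 4 , + 0) ∷ (+ 5 , -[1+ 0 ]) ∷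
           (+ 4 , -[1+ 1 ]) ∷ (+ 2 , -[1+ 1 ]) ∷ SE ∷ []
    hexagon = NE ∷ E ∷ SE ∷ []

  -- Coordinates are relative to the centre of a hexagon. Its leftmost corner (-2 , 0) has the two later
  -- neighbours (-1 , 1) and (-1 , -1); its corner (-1 , 1) has the only later neighbour (1 , 1).
  rightPoly leftUpper leftLower : Polynomial Point
  rightPoly = ⊞ (NW ∷ []) ∷ ⊟ (NW ∷ NE ∷ []) ∷ []
  leftUpper =
    ⊞ (W ∷ []) ∷ ⊟ (W ∷ NW ∷ []) ∷ ⊟ (W ∷ SW ∷ []) ∷
    ⊞ (W ∷ NW ∷ SW ∷ SE ∷ NE ∷ []) ∷
    ⊞ (W ∷ NW ∷ SW ∷ SE ∷ (-[1+ 1 ] , + 2) ∷ []) ∷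
    ⊟ (W ∷ NW ∷ SW ∷ SE ∷ NE ∷ (-[1+ 1 ] , + 2) ∷ []) ∷ []
  leftLower =
    ⊞ (W ∷ []) ∷ ⊟ (W ∷ NW ∷ []) ∷ ⊟ (W ∷ SW ∷ []) ∷
    ⊞ (W ∷ NW ∷ SW ∷ hexagon) ∷
    ⊞ (W ∷ NW ∷ SW ∷ ring) ∷
    ⊟ (W ∷ NW ∷ SW ∷ E ∷ ring) ∷ []

  hexagonalUpper hexagonalLower : Polynomial Point
  hexagonalUpper = rightPoly ++ leftUpper
  hexagonalLower = rightPoly ++ leftLower

  hexagonVertices : ℕ → List Point
  hexagonVertices m = deduplicate _≟ᴾ_ (concatMap corners (centres m))

  hexagonVertices-unique : ∀ m → Unique (hexagonVertices m)
  hexagonVertices-unique m = deduplicate-separated sym trans _≟ᴾ_ refl (concatMap corners (centres m))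

  hexagonalDrawing : ∀ m → Drawing (hexagonal m) (hexagonVertices m) (SymClosure (HexagonalSide m))
  hexagonalDrawing m = record
    { ℓ           = lookup (hexagonVertices m)
    ; ℓ-injective = lookup-injective (hexagonVertices-unique m)
    ; ℓ-∈         = ∈.∈-lookup
    ; ℓ-onto      = λ p∈ → Any.index p∈ , sym (Any.lookup-index p∈)
    ; vs-length   = refl
    ; adj⇒        = λ r → r
    ; adj⇐        = λ r → r
    }

  module HexagonModel (m k : ℕ) (m≡ : m ≡ 3 + k) (G : Graph)
                      (drawing : Drawing G (hexagonVertices m) (SymClosure (HexagonalSide m))) where

    private
      ≤m : ∀ {x} → x ≤ 3 + k → x ≤ m
      ≤m = subst (_ ≤_) (sym m≡)

      vs : List Point
      vs = hexagonVertices m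

      R : Rel Point 0ℓ
      R = SymClosure (HexagonalSide m)

      R-sym : Symmetric R
      R-sym = Sym.symmetric (HexagonalSide m)

      vs-unique : Unique vs
      vs-unique = hexagonVertices-unique m

      corner-∈ : ∀ {c p} → c ∈ centres m → p ∈ corners c → p ∈ vs
      corner-∈ c∈ p∈ = deduplicate-covers sym trans _≟ᴾ_ refl (concatMap corners (centres m))
        (∈.∈-concatMap⁺ corners (lose c∈ p∈))

      ∈-corner : ∀ {p} → p ∈ vs → ∃ λ c → c ∈ centres m × p ∈ corners c
      ∈-corner p∈ = find (∈.∈-concatMap⁻ corners {xs = centres m} (∈.∈-deduplicate⁻ _≟ᴾ_ (concatMap corners (centres m)) p∈))

      column : ℕ → List Point
      column j = map (centre j) (upTo (m ℕ.∸ j % 2))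

      centre-∈ : ∀ {j i} → j < m → i < m ℕ.∸ j % 2 → centre j i ∈ centres m
      centre-∈ {j} j< i< = ∈.∈-concatMap⁺ column (lose (∈.∈-upTo⁺ j<) (∈.∈-map⁺ (centre j) (∈.∈-upTo⁺ i<)))

      ∈-centre : ∀ {c} → c ∈ centres m → ∃ λ j → ∃ λ i → j < m × i < m × c ≡ centre j i
      ∈-centre c∈ with find (∈.∈-concatMap⁻ column {xs = upTo m} c∈)
      ... | j , j∈ , c∈′ with ∈.∈-map⁻ (centre j) c∈′
      ... | i , i∈ , eq = j , i , ∈.∈-upTo⁻ j∈ , ℕ.≤-trans (∈.∈-upTo⁻ i∈) (ℕ.m∸n≤m m (j % 2)) , eq

      not-vertex : ∀ {p} j → proj₁ p ≡ + (3 * j) → p ∉ vs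
      not-vertex j eq p∈ with ∈-corner p∈
      ... | c , c∈ , p∈c with ∈-centre c∈
      ... | b , i , _ , _ , refl = corner-x j _ (centre b i) p∈c b refl eq

      neighbours : ∀ {p q} → R p q → q ∈ map (p ⊕_) directions
      neighbours {p} {q} = go
        where
        at : ∀ c o δ → δ ∈ directions → c ⊕ (o ⊕ δ) ∈ map ((c ⊕ o) ⊕_) directions
        at c o δ δ∈ = subst (_∈ map ((c ⊕ o) ⊕_) directions) (⊕-assoc c o δ) (∈.∈-map⁺ ((c ⊕ o) ⊕_) δ∈)
        d₁ : E ∈ directions
        d₁ = here refl
        d₂ : NE ∈ directions
        d₂ = there (here refl)
        d₃ : SE ∈ directions
        d₃ = there (there (here refl))
        d₄ : W ∈ directions
        d₄ = there (there (there (here refl)))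
        d₅ : SW ∈ directions
        d₅ = there (there (there (there (here refl))))
        d₆ : NW ∈ directions
        d₆ = there (there (there (there (there (here refl)))))
        forward : ∀ c {p q} → (p , q) ∈ sides c → q ∈ map (p ⊕_) directions
        forward c (here refl)                                         = at c E _ d₆
        forward c (there (here refl))                                 = at c NE _ d₄
        forward c (there (there (here refl)))                         = at c NW _ d₅
        forward c (there (there (there (here refl))))                 = at c W _ d₃
        forward c (there (there (there (there (here refl)))))         = at c SW _ d₁
        forward c (there (there (there (there (there (here refl)))))) = at c SE _ d₂
        backward : ∀ c {p q} → (p , q) ∈ sides c → p ∈ map (q ⊕_) directions
        backward c (here refl)                                         = at c NE _ d₃
        backward c (there (here refl))                                 = at c NW _ d₁
        backward c (there (there (here refl)))                         = at c W _ d₂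
        backward c (there (there (there (here refl))))                 = at c SW _ d₆
        backward c (there (there (there (there (here refl)))))         = at c SE _ d₄
        backward c (there (there (there (there (there (here refl)))))) = at c E _ d₅
        go : ∀ {p q} → R p q → q ∈ map (p ⊕_) directions
        go (fwd side) = let c , side∈ = Any.satisfied side in forward c side∈
        go (bwd side) = let c , side∈ = Any.satisfied side in backward c side∈

      indices : List (ℕ × ℕ)
      indices = cartesianProduct (upTo (2 + k)) (upTo k)

      innerCentre : ℕ × ℕ → Point
      innerCentre (j , i) = centre j (suc i)

      inner : List Point
      inner = map innerCentre indices

      -- These are the hexagons whose corners occur in the polynomials: the one above supplies (-2 ,
      -- 2), the two on the right supply the ring.
      record Surrounded (c : Point) : Set where
        field
          here-∈  : c ∈ centres m
          above-∈ : c ⊕ (+ 0 , + 2) ∈ centres m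
          right⁺  : c ⊕ (+ 3 , + 1) ∈ centres m
          right⁻  : c ⊕ (+ 3 , -[1+ 0 ]) ∈ centres m

      -- Odd columns are raised by half a hexagon, so the indices of the hexagons on the right
      -- depend on the parity of the column.
      surrounded : ∀ {c} → c ∈ inner → Surrounded c
      surrounded c∈ with ∈.∈-map⁻ innerCentre c∈
      ... | (j , i) , ji∈ , refl = result (parity j)
        where
        j< : j < 2 + k
        j< = ∈.∈-upTo⁻ (proj₁ (∈.∈-cartesianProduct⁻ (upTo (2 + k)) (upTo k) ji∈))
        i< : i < k
        i< = ∈.∈-upTo⁻ (proj₂ (∈.∈-cartesianProduct⁻ (upTo (2 + k)) (upTo k) ji∈))
        row : ∀ r → r ≤ 1 → 3 + i ≤ m ℕ.∸ r
        row r r≤1 = ℕ.≤-trans (ℕ.+-monoʳ-≤ 2 i<) (ℕ.≤-trans (ℕ.≤-reflexive (cong (ℕ._∸ 1) (sym m≡))) (ℕ.∸-monoʳ-≤ m r≤1))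
        x-≡ : 3 * suc j ≡ 3 * j + 3
        x-≡ = lem j
          where
          lem : ∀ j → 3 * suc j ≡ 3 * j + 3
          lem = ℕRing.solve-∀
        x0-≡ : 3 * j ≡ 3 * j + 0
        x0-≡ = sym (ℕ.+-identityʳ (3 * j))
        in-row : ∀ {j i′ r} → j < m → j % 2 ≡ r → r ≤ 1 → suc i′ ≤ 3 + i → centre j i′ ∈ centres m
        in-row {j} {i′} j<m refl r≤1 i′≤ = centre-∈ j<m (ℕ.≤-trans i′≤ (row (j % 2) r≤1))
        j<m : j < m
        j<m = ≤m (ℕ.m≤n⇒m≤1+n j<)
        sj<m : suc j < m
        sj<m = ≤m (s≤s j<)
        two : ∀ i r → 2 * suc (suc i) + r ≡ 2 * suc i + r + 2
        two = ℕRing.solve-∀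
        result : (j % 2 ≡ 0 × suc j % 2 ≡ 1) ⊎ (j % 2 ≡ 1 × suc j % 2 ≡ 0) → Surrounded (centre j (suc i))
        result (inj₁ (j≡ , sj≡)) = record
          { here-∈  = in-row j<m j≡ z≤n (ℕ.n≤1+n _)
          ; above-∈ = subst (_∈ centres m) (cong₂ (λ x y → + x , + y) x0-≡ (two i (j % 2))) (in-row j<m j≡ z≤n ℕ.≤-refl)
          ; right⁺  = subst (_∈ centres m) (cong₂ (λ x y → + x , + y) x-≡ (trans (cong (_+_ (2 * suc i)) sj≡) (trans (sym (cong (_+ 1) (ℕ.+-identityʳ (2 * suc i)))) (cong (λ r → 2 * suc i + r + 1) (sym j≡)))))
                        (in-row sj<m sj≡ ℕ.≤-refl (ℕ.n≤1+n _))
          ; right⁻  = subst (_∈ centres m) (cong₂ (λ x y → + x , + y) x-≡ (trans (cong (_+_ (2 * i)) sj≡) (trans (lem i) (cong (λ r → i + suc (i + 0) + r) (sym j≡)))))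
                        (in-row {suc j} {i} sj<m sj≡ ℕ.≤-refl (ℕ.m≤n+m (suc i) 2))
          }
          where
          lem : ∀ i → 2 * i + 1 ≡ i + suc (i + 0) + 0
          lem = ℕRing.solve-∀
        result (inj₂ (j≡ , sj≡)) = record
          { here-∈  = in-row j<m j≡ ℕ.≤-refl (ℕ.n≤1+n _)
          ; above-∈ = subst (_∈ centres m) (cong₂ (λ x y → + x , + y) x0-≡ (two i (j % 2))) (in-row j<m j≡ ℕ.≤-refl ℕ.≤-refl)
          ; right⁺  = subst (_∈ centres m) (cong₂ (λ x y → + x , + y) x-≡ (trans (cong (_+_ (2 * suc (suc i))) sj≡) (trans (lem⁺ i) (cong (λ r → 2 * suc i + r + 1) (sym j≡)))))
                        (in-row sj<m sj≡ z≤n ℕ.≤-refl)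
          ; right⁻  = subst (_∈ centres m) (cong₂ (λ x y → + x , + y) x-≡ (trans (cong (_+_ (2 * suc i)) sj≡) (trans (lem⁻ i) (cong (λ r → i + suc (i + 0) + r) (sym j≡)))))
                        (in-row sj<m sj≡ z≤n (ℕ.n≤1+n _))
          }
          where
          lem⁺ : ∀ i → 2 * suc (suc i) + 0 ≡ 2 * suc i + 1 + 1
          lem⁺ = ℕRing.solve-∀
          lem⁻ : ∀ i → 2 * suc i + 0 ≡ i + suc (i + 0) + 1
          lem⁻ = ℕRing.solve-∀

      open OnPoints _≟ᴾ_ vs vs-unique R R-sym G drawing
      open Ordered _≺ᴾ_ ≺ᴾ-trans ≺ᴾ-asym ≺ᴾ-cmp

      -- Neighbours lie in the six directions and the order is invariant under translation, so the
      -- candidates depend on the offsets alone; for concrete `e₀` and `e` the filter evaluates to a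
      -- short explicit list.
      later-near : ∀ s c e₀ e {w} → Later s (c ⊕ e₀) w → R (c ⊕ e) w →
                   w ∈ map (c ⊕_) (filter (e₀ ≺ᴾ?_) (map (e ⊕_) directions))
      later-near s c e₀ e (_ , v≺w) r with ∈.∈-map⁻ ((c ⊕ e) ⊕_) (neighbours r)
      ... | δ , δ∈ , refl = subst (_∈ _) (sym (⊕-assoc c e δ))
        (∈.∈-map⁺ (c ⊕_) (∈.∈-filter⁺ (e₀ ≺ᴾ?_) (∈.∈-map⁺ (e ⊕_) δ∈)
          (⊕-cancel-≺ c (subst (c ⊕ e₀ ≺ᴾ_) (⊕-assoc c e δ) v≺w))))

      side₁ : ∀ x → (x ⊕ E , x ⊕ NE) ∈ sides x
      side₁ x = here refl
      side₂ : ∀ x → (x ⊕ NE , x ⊕ NW) ∈ sides x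
      side₂ x = there (here refl)
      side₃ : ∀ x → (x ⊕ NW , x ⊕ W) ∈ sides x
      side₃ x = there (there (here refl))
      side₄ : ∀ x → (x ⊕ W , x ⊕ SW) ∈ sides x
      side₄ x = there (there (there (here refl)))
      side₅ : ∀ x → (x ⊕ SW , x ⊕ SE) ∈ sides x
      side₅ x = there (there (there (there (here refl))))
      side₆ : ∀ x → (x ⊕ SE , x ⊕ E) ∈ sides x
      side₆ x = there (there (there (there (there (here refl)))))

      module Around (c : Point) (S : Surrounded c) (s : Point → Bool) (supp : Supported s) where
        open Surrounded S

        v l d d₁ l₁ l₂ u r : Point
        v  = c ⊕ W
        l  = c ⊕ NW
        d  = c ⊕ SW
        d₁ = c ⊕ SE
        l₁ = c ⊕ NE
        l₂ = c ⊕ (-[1+ 1 ] , + 2)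
        u  = c ⊕ E
        r  = c ⊕ NE

        -- These points lie in the column of the centre `c`, which contains no vertex.
        never : ∀ y → s (c ⊕ (+ 0 , y)) ≢ true
        never y sp with ∈-centre here-∈
        ... | j , i , _ , _ , refl = not-vertex j (ℤ.+-identityʳ (+ (3 * j))) (supp _ sp)

        edge : ∀ e → c ⊕ e ∈ centres m → ∀ {o o′} → (∀ x → (x ⊕ o , x ⊕ o′) ∈ sides x) → R (c ⊕ (e ⊕ o)) (c ⊕ (e ⊕ o′))
        edge e c∈ {o} {o′} side = subst₂ R (⊕-assoc c e o) (⊕-assoc c e o′) (fwd (lose c∈ (side (c ⊕ e))))

        edge₀ : ∀ {o o′} → (∀ x → (x ⊕ o , x ⊕ o′) ∈ sides x) → R (c ⊕ o) (c ⊕ o′)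
        edge₀ side = fwd (lose here-∈ (side c))

        C : Rel Point 0ℓ
        C = Conn R R-sym (Later s v)

        later : ∀ o {W≺o : True (W ≺ᴾ? o)} → s (c ⊕ o) ≡ true → Later s v (c ⊕ o)
        later o {W≺o} so = so , ⊕-mono-≺ c (toWitness W≺o)

        later-l : s l ≡ true → Later s v l
        later-l = later NW
        later-d : s d ≡ true → Later s v d
        later-d = later SW

        shut : ∀ {p} {A : Set} → s p ≡ false → s p ≡ true → A
        shut f t = contradiction (trans (sym f) t) λ ()

        U L : ℤ
        U = eval s (instantiate (c ⊕_) leftUpper)
        L = eval s (instantiate (c ⊕_) leftLower)

        U-closed : s v ≡ false → 0ℤ ℤ.≤ U
        U-closed sv rewrite sv = ℤ.≤-refl
        U00 : s v ≡ true → s l ≡ false → s d ≡ false → 1ℤ ℤ.≤ U ℤ.+ + 0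
        U00 sv sl sd rewrite sv | sl | sd = ℤ.≤-refl
        U10 : s v ≡ true → s l ≡ true → s d ≡ false → 1ℤ ℤ.≤ U ℤ.+ + 1
        U10 sv sl sd rewrite sv | sl | sd = ℤ.≤-refl
        U01 : s v ≡ true → s l ≡ false → s d ≡ true → 1ℤ ℤ.≤ U ℤ.+ + 1
        U01 sv sl sd rewrite sv | sl | sd = ℤ.≤-refl
        U11 : s v ≡ true → s l ≡ true → s d ≡ true → 1ℤ ℤ.≤ U ℤ.+ + 2
        U11 sv sl sd rewrite sv | sl | sd with s d₁ | s l₁ | s l₂
        ... | false | _     | _     = ℤ.≤-refl
        ... | true  | false | false = ℤ.≤-refl
        ... | true  | false | true  = ℤ.+≤+ (s≤s z≤n)
        ... | true  | true  | false = ℤ.+≤+ (s≤s z≤n)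
        ... | true  | true  | true  = ℤ.+≤+ (s≤s z≤n)
        U-link : s v ≡ true → s l ≡ true → s d ≡ true → s d₁ ≡ true → s l₁ ≡ true ⊎ s l₂ ≡ true → 1ℤ ℤ.≤ U ℤ.+ + 1
        U-link sv sl sd sd₁ (inj₁ s₁) rewrite sv | sl | sd | sd₁ | s₁ with s l₂
        ... | false = ℤ.≤-refl
        ... | true  = ℤ.≤-refl
        U-link sv sl sd sd₁ (inj₂ s₂) rewrite sv | sl | sd | sd₁ | s₂ with s l₁
        ... | false = ℤ.≤-refl
        ... | true  = ℤ.≤-refl

        -- Among later vertices `d` can be left only through `d₁`; likewise `l` only through `l₁` or
        -- `l₂`.
        d-isolated : s d₁ ≡ false → ∀ {w} → Later s v w → ¬ R d w
        d-isolated sd₁ lw rw with later-near s c W SW lw rw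
        ... | here refl                 = shut sd₁ (proj₁ lw)
        ... | there (here refl)         = never _ (proj₁ lw)
        ... | there (there (here refl)) = never _ (proj₁ lw)

        l-isolated : s l₁ ≡ false → s l₂ ≡ false → ∀ {w} → Later s v w → ¬ R l w
        l-isolated s₁ s₂ lw rw with later-near s c W NW lw rw
        ... | here refl                 = shut s₁ (proj₁ lw)
        ... | there (here refl)         = never _ (proj₁ lw)
        ... | there (there (here refl)) = never _ (proj₁ lw)
        ... | there (there (there (here refl))) = shut s₂ (proj₁ lw)

        left-upper : s v ≡ true → Gain≤ s v U
        left-upper sv = go (s l) (s d) (s d₁) (s l₁) (s l₂) refl refl refl refl refl
          where
          l-v : R l v
          l-v = edge₀ side₃
          d-v : R d v
          d-v = R-sym (edge₀ side₄)
          one-l : s l ≡ true → 1ℤ ℤ.≤ U ℤ.+ + 1 → Gain≤ s v U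
          one-l sl bd = record { reps = l ∷ [] ; adjacent = (later-l sl , l-v) ∷ [] ; apart = [] ∷ [] ; bound = bd }
          two : s l ≡ true → s d ≡ true → ¬ C l d → Gain≤ s v U
          two sl sd l≁d = record
            { reps = l ∷ d ∷ [] ; adjacent = (later-l sl , l-v) ∷ (later-d sd , d-v) ∷ []
            ; apart = (l≁d ∷ []) ∷ [] ∷ [] ; bound = U11 sv sl sd }
          l≢d : l ≢ d
          l≢d eq with () ← ⊕-injective c {NW} {SW} eq
          go : ∀ bl bd b₀ b₁ b₂ → s l ≡ bl → s d ≡ bd → s d₁ ≡ b₀ → s l₁ ≡ b₁ → s l₂ ≡ b₂ → Gain≤ s v U
          go false false _ _ _ sl sd _ _ _ = record { reps = [] ; adjacent = [] ; apart = [] ; bound = U00 sv sl sd }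
          go true  false _ _ _ sl sd _ _ _ = one-l sl (U10 sv sl sd)
          go false true  _ _ _ sl sd _ _ _ = record
            { reps = d ∷ [] ; adjacent = (later-d sd , d-v) ∷ [] ; apart = [] ∷ [] ; bound = U01 sv sl sd }
          go true true false _ _ sl sd sd₁ _ _ =
            two sl sd (λ p → l≢d (sym (isolated R R-sym (d-isolated sd₁) (Conn-sym R R-sym p))))
          go true true true false false sl sd _ s₁ s₂ = two sl sd (λ p → l≢d (isolated R R-sym (l-isolated s₁ s₂) p))
          go true true true true  _    sl sd sd₁ s₁ _ = one-l sl (U-link sv sl sd sd₁ (inj₁ s₁))
          go true true true false true sl sd sd₁ _ s₂ = one-l sl (U-link sv sl sd sd₁ (inj₂ s₂))

        hexagonᶜ ringᶜ : List Point
        hexagonᶜ = map (c ⊕_) hexagon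
        ringᶜ = map (c ⊕_) ring

        L-closed : s v ≡ false → L ℤ.≤ 0ℤ
        L-closed sv rewrite sv = ℤ.≤-refl
        L00 : s v ≡ true → s l ≡ false → s d ≡ false → L ℤ.+ + 0 ℤ.≤ 1ℤ
        L00 sv sl sd rewrite sv | sl | sd = ℤ.≤-refl
        L10 : s v ≡ true → s l ≡ true → s d ≡ false → L ℤ.+ + 1 ℤ.≤ 1ℤ
        L10 sv sl sd rewrite sv | sl | sd = ℤ.≤-refl
        L01 : s v ≡ true → s l ≡ false → s d ≡ true → L ℤ.+ + 1 ℤ.≤ 1ℤ
        L01 sv sl sd rewrite sv | sl | sd = ℤ.≤-refl
        -- The ring contains NE and SE, so the hexagon and the ring are both open exactly when `E`
        -- and the ring are. The last monomial subtracts this overlap, and the weight never exceeds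
        -- 0.
        L11 : s v ≡ true → s l ≡ true → s d ≡ true → L ℤ.+ + 1 ℤ.≤ 1ℤ
        L11 sv sl sd rewrite sv | sl | sd with s u in su | all s ringᶜ
        ... | false | false with s l₁ | s d₁
        ...   | false | _     = ℤ.+≤+ z≤n
        ...   | true  | false = ℤ.+≤+ z≤n
        ...   | true  | true  = ℤ.+≤+ z≤n
        L11 sv sl sd | false | true with s l₁ | s d₁
        ...   | false | _     = ℤ.≤-refl
        ...   | true  | false = ℤ.≤-refl
        ...   | true  | true  = ℤ.≤-refl
        L11 sv sl sd | true | false with s l₁ | s d₁
        ...   | false | _     = ℤ.+≤+ z≤n
        ...   | true  | false = ℤ.+≤+ z≤n
        ...   | true  | true  = ℤ.≤-refl
        L11 sv sl sd | true | true with s l₁ | s d₁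
        ...   | false | _     = ℤ.+≤+ z≤n
        ...   | true  | false = ℤ.+≤+ z≤n
        ...   | true  | true  = ℤ.≤-refl
        L-apart : s v ≡ true → s l ≡ true → s d ≡ true → all s hexagonᶜ ≡ false → s u ≡ true ⊎ all s ringᶜ ≡ false →
                  L ℤ.+ + 2 ℤ.≤ 1ℤ
        L-apart sv sl sd sh (inj₁ su) rewrite sv | sl | sd | sh | su with all s ringᶜ
        ... | false = ℤ.≤-refl
        ... | true  = ℤ.≤-refl
        L-apart sv sl sd sh (inj₂ sr) rewrite sv | sl | sd | sh | sr with s u
        ... | false = ℤ.≤-refl
        ... | true  = ℤ.≤-refl

        Near : List Point → Set
        Near reps = ∀ {w} → Later s v w → R w v → Any (C w) reps

        near-v : ∀ {reps} → (s l ≡ true → Any (C l) reps) → (s d ≡ true → Any (C d) reps) → Near reps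
        near-v fl fd lw rw with later-near s c W W lw (R-sym rw)
        ... | here refl                 = contradiction (proj₁ lw) (never _)
        ... | there (here refl)         = fl (proj₁ lw)
        ... | there (there (here refl)) = fd (proj₁ lw)

        left-lower : s v ≡ true → Gain≥ s v L
        left-lower sv = go (s l) (s d) (all s hexagonᶜ) (s u) (all s ringᶜ) refl refl refl refl refl
          where
          linked : s l ≡ true → s d ≡ true → C l d → Gain≥ s v L
          linked sl sd l~d = record { reps = d ∷ [] ; near = near-v (λ _ → here l~d) (λ _ → here ε) ; bound = L11 sv sl sd }
          apart : s l ≡ true → s d ≡ true → L ℤ.+ + 2 ℤ.≤ 1ℤ → Gain≥ s v L
          apart sl sd bd = record { reps = l ∷ d ∷ [] ; near = near-v (λ _ → here ε) (λ _ → there (here ε)) ; bound = bd }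
          go : ∀ bl bd bh bu br → s l ≡ bl → s d ≡ bd → all s hexagonᶜ ≡ bh → s u ≡ bu → all s ringᶜ ≡ br → Gain≥ s v L
          go false false _ _ _ sl sd _ _ _ = record { reps = [] ; near = near-v (shut sl) (shut sd) ; bound = L00 sv sl sd }
          go true  false _ _ _ sl sd _ _ _ = record { reps = l ∷ [] ; near = near-v (λ _ → here ε) (shut sd) ; bound = L10 sv sl sd }
          go false true  _ _ _ sl sd _ _ _ = record { reps = d ∷ [] ; near = near-v (shut sl) (λ _ → here ε) ; bound = L01 sv sl sd }
          go true true true _ _ sl sd sh _ _ with all-true s hexagonᶜ sh
          ... | s₁ ∷ s₂ ∷ s₃ ∷ [] = linked sl sd
            ((later-l sl , p₁ , R-sym (edge₀ side₂)) ◅ (p₁ , p₂ , R-sym (edge₀ side₁)) ◅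
             (p₂ , p₃ , R-sym (edge₀ side₆)) ◅ (p₃ , later-d sd , R-sym (edge₀ side₅)) ◅ ε)
            where
            p₁ = later NE s₁
            p₂ = later E s₂
            p₃ = later SE s₃
          go true true false true _ sl sd sh su _ = apart sl sd (L-apart sv sl sd sh (inj₁ su))
          go true true false false false sl sd sh _ sr = apart sl sd (L-apart sv sl sd sh (inj₂ sr))
          go true true false false true sl sd _ _ sr with all-true s ringᶜ sr
          ... | s₁ ∷ s₂ ∷ s₃ ∷ s₄ ∷ s₅ ∷ s₆ ∷ s₇ ∷ s₈ ∷ s₉ ∷ [] = linked sl sd
            -- The detour around `E` runs along the hexagons centred at (3 , 1) and (3 , -1), which
            -- share the corner (4 , 0).
            ((later-l sl , p₁ , R-sym (edge₀ side₂)) ◅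
             (p₁ , p₂ , R-sym (edge (+ 3 , + 1) right⁺ side₃)) ◅ (p₂ , p₃ , R-sym (edge (+ 3 , + 1) right⁺ side₂)) ◅
             (p₃ , p₄ , R-sym (edge (+ 3 , + 1) right⁺ side₁)) ◅ (p₄ , p₅ , R-sym (edge (+ 3 , + 1) right⁺ side₆)) ◅
             (p₅ , p₆ , R-sym (edge (+ 3 , -[1+ 0 ]) right⁻ side₁)) ◅ (p₆ , p₇ , R-sym (edge (+ 3 , -[1+ 0 ]) right⁻ side₆)) ◅
             (p₇ , p₈ , R-sym (edge (+ 3 , -[1+ 0 ]) right⁻ side₅)) ◅ (p₈ , p₉ , R-sym (edge (+ 3 , -[1+ 0 ]) right⁻ side₄)) ◅
             (p₉ , later-d sd , R-sym (edge₀ side₅)) ◅ ε)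
            where
            p₁ = later NE s₁
            p₂ = later (+ 2 , + 2) s₂
            p₃ = later (+ 4 , + 2) s₃
            p₄ = later (+ 5 , + 1) s₄
            p₅ = later (+ 4 , + 0) s₅
            p₆ = later (+ 5 , -[1+ 0 ]) s₆
            p₇ = later (+ 4 , -[1+ 1 ]) s₇
            p₈ = later (+ 2 , -[1+ 1 ]) s₈
            p₉ = later SE s₉

        right-weight : ℤ
        right-weight = eval s (instantiate (c ⊕_) rightPoly)

        right-upper : s l ≡ true → Gain≤ s l right-weight
        right-upper sl = go (s r) refl
          where
          go : ∀ br → s r ≡ br → Gain≤ s l right-weight
          go false sr = record { reps = [] ; adjacent = [] ; apart = [] ; bound = bd sl sr }
            where
            bd : s l ≡ true → s r ≡ false → 1ℤ ℤ.≤ right-weight ℤ.+ + 0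
            bd sl sr rewrite sl | sr = ℤ.≤-refl
          go true sr = record
            { reps     = r ∷ []
            ; adjacent = ((sr , ⊕-mono-≺ c (from-yes (NW ≺ᴾ? NE))) , edge₀ side₂) ∷ []
            ; apart    = [] ∷ []
            ; bound    = bd sl sr }
            where
            bd : s l ≡ true → s r ≡ true → 1ℤ ℤ.≤ right-weight ℤ.+ + 1
            bd sl sr rewrite sl | sr = ℤ.≤-refl

        right-lower : s l ≡ true → Gain≥ s l right-weight
        right-lower sl = go (s r) refl
          where
          near-l : ∀ {reps} → (s r ≡ true → Any (Conn R R-sym (Later s l) r) reps) →
                   ∀ {w} → Later s l w → R w l → Any (Conn R R-sym (Later s l) w) reps
          near-l fr lw rw with later-near s c NW NW lw (R-sym rw)
          ... | here refl                 = fr (proj₁ lw)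
          ... | there (here refl)         = contradiction (proj₁ lw) (never _)
          ... | there (there (here refl)) = contradiction (proj₁ lw) (never _)
          go : ∀ br → s r ≡ br → Gain≥ s l right-weight
          go false sr = record { reps = [] ; near = near-l (shut sr) ; bound = bd sl sr }
            where
            bd : s l ≡ true → s r ≡ false → right-weight ℤ.+ + 0 ℤ.≤ 1ℤ
            bd sl sr rewrite sl | sr = ℤ.≤-refl
          go true sr = record { reps = r ∷ [] ; near = near-l (λ _ → here ε) ; bound = bd sl sr }
            where
            bd : s l ≡ true → s r ≡ true → right-weight ℤ.+ + 1 ℤ.≤ 1ℤ
            bd sl sr rewrite sl | sr = ℤ.≤-refl

      open DecMembership _≟ᴾ_ using (_∈?_)

      leftOf rightOf : Point → Point
      leftOf c  = c ⊕ W
      rightOf c = c ⊕ NW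

      -- Vertices that are not attached to an inner centre get a crude weight.
      weight : (right left crude : Polynomial Point) → Point → Polynomial Point
      weight right left crude v with (v ⊕ E) ∈? inner | (v ⊕ SE) ∈? inner
      ... | yes _ | _     = instantiate ((v ⊕ E) ⊕_) left
      ... | no _  | yes _ = instantiate ((v ⊕ SE) ⊕_) right
      ... | no _  | no _  = instantiate (v ⊕_) crude

      leftOf-centre : ∀ v → leftOf (v ⊕ E) ≡ v
      leftOf-centre v = trans (⊕-assoc v E W) (⊕-identityʳ v)

      rightOf-centre : ∀ v → rightOf (v ⊕ SE) ≡ v
      rightOf-centre v = trans (⊕-assoc v SE NW) (⊕-identityʳ v)

      centre-leftOf : ∀ c → leftOf c ⊕ E ≡ c
      centre-leftOf c = trans (⊕-assoc c W E) (⊕-identityʳ c)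

      centre-rightOf : ∀ c → rightOf c ⊕ SE ≡ c
      centre-rightOf c = trans (⊕-assoc c NW SE) (⊕-identityʳ c)

      inner-not-corner : ∀ {c c′} → c ∈ inner → c′ ∈ inner → ∀ {p} → p ∈ corners c′ → p ≢ c
      inner-not-corner c∈ c′∈ p∈ refl with ∈-centre (Surrounded.here-∈ (surrounded c∈))
      ... | j , i , _ , _ , refl = not-vertex j refl (corner-∈ (Surrounded.here-∈ (surrounded c′∈)) p∈)

      -- Otherwise the corner NE of the hexagon of `c′`, one step `E` from its corner NW, would be
      -- the centre `c`.
      leftOf-rightOf : ∀ {c c′} → c ∈ inner → c′ ∈ inner → rightOf c′ ≢ leftOf c
      leftOf-rightOf {c} {c′} c∈ c′∈ eq = inner-not-corner c∈ c′∈ {c′ ⊕ NE} (there (here refl))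
        (trans (sym (⊕-assoc c′ NW E)) (trans (cong (_⊕ E) eq) (centre-leftOf c)))

      weight-left : ∀ right left crude {c} → c ∈ inner → weight right left crude (leftOf c) ≡ instantiate (c ⊕_) left
      weight-left right left crude {c} c∈ with (leftOf c ⊕ E) ∈? inner | (leftOf c ⊕ SE) ∈? inner
      ... | yes _ | _ = cong (λ x → instantiate (x ⊕_) left) (centre-leftOf c)
      ... | no c∉ | _ = contradiction (subst (_∈ inner) (sym (centre-leftOf c)) c∈) c∉

      weight-right : ∀ right left crude {c} → c ∈ inner → weight right left crude (rightOf c) ≡ instantiate (c ⊕_) right
      weight-right right left crude {c} c∈ with (rightOf c ⊕ E) ∈? inner | (rightOf c ⊕ SE) ∈? inner
      ... | yes l∈ | _ = contradiction (sym (leftOf-centre (rightOf c))) (leftOf-rightOf l∈ c∈)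
      ... | no _ | yes _ = cong (λ x → instantiate (x ⊕_) right) (centre-rightOf c)
      ... | no _ | no c∉ = contradiction (subst (_∈ inner) (sym (centre-rightOf c)) c∈) c∉

      weight-cases : ∀ right left crude (Q : Point → Polynomial Point → Set) →
        (∀ {c} → c ∈ inner → Q (leftOf c) (instantiate (c ⊕_) left)) →
        (∀ {c} → c ∈ inner → Q (rightOf c) (instantiate (c ⊕_) right)) →
        (∀ v → Q v (instantiate (v ⊕_) crude)) → ∀ v → Q v (weight right left crude v)
      weight-cases right left crude Q onLeft onRight onOther v
        with (v ⊕ E) ∈? inner | (v ⊕ SE) ∈? inner
      ... | yes c∈ | _      = subst (λ x → Q x (instantiate ((v ⊕ E) ⊕_) left)) (leftOf-centre v) (onLeft c∈)
      ... | no _   | yes c∈ = subst (λ x → Q x (instantiate ((v ⊕ SE) ⊕_) right)) (rightOf-centre v) (onRight c∈)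
      ... | no _   | no _   = onOther v

      centre-injective : ∀ {j i j′ i′} → centre j i ≡ centre j′ i′ → (j , i) ≡ (j′ , i′)
      centre-injective {j} {i} {j′} {i′} eq
        with refl ← ℕ.*-cancelˡ-≡ j j′ 3 (ℤ.+-injective (cong proj₁ eq))
        with refl ← ℕ.*-cancelˡ-≡ i i′ 2 (ℕ.+-cancelʳ-≡ (j % 2) (2 * i) (2 * i′) (ℤ.+-injective (cong proj₂ eq))) = refl

      inner-unique : Unique inner
      inner-unique = Unique.map⁺ (λ {(j , i)} {(j′ , i′)} eq → cong (λ (a , b) → a , pred b) (centre-injective {j} {suc i} {j′} {suc i′} eq))
        (Unique.cartesianProduct⁺ (Unique.upTo⁺ (2 + k)) (Unique.upTo⁺ k))

      pair : Point → List Point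
      pair c = rightOf c ∷ leftOf c ∷ []

      pairs-unique : ∀ cs → (∀ {c} → c ∈ cs → c ∈ inner) → Unique cs → Unique (concatMap pair cs)
      pairs-unique [] _ [] = []
      pairs-unique (c ∷ cs) ⊆ (c≢ ∷ u) =
        (leftOf-rightOf (⊆ (here refl)) (⊆ (here refl)) ∷ All.tabulate (λ p∈ → away (λ q → q ≢ rightOf c)
          (λ c′∈ eq → All.lookup c≢ c′∈ (⊕-cancelʳ NW (sym eq)))
          (λ c′∈ eq → leftOf-rightOf (⊆ (there c′∈)) (⊆ (here refl)) (sym eq)) p∈ ∘ sym)) ∷
        All.tabulate (λ p∈ → away (λ q → q ≢ leftOf c)
          (λ c′∈ → leftOf-rightOf (⊆ (here refl)) (⊆ (there c′∈)))
          (λ c′∈ eq → All.lookup c≢ c′∈ (⊕-cancelʳ W (sym eq))) p∈ ∘ sym) ∷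
        pairs-unique cs (⊆ ∘ there) u
        where
        away : ∀ (Q : Point → Set) → (∀ {c′} → c′ ∈ cs → Q (rightOf c′)) → (∀ {c′} → c′ ∈ cs → Q (leftOf c′)) →
               ∀ {p} → p ∈ concatMap pair cs → Q p
        away Q qr ql p∈ with find (∈.∈-concatMap⁻ pair {xs = cs} p∈)
        ... | c′ , c′∈ , here refl         = qr c′∈
        ... | c′ , c′∈ , there (here refl) = ql c′∈

      cellCorners : List Point
      cellCorners = cornerOffsets ++ map ((+ 0 , + 2) ⊕_) cornerOffsets ++
                    map ((+ 3 , + 1) ⊕_) cornerOffsets ++ map ((+ 3 , -[1+ 0 ]) ⊕_) cornerOffsets

      cellCorners-∈ : ∀ {c} → c ∈ inner → All (λ o → c ⊕ o ∈ vs) cellCorners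
      cellCorners-∈ {c} c∈ = All.++⁺ (All.tabulate (λ o∈ → corner-∈ here-∈ (∈.∈-map⁺ (c ⊕_) o∈)))
        (All.++⁺ (around (+ 0 , + 2) above-∈) (All.++⁺ (around (+ 3 , + 1) right⁺) (around (+ 3 , -[1+ 0 ]) right⁻)))
        where
        open Surrounded (surrounded c∈)
        around : ∀ e → c ⊕ e ∈ centres m → All (λ o → c ⊕ o ∈ vs) (map (e ⊕_) cornerOffsets)
        around e e∈ = All.map⁺ (All.tabulate (λ {o} o∈ → subst (_∈ vs) (⊕-assoc c e o) (corner-∈ e∈ (∈.∈-map⁺ ((c ⊕ e) ⊕_) o∈))))

      hexCells : Cells
      hexCells = record
        { Cell    = Point
        ; cells   = inner
        ; members = pair
        ; unique  = pairs-unique inner (λ c∈ → c∈) inner-unique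
        ; within  = λ v∈ → pair-∈ v∈
        }
        where
        pair-∈ : ∀ {v} → v ∈ concatMap pair inner → v ∈ vs
        pair-∈ v∈ with find (∈.∈-concatMap⁻ pair {xs = inner} v∈)
        ... | c , c∈ , here refl         = corner-∈ (Surrounded.here-∈ (surrounded c∈)) (there (there (here refl)))
        ... | c , c∈ , there (here refl) = corner-∈ (Surrounded.here-∈ (surrounded c∈)) (there (there (there (here refl))))

      cellBound : ∀ right left crude → Within cellCorners (right ++ left) → ∀ {b} →
        norm right ≤ b → norm left ≤ b → norm crude ≤ b →
        CellBound hexCells (weight right left crude) (profile (right ++ left)) b
      cellBound right left crude w {b} nr nl nc = record
        { cellWeight = λ c → instantiate (c ⊕_) (right ++ left)
        ; cell-≤     = λ {c} c∈ s _ → ℤ.≤-reflexive (trans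
            (cong₂ (λ x y → eval s x ℤ.+ (eval s y ℤ.+ 0ℤ)) (weight-right right left crude c∈) (weight-left right left crude c∈))
            (trans (cong (ℤ._+_ (eval s (instantiate (c ⊕_) right))) (ℤ.+-identityʳ _))
              (sym (trans (cong (eval s) (map-++ _ right left)) (Σᴸ-++ (evalMonomial s) (instantiate (c ⊕_) right) (instantiate (c ⊕_) left))))))
        ; valid      = λ {c} c∈ → instantiate-valid (c ⊕_) (⊕-injective c) (cellCorners-∈ c∈) w
        ; shape      = λ c → same (c ⊕_) (right ++ left)
        ; norm-≤     = weight-cases right left crude (λ _ p → norm p ≤ b)
            (λ {c} _ → subst (_≤ b) (sym (norm-instantiate (c ⊕_) left)) nl)
            (λ {c} _ → subst (_≤ b) (sym (norm-instantiate (c ⊕_) right)) nr)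
            (λ v → subst (_≤ b) (sym (norm-instantiate (v ⊕_) crude)) nc)
        }
        where
        same : (f : Point → Point) → ∀ p → profile (instantiate f p) ≡ profile p
        same f []            = refl
        same f ((c , A) ∷ p) = cong₂ _∷_ (cong (c ,_) (length-map f A)) (same f p)

      origin : Point
      origin = (+ 0 , + 0)

      -- Opening a vertex adds at most one cluster, and it joins at most three because only E, NE
      -- and SE lead to later points. So the change lies between -2 and 1.
      crudeUpper crudeLower : Polynomial Point
      crudeUpper = ⊞ (origin ∷ []) ∷ []
      crudeLower = (-[1+ 1 ] , origin ∷ []) ∷ []

      module _ (s : Point → Bool) (supp : Supported s) where

        private
          at-origin : ∀ v {b} → s v ≡ b → s (v ⊕ origin) ≡ b
          at-origin v sv = trans (cong s (⊕-identityʳ v)) sv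

        upper-gain : ∀ v → s v ≡ true → Gain≤ s v (eval s (weight rightPoly leftUpper crudeUpper v))
        upper-gain = weight-cases rightPoly leftUpper crudeUpper (λ v p → s v ≡ true → Gain≤ s v (eval s p))
          (λ {c} c∈ → Around.left-upper c (surrounded c∈) s supp)
          (λ {c} c∈ → Around.right-upper c (surrounded c∈) s supp)
          (λ v sv → record { reps = [] ; adjacent = [] ; apart = [] ; bound = bd v (at-origin v sv) })
          where
          bd : ∀ v → s (v ⊕ origin) ≡ true → 1ℤ ℤ.≤ eval s (instantiate (v ⊕_) crudeUpper) ℤ.+ + 0
          bd v sv rewrite sv = ℤ.≤-refl

        upper-closed : ∀ v → s v ≡ false → 0ℤ ℤ.≤ eval s (weight rightPoly leftUpper crudeUpper v)
        upper-closed = weight-cases rightPoly leftUpper crudeUpper (λ v p → s v ≡ false → 0ℤ ℤ.≤ eval s p)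
          (λ {c} c∈ → Around.U-closed c (surrounded c∈) s supp) onRight (λ v sv → bd v (at-origin v sv))
          where
          onRight : ∀ {c} → c ∈ inner → s (rightOf c) ≡ false → 0ℤ ℤ.≤ eval s (instantiate (c ⊕_) rightPoly)
          onRight _ sv rewrite sv = ℤ.≤-refl
          bd : ∀ v → s (v ⊕ origin) ≡ false → 0ℤ ℤ.≤ eval s (instantiate (v ⊕_) crudeUpper)
          bd v sv rewrite sv = ℤ.≤-refl

        lower-gain : ∀ v → s v ≡ true → Gain≥ s v (eval s (weight rightPoly leftLower crudeLower v))
        lower-gain = weight-cases rightPoly leftLower crudeLower (λ v p → s v ≡ true → Gain≥ s v (eval s p))
          (λ {c} c∈ → Around.left-lower c (surrounded c∈) s supp)
          (λ {c} c∈ → Around.right-lower c (surrounded c∈) s supp)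
          (λ v sv → record
            { reps  = map (v ⊕_) (filter (origin ≺ᴾ?_) (map (origin ⊕_) directions))
            ; near  = λ {w} lw r → Any.map (λ { refl → ε })
                (later-near s v origin origin {w} (subst (λ x → Later s x w) (sym (⊕-identityʳ v)) lw)
                  (subst (λ x → R x w) (sym (⊕-identityʳ v)) (R-sym r)))
            ; bound = bd v (at-origin v sv) })
          where
          bd : ∀ v → s (v ⊕ origin) ≡ true → eval s (instantiate (v ⊕_) crudeLower) ℤ.+ + 3 ℤ.≤ 1ℤ
          bd v sv rewrite sv = ℤ.≤-refl

        lower-closed : ∀ v → s v ≡ false → eval s (weight rightPoly leftLower crudeLower v) ℤ.≤ 0ℤ
        lower-closed = weight-cases rightPoly leftLower crudeLower (λ v p → s v ≡ false → eval s p ℤ.≤ 0ℤ)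
          (λ {c} c∈ → Around.L-closed c (surrounded c∈) s supp) onRight (λ v sv → bd v (at-origin v sv))
          where
          onRight : ∀ {c} → c ∈ inner → s (rightOf c) ≡ false → eval s (instantiate (c ⊕_) rightPoly) ℤ.≤ 0ℤ
          onRight _ sv rewrite sv = ℤ.≤-refl
          bd : ∀ v → s (v ⊕ origin) ≡ false → eval s (instantiate (v ⊕_) crudeLower) ℤ.≤ 0ℤ
          bd v sv rewrite sv = ℤ.≤-refl

      N : ℕ
      N = Graph.order G

      weight-negate : ∀ right left crude v → weight (negate right) (negate left) (negate crude) v ≡ negate (weight right left crude v)
      weight-negate right left crude v with (v ⊕ E) ∈? inner | (v ⊕ SE) ∈? inner
      ... | yes _ | _     = instantiate-negate _ left
      ... | no _  | yes _ = instantiate-negate _ right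
      ... | no _  | no _  = instantiate-negate _ crude

      inner-length : length inner ≡ (2 + k) * k
      inner-length = trans (length-map innerCentre indices) (trans (length-cartesianProduct (upTo (2 + k)) (upTo k))
        (cong₂ _*_ (length-upTo (2 + k)) (length-upTo k)))

      pairs-length : ∀ cs → length (concatMap pair cs) ≡ 2 * length cs
      pairs-length []       = refl
      pairs-length (c ∷ cs) = trans (cong (_+_ 2) (pairs-length cs)) (lem (length cs))
        where
        lem : ∀ n → 2 + 2 * n ≡ 2 * suc n
        lem = ℕRing.solve-∀

      open Cells hexCells using (margin)

      size : 2 * length inner + margin ≡ N
      size = trans (cong (_+ margin) (sym (pairs-length inner))) (Cells.size hexCells)

      weights-≤ : ∀ {n} (le : n ≤ N) w → Vec.Unique w →
                  + clustersOf G le w ℤ.≤ Σᴸ (λ v → eval (opened le w) (weight rightPoly leftUpper crudeUpper v)) vs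
      weights-≤ le w w! = clusters-≤-weight le w w! (λ v → eval (opened le w) (weight rightPoly leftUpper crudeUpper v))
        (λ {v} _ → upper-gain (opened le w) (opened⇒∈ le w) v) (λ {v} _ → upper-closed (opened le w) (opened⇒∈ le w) v)

      weights-≥ : ∀ {n} (le : n ≤ N) w → Vec.Unique w →
                  Σᴸ (λ v → eval (opened le w) (weight rightPoly leftLower crudeLower v)) vs ℤ.≤ + clustersOf G le w
      weights-≥ le w w! = clusters-≥-weight le w w! (λ v → eval (opened le w) (weight rightPoly leftLower crudeLower v))
        (λ {v} _ → lower-gain (opened le w) (opened⇒∈ le w) v) (λ {v} _ → lower-closed (opened le w) (opened⇒∈ le w) v)

      negated : ∀ s ps → Σᴸ (λ v → eval s (weight (negate rightPoly) (negate leftLower) (negate crudeLower) v)) ps ≡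
                ℤ.- Σᴸ (λ v → eval s (weight rightPoly leftLower crudeLower v)) ps
      negated s ps = trans (Σᴸ-cong ps (λ {v} _ → trans (cong (eval s) (weight-negate rightPoly leftLower crudeLower v))
        (eval-negate s (weight rightPoly leftLower crudeLower v)))) (Σᴸ-neg _ ps)

      upper : ∀ {n} (le : n ≤ N) → Σ-orderings N N [] (λ w → + clustersOf G le w) ℤ.≤
              + length inner ℤ.* moment N n (profile hexagonalUpper) ℤ.+ + (N !) ℤ.* + (margin * 12)
      upper le = Σ-clusters-≤ hexCells le (λ w → + clustersOf G le w) (weight rightPoly leftUpper crudeUpper)
        (cellBound rightPoly leftUpper crudeUpper (from-yes (within? cellCorners hexagonalUpper))
          (from-yes (norm rightPoly ℕ.≤? 12)) (from-yes (norm leftUpper ℕ.≤? 12)) (from-yes (norm crudeUpper ℕ.≤? 12)))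
        (weights-≤ le)

      lower : ∀ {n} (le : n ≤ N) → Σ-orderings N N [] (λ w → ℤ.- (+ clustersOf G le w)) ℤ.≤
              + length inner ℤ.* moment N n (profile (negate rightPoly ++ negate leftLower)) ℤ.+ + (N !) ℤ.* + (margin * 12)
      lower le = Σ-clusters-≤ hexCells le (λ w → ℤ.- (+ clustersOf G le w)) (weight (negate rightPoly) (negate leftLower) (negate crudeLower))
        (cellBound (negate rightPoly) (negate leftLower) (negate crudeLower)
          (from-yes (within? cellCorners (negate rightPoly ++ negate leftLower)))
          (from-yes (norm (negate rightPoly) ℕ.≤? 12)) (from-yes (norm (negate leftLower) ℕ.≤? 12)) (from-yes (norm (negate crudeLower) ℕ.≤? 12)))
        (λ w w! → subst (ℤ.- (+ clustersOf G le w) ℤ.≤_) (sym (negated (opened le w) vs)) (ℤ.neg-mono-≤ (weights-≥ le w w!)))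

      profile-lower : profile (negate rightPoly ++ negate leftLower) ≡ negate (profile hexagonalLower)
      profile-lower = refl

      lower′ : ∀ {n} (le : n ≤ N) → ℤ.- Σ-orderings N N [] (λ w → + clustersOf G le w) ℤ.≤
               + length inner ℤ.* moment N n (negate (profile hexagonalLower)) ℤ.+ + (N !) ℤ.* + (margin * 12)
      lower′ {n} le = subst₂ (λ x p → x ℤ.≤ + length inner ℤ.* moment N n p ℤ.+ + (N !) ℤ.* + (margin * 12))
        (Σ-orderings-neg N N [] (λ w → + clustersOf G le w)) profile-lower (lower le)

      -- Every vertex is the left or the right corner of some hexagon of a slightly larger region.
      outer : ℕ × ℕ → Point
      outer (j , i) = centre j i ⊕ (+ 0 , -[1+ 1 ])

      outerIndices : List (ℕ × ℕ)
      outerIndices = cartesianProduct (upTo (suc m)) (upTo (2 + m))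

      outer-pairs : List Point
      outer-pairs = concatMap pair (map outer outerIndices)

      vs⊆outer : ∀ {p} → p ∈ vs → p ∈ outer-pairs
      vs⊆outer p∈ with ∈-corner p∈
      ... | c , c∈ , p∈c with ∈-centre c∈
      ... | j , i , j< , i< , refl = go p∈c
        where
        c₀ = centre j i
        pair-∈ : ∀ {j i q} → j < suc m → i < 2 + m → q ∈ pair (outer (j , i)) → q ∈ outer-pairs
        pair-∈ j< i< q∈ = ∈.∈-concatMap⁺ pair (lose (∈.∈-map⁺ outer (∈.∈-cartesianProduct⁺ (∈.∈-upTo⁺ j<) (∈.∈-upTo⁺ i<))) q∈)
        IsOuter : Point → Set
        IsOuter q = ∃ λ ji → proj₁ ji < suc m × proj₂ ji < 2 + m × outer ji ≡ q
        as-right : ∀ {q} e → IsOuter (c₀ ⊕ e) → c₀ ⊕ (e ⊕ NW) ≡ q → q ∈ outer-pairs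
        as-right e ((a , b) , a< , b< , eq) refl = pair-∈ a< b< (here (sym (trans (cong rightOf eq) (⊕-assoc c₀ e NW))))
        as-left : ∀ {q} e → IsOuter (c₀ ⊕ e) → c₀ ⊕ (e ⊕ W) ≡ q → q ∈ outer-pairs
        as-left e ((a , b) , a< , b< , eq) refl = pair-∈ a< b< (there (here (sym (trans (cong leftOf eq) (⊕-assoc c₀ e W)))))
        same : IsOuter (c₀ ⊕ (+ 0 , + 0))
        same = (j , suc i) , ℕ.m≤n⇒m≤1+n j< , s≤s (ℕ.m≤n⇒m≤1+n i<) , cong₂ _,_ refl (up-one i (j % 2))
          where
          lem : ∀ a → + 2 ℤ.+ a ℤ.+ -[1+ 1 ] ≡ a ℤ.+ + 0
          lem = solve-∀
          up-one : ∀ i r → + (2 * suc i + r) ℤ.+ -[1+ 1 ] ≡ + (2 * i + r) ℤ.+ + 0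
          up-one i r = trans (cong (λ n → + n ℤ.+ -[1+ 1 ]) (two i r)) (lem (+ (2 * i + r)))
            where
            two : ∀ i r → 2 * suc i + r ≡ 2 + (2 * i + r)
            two = ℕRing.solve-∀
        below : IsOuter (c₀ ⊕ (+ 0 , -[1+ 1 ]))
        below = (j , i) , ℕ.m≤n⇒m≤1+n j< , ℕ.m≤n⇒m≤1+n (ℕ.m≤n⇒m≤1+n i<) , refl
        x-≡ : + (3 * suc j) ℤ.+ + 0 ≡ + (3 * j) ℤ.+ + 3
        x-≡ = cong +_ (lem j)
          where
          lem : ∀ j → 3 * suc j + 0 ≡ 3 * j + 3
          lem = ℕRing.solve-∀
        y-even : ∀ a → a ℤ.+ + 1 ℤ.+ -[1+ 1 ] ≡ a ℤ.+ + 0 ℤ.+ -[1+ 0 ]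
        y-even = solve-∀
        two : ∀ i r → 2 * suc i + r ≡ 2 + (2 * i + r)
        two = ℕRing.solve-∀
        right⁻ : IsOuter (c₀ ⊕ (+ 3 , -[1+ 0 ]))
        right⁻ with parity j
        ... | inj₁ (j≡ , sj≡) = (suc j , i) , s≤s j< , ℕ.m≤n⇒m≤1+n (ℕ.m≤n⇒m≤1+n i<) , cong₂ _,_ x-≡
          (trans (cong (λ r → + (2 * i + r) ℤ.+ -[1+ 1 ]) sj≡) (trans (y-even (+ (2 * i))) (cong (λ r → + (2 * i + r) ℤ.+ -[1+ 0 ]) (sym j≡))))
        ... | inj₂ (j≡ , sj≡) = (suc j , suc i) , s≤s j< , s≤s (ℕ.m≤n⇒m≤1+n i<) , cong₂ _,_ x-≡
          (trans (cong (λ r → + (2 * suc i + r) ℤ.+ -[1+ 1 ]) sj≡) (trans (cong (λ n → + n ℤ.+ -[1+ 1 ]) (two i 0)) (trans (lem (+ (2 * i)))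
            (cong (λ r → + (2 * i + r) ℤ.+ -[1+ 0 ]) (sym j≡)))))
          where
          lem : ∀ a → + 2 ℤ.+ (a ℤ.+ + 0) ℤ.+ -[1+ 1 ] ≡ a ℤ.+ + 1 ℤ.+ -[1+ 0 ]
          lem = solve-∀
        right⁺ : IsOuter (c₀ ⊕ (+ 3 , + 1))
        right⁺ with parity j
        ... | inj₁ (j≡ , sj≡) = (suc j , suc i) , s≤s j< , s≤s (ℕ.m≤n⇒m≤1+n i<) , cong₂ _,_ x-≡
          (trans (cong (λ r → + (2 * suc i + r) ℤ.+ -[1+ 1 ]) sj≡) (trans (cong (λ n → + n ℤ.+ -[1+ 1 ]) (two i 1)) (trans (lem (+ (2 * i)))
            (cong (λ r → + (2 * i + r) ℤ.+ + 1) (sym j≡)))))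
          where
          lem : ∀ a → + 2 ℤ.+ (a ℤ.+ + 1) ℤ.+ -[1+ 1 ] ≡ a ℤ.+ + 0 ℤ.+ + 1
          lem = solve-∀
        ... | inj₂ (j≡ , sj≡) = (suc j , suc (suc i)) , s≤s j< , s≤s (s≤s i<) , cong₂ _,_ x-≡
          (trans (cong (λ r → + (2 * suc (suc i) + r) ℤ.+ -[1+ 1 ]) sj≡) (trans (cong (λ n → + n ℤ.+ -[1+ 1 ]) (four i)) (trans (lem (+ (2 * i)))
            (cong (λ r → + (2 * i + r) ℤ.+ + 1) (sym j≡)))))
          where
          four : ∀ i → 2 * suc (suc i) + 0 ≡ 4 + 2 * i
          four = ℕRing.solve-∀
          lem : ∀ a → + 4 ℤ.+ a ℤ.+ -[1+ 1 ] ≡ a ℤ.+ + 1 ℤ.+ + 1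
          lem = solve-∀
        go : ∀ {q} → q ∈ corners c₀ → q ∈ outer-pairs
        go (here refl)                                         = as-right (+ 3 , -[1+ 0 ]) right⁻ refl
        go (there (here refl))                                 = as-left (+ 3 , + 1) right⁺ refl
        go (there (there (here refl)))                         = as-right (+ 0 , + 0) same refl
        go (there (there (there (here refl))))                 = as-left (+ 0 , + 0) same refl
        go (there (there (there (there (here refl)))))         = as-right (+ 0 , -[1+ 1 ]) below refl
        go (there (there (there (there (there (here refl)))))) = as-left (+ 3 , -[1+ 0 ]) right⁻ refl

    -- Together with `order-≡` this leaves a margin of at most 14 k + 40, linear in the side,
    -- without an exact count of the vertices.
    order-≤ : Graph.order G ≤ 2 * ((4 + k) * (5 + k))
    order-≤ = ℕ.≤-trans (subst (_≤ length outer-pairs) (Drawing.vs-length drawing) (unique-⊆-length vs-unique vs⊆outer)) (ℕ.≤-reflexive (trans (pairs-length (map outer outerIndices))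
      (cong (2 *_) (trans (length-map outer outerIndices) (trans (length-cartesianProduct (upTo (suc m)) (upTo (2 + m)))
        (trans (cong₂ _*_ (length-upTo (suc m)) (length-upTo (2 + m))) (cong (λ x → suc x * (2 + x)) m≡)))))))

    analysed : Analysed G 2 12 (profile hexagonalUpper) (profile hexagonalLower)
    analysed = record
      { M         = length inner
      ; margin    = margin
      ; size      = size
      ; upper     = upper
      ; lower     = lower′
      ; lipschitz = clusters-lipschitz (λ p → map (p ⊕_) directions) (λ _ → ℕ.≤-refl) (λ r → neighbours (R-sym r))
      ; step      = clusters-step
      }

    order-≡ : 2 * ((2 + k) * k) + Analysed.margin analysed ≡ Graph.order G
    order-≡ = trans (cong (λ l → 2 * l + margin) (sym inner-length)) size

-- The margin is negligible on all three lattices.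

module Families where
  open import Defs
  open Model
  open Grids
  open Squares
  open Triangles
  open Hexagons
  open import Data.Nat.Base using (ℕ; suc; _+_; _*_; _∸_; _≤_; z≤n; s≤s)
  import Data.Nat.Properties as ℕ
  import Data.Nat.Tactic.RingSolver as ℕRing
  open import Data.Product.Base using (∃; _,_; proj₁; proj₂)
  open import Data.Sum.Base using (inj₁; inj₂)
  open import Level using (0ℓ)
  open import Relation.Binary.Core using (Rel)
  open import Relation.Binary.Definitions using (Symmetric)
  open import Relation.Binary.PropositionalEquality
  open import Relation.Nullary.Decidable using (from-yes)
  open import Relation.Nullary.Negation using (contradiction)

  private
    -- The form in which a margin linear in the side meets a number of vertices quadratic in it: C a
    -- k ≤ k k and C b ≤ k.
    quadratic : ∀ a b C k → (a + b) * C ≤ k → C * (a * k + b) ≤ k * k + k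
    quadratic a b C k le = subst (_≤ k * k + k) (lem a b C k) (ℕ.+-mono-≤
      (ℕ.*-monoˡ-≤ k (ℕ.≤-trans (ℕ.*-monoˡ-≤ C (ℕ.m≤m+n a b)) le))
      (ℕ.≤-trans (ℕ.*-monoˡ-≤ C (ℕ.m≤n+m b a)) le))
      where
      lem : ∀ a b C k → a * C * k + b * C ≡ C * (a * k + b)
      lem = ℕRing.solve-∀

    split : ∀ {n} → 3 ≤ n → n ≡ 3 + (n ∸ 3)
    split 3≤n = sym (ℕ.m+[n∸m]≡n 3≤n)

    module GridFamily {R : Rel Lattice² 0ℓ} {R-sym : Symmetric R} (W : GridWeights R R-sym) (G : ℕ → Graph)
                      (drawing : ∀ n → Drawing (G n) (grid n) R) where
      open GridWeights W

      order : ∀ n → Graph.order (G n) ≡ n * n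
      order n = trans (sym (Drawing.vs-length (drawing n))) (grid-length n)

      large : ∀ n → 9 ≤ Graph.order (G n) → 3 ≤ n
      large n 9≤ with ℕ.<-≤-connex n 3
      ... | inj₂ 3≤n = 3≤n
      ... | inj₁ n<3 = contradiction (subst (9 ≤_) (order n) 9≤) (ℕ.<⇒≱ (ℕ.*-mono-< n<3 n<3))

      model : ∀ b → norm upperPoly ≤ b → norm (negate lowerPoly) ≤ b → ∀ n → 9 ≤ Graph.order (G n) →
              Analysed (G n) 1 b (profile upperPoly) (profile lowerPoly)
      model b nU nL n h = GridModel.analysed W n (n ∸ 3) (split (large n h)) (G n) (drawing n) b nU nL

      small : ∀ b nU nL C → ∃ λ N₀ → ∀ n h → N₀ ≤ Graph.order (G n) → C * Analysed.margin (model b nU nL n h) ≤ Graph.order (G n)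
      small b nU nL C = bound * bound , λ n h N₀≤ → begin
        C * Analysed.margin (model b nU nL n h)
          ≡⟨ cong (C *_) (GridModel.margin-≡ W n (n ∸ 3) (split (large n h)) (G n) (drawing n)) ⟩
        C * (5 * (n ∸ 3) + 9)
          ≤⟨ quadratic 5 9 C (n ∸ 3) (subst (_≤ n ∸ 3) (ℕ.m+n∸m≡n 3 (14 * C)) (ℕ.∸-monoˡ-≤ 3 (big n (subst (bound * bound ≤_) (order n) N₀≤)))) ⟩
        (n ∸ 3) * (n ∸ 3) + (n ∸ 3)
          ≤⟨ ℕ.m≤m+n _ (5 * (n ∸ 3) + 9) ⟩
        (n ∸ 3) * (n ∸ 3) + (n ∸ 3) + (5 * (n ∸ 3) + 9)
          ≡⟨ lem (n ∸ 3) ⟩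
        (3 + (n ∸ 3)) * (3 + (n ∸ 3))
          ≡⟨ cong (λ x → x * x) (split (large n h)) ⟨
        n * n
          ≡⟨ order n ⟨
        Graph.order (G n) ∎
        where
        open ℕ.≤-Reasoning
        -- 14 = 5 + 9 adds the coefficients of the margin 5 k + 9, and 3 passes from k to n.
        bound = 3 + 14 * C
        big : ∀ n → bound * bound ≤ n * n → bound ≤ n
        big n le with ℕ.<-≤-connex n bound
        ... | inj₂ ≤n = ≤n
        ... | inj₁ n< = contradiction le (ℕ.<⇒≱ (ℕ.*-mono-< n< n<))
        lem : ∀ k → k * k + k + (5 * k + 9) ≡ (3 + k) * (3 + k)
        lem = ℕRing.solve-∀

  squareFamily : Family squareL 1 12 (profile squareUpper) (profile squareLower)
  squareFamily = record
    { least = 9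
    ; model = model 12 (from-yes (norm squareUpper ℕ.≤? 12)) (from-yes (norm (negate squareLower) ℕ.≤? 12))
    ; small = small 12 (from-yes (norm squareUpper ℕ.≤? 12)) (from-yes (norm (negate squareLower) ℕ.≤? 12))
    }
    where open GridFamily squareWeights square squareDrawing

  triangularFamily : Family triangularL 1 12 (profile triangularUpper) (profile triangularLower)
  triangularFamily = record
    { least = 9
    ; model = model 12 (from-yes (norm triangularUpper ℕ.≤? 12)) (from-yes (norm (negate triangularLower) ℕ.≤? 12))
    ; small = small 12 (from-yes (norm triangularUpper ℕ.≤? 12)) (from-yes (norm (negate triangularLower) ℕ.≤? 12))
    }
    where open GridFamily triangularWeights triangular triangularDrawing

  private
    -- For m = 2 the lattice is three mutually adjacent hexagons, with 13 vertices in all.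
    large : ∀ m → 14 ≤ Graph.order (hexagonal m) → 3 ≤ m
    large 0 h = contradiction h (ℕ.<⇒≱ (from-yes (Graph.order (hexagonal 0) ℕ.<? 14)))
    large 1 h = contradiction h (ℕ.<⇒≱ (from-yes (Graph.order (hexagonal 1) ℕ.<? 14)))
    large 2 h = contradiction h (ℕ.<⇒≱ (from-yes (Graph.order (hexagonal 2) ℕ.<? 14)))
    large (suc (suc (suc m))) _ = s≤s (s≤s (s≤s z≤n))

    module Hex (m : ℕ) (3≤m : 3 ≤ m) = HexagonModel m (m ∸ 3) (split 3≤m) (hexagonal m) (hexagonalDrawing m)

    hex-small : ∀ C → ∃ λ N₀ → ∀ m (3≤m : 3 ≤ m) → N₀ ≤ Graph.order (hexagonal m) →
                C * Analysed.margin (Hex.analysed m 3≤m) ≤ Graph.order (hexagonal m)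
    hex-small C = suc (2 * ((4 + K) * (5 + K))) , λ m 3≤m N₀≤ →
      bound (m ∸ 3) (Graph.order (hexagonal m)) (Analysed.margin (Hex.analysed m 3≤m)) (Hex.order-≤ m 3≤m) (Hex.order-≡ m 3≤m) N₀≤
      where
      -- 54 = 14 + 40, from the bound 14 k + 40 on the margin.
      K = 54 * C
      bound : ∀ k N g → N ≤ 2 * ((4 + k) * (5 + k)) → 2 * ((2 + k) * k) + g ≡ N → suc (2 * ((4 + K) * (5 + K))) ≤ N → C * g ≤ N
      bound k N g N≤ N≡ N₀≤ = begin
        C * g                        ≤⟨ ℕ.*-monoʳ-≤ C g≤ ⟩
        C * (14 * k + 40)            ≤⟨ quadratic 14 40 C k K≤k ⟩
        k * k + k                    ≤⟨ ℕ.m≤m+n (k * k + k) (k * k + 3 * k + g) ⟩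
        k * k + k + (k * k + 3 * k + g) ≡⟨ lem k g ⟩
        2 * ((2 + k) * k) + g        ≡⟨ N≡ ⟩
        N ∎
        where
        open ℕ.≤-Reasoning
        lem : ∀ k g → k * k + k + (k * k + 3 * k + g) ≡ 2 * ((2 + k) * k) + g
        lem = ℕRing.solve-∀
        lem′ : ∀ k → 2 * ((4 + k) * (5 + k)) ≡ 2 * ((2 + k) * k) + (14 * k + 40)
        lem′ = ℕRing.solve-∀
        g≤ : g ≤ 14 * k + 40
        g≤ = ℕ.+-cancelˡ-≤ (2 * ((2 + k) * k)) g _ (subst₂ _≤_ (sym N≡) (lem′ k) N≤)
        K≤k : K ≤ k
        K≤k with ℕ.≤-total K k
        ... | inj₁ le = le
        ... | inj₂ k≤K = contradiction (ℕ.≤-trans N₀≤ N≤)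
          (ℕ.<⇒≱ (s≤s (ℕ.*-monoʳ-≤ 2 (ℕ.*-mono-≤ (ℕ.+-monoʳ-≤ 4 k≤K) (ℕ.+-monoʳ-≤ 5 k≤K)))))

  hexagonalFamily : Family hexagonalL 2 12 (profile hexagonalUpper) (profile hexagonalLower)
  hexagonalFamily = record
    { least = 14
    ; model = λ m h → Hex.analysed m (large m h)
    ; small = λ C → proj₁ (hex-small C) , λ m h → proj₂ (hex-small C) m (large m h)
    }

-- Stopping times of the blind game, and expectations as fractions.

module Stopping where
  open import Defs
  open Scan
  open Orderings
  open Variance
  open Model
  open import Data.Empty using (⊥-elim)
  open import Data.Fin.Base as Fin using (Fin; zero; suc)
  import Data.Fin.Properties as Fin
  open import Data.Integer.Base as ℤ using (ℤ; +_)
  import Data.Integer.Properties as ℤ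
  open import Data.List.Base using (List; []; _∷_; map)
  open import Data.Nat.Base as ℕ using (ℕ; zero; suc; NonZero; _!)
  import Data.Nat.Properties as ℕ
  import Data.Nat.Tactic.RingSolver as ℕRing
  open import Data.Nat.ListAction using (sum)
  open import Data.Product.Base using (∃; _,_)
  open import Data.Rational.Base as ℚ using (ℚ)
  import Data.Rational.Properties as ℚ
  open import Data.Rational.Unnormalised.Base as ℚᵘ using (ℚᵘ; mkℚᵘ; *≤*; *≡*; _≃_)
  import Data.Rational.Unnormalised.Properties as ℚᵘ
  open import Data.Sum.Base using (inj₁; inj₂)
  open import Relation.Binary.PropositionalEquality
  open import Relation.Nullary.Decidable using (yes; no)

  /-≃ : ∀ a b .{{_ : NonZero b}} → ℚ.toℚᵘ (+ a ℚ./ b) ≃ (+ a ℚᵘ./ b)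
  /-≃ a (suc b) = ℚ.toℚᵘ-fromℚᵘ (mkℚᵘ (+ a) b)

  /-≤ᵘ⁺ : ∀ a b c d .{{_ : NonZero b}} .{{_ : NonZero d}} → a ℕ.* d ℕ.≤ c ℕ.* b → (+ a ℚᵘ./ b) ℚᵘ.≤ (+ c ℚᵘ./ d)
  /-≤ᵘ⁺ a (suc b) c (suc d) le = *≤* (subst₂ ℤ._≤_ (ℤ.pos-* a (suc d)) (ℤ.pos-* c (suc b)) (ℤ.+≤+ le))

  /-≤ᵘ⁻ : ∀ a c d .{{_ : NonZero d}} → (+ a ℚᵘ./ d) ℚᵘ.≤ (+ c ℚᵘ./ d) → a ℕ.≤ c
  /-≤ᵘ⁻ a c (suc d) (*≤* le) = ℕ.*-cancelʳ-≤ a c (suc d)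
    (ℤ.drop‿+≤+ (subst₂ ℤ._≤_ (sym (ℤ.pos-* a (suc d))) (sym (ℤ.pos-* c (suc d))) le))

  /-≤⁺ : ∀ a b c d .{{_ : NonZero b}} .{{_ : NonZero d}} → a ℕ.* d ℕ.≤ c ℕ.* b → (+ a ℚ./ b) ℚ.≤ (+ c ℚ./ d)
  /-≤⁺ a b c d le = ℚ.toℚᵘ-cancel-≤ (ℚᵘ.≤-respˡ-≃ (ℚᵘ.≃-sym (/-≃ a b)) (ℚᵘ.≤-respʳ-≃ (ℚᵘ.≃-sym (/-≃ c d)) (/-≤ᵘ⁺ a b c d le)))

  /-≤⁻ : ∀ a c d .{{_ : NonZero d}} → (+ a ℚ./ d) ℚ.≤ (+ c ℚ./ d) → a ℕ.≤ c
  /-≤⁻ a c d le = /-≤ᵘ⁻ a c d (ℚᵘ.≤-respˡ-≃ (/-≃ a d) (ℚᵘ.≤-respʳ-≃ (/-≃ c d) (ℚ.toℚᵘ-mono-≤ le)))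

  1/*/ : ∀ a b d .{{_ : NonZero b}} .{{_ : NonZero d}} .{{_ : NonZero (b ℕ.* d)}} →
         (+ 1 ℚᵘ./ b) ℚᵘ.* (+ a ℚᵘ./ d) ≃ (+ a ℚᵘ./ (b ℕ.* d))
  1/*/ a (suc b) (suc d) = *≡* (cong (ℤ._* + (suc b ℕ.* suc d)) (ℤ.*-identityˡ (+ a)))

  -- Only 1 / (d + 1) is spent, which is at most the fraction added on the right.
  /-+-≤ : ∀ a c b e d .{{_ : NonZero b}} → a ℕ.* suc d ℕ.≤ c ℕ.* suc d ℕ.+ b →
          (+ a ℚᵘ./ b) ℚᵘ.≤ (+ c ℚᵘ./ b) ℚᵘ.+ mkℚᵘ (+ suc e) d
  /-+-≤ a c (suc b) e d le = *≤* (subst₂ ℤ._≤_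
    (ℤ.pos-* a (B ℕ.* D))
    (trans (ℤ.pos-* (c ℕ.* D ℕ.+ suc e ℕ.* B) B) (cong (ℤ._* + B) (trans (ℤ.pos-+ (c ℕ.* D) (suc e ℕ.* B)) (cong₂ ℤ._+_ (ℤ.pos-* c D) (ℤ.pos-* (suc e) B)))))
    (ℤ.+≤+ (begin
      a ℕ.* (B ℕ.* D)                          ≡⟨ lem a B D ⟩
      a ℕ.* D ℕ.* B                            ≤⟨ ℕ.*-monoˡ-≤ B (ℕ.≤-trans le (ℕ.+-monoʳ-≤ (c ℕ.* D) (ℕ.m≤m+n B (e ℕ.* B)))) ⟩
      (c ℕ.* D ℕ.+ suc e ℕ.* B) ℕ.* B          ∎)))
    where
    open ℕ.≤-Reasoning
    B = suc b
    D = suc d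
    lem : ∀ a b d → a ℕ.* (b ℕ.* d) ≡ a ℕ.* d ℕ.* b
    lem = ℕRing.solve-∀

  module _ (G : Graph) where
    open Graph G using () renaming (order to N)

    -- The event that `τ` takes its value at `σ` is trivial and contains `σ`, so it is everything.
    blind-constant : ∀ {τ} → IsStoppingTime G (blind G) τ → ∀ σ π → τ π ≡ τ σ
    blind-constant {τ} st σ π with st (τ σ)
    ... | inj₁ (A⊆∅ , _) = ⊥-elim (A⊆∅ {σ} refl)
    ... | inj₂ (_ , U⊆A) = U⊆A {π} _

    constant-blind : ∀ t → IsStoppingTime G (blind G) (λ _ → t)
    constant-blind t t′ with t Fin.≟ t′
    ... | yes eq = inj₂ ((λ _ → _) , (λ _ → eq))
    ... | no ne  = inj₁ ((λ eq → ne eq) , (λ ()))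

    blind-full : ∀ {τ} → IsStoppingTime G (blind G) τ → IsStoppingTime G (fullInformation G) τ
    blind-full st t σ π τσ≡t _ = trans (blind-constant st σ π) τσ≡t

    total-mono : ∀ {τ τ′} → 𝔼C̃ G τ′ ℚ.≤ 𝔼C̃ G τ → total G τ′ ℕ.≤ total G τ
    total-mono {τ} {τ′} le = /-≤⁻ (total G τ′) (total G τ) (N !) le
      where instance _ = N ℕ.!≢0

    optimal-≥ : ∀ {τ} → IsOptimal G (blind G) τ → ∀ t → total G (λ _ → t) ℕ.≤ total G τ
    optimal-≥ {τ} (_ , opt) t = total-mono {τ} {λ _ → t} (opt (λ _ → t) (constant-blind t))

    blind-total : .{{NonZero N}} → ∀ {τ} → IsStoppingTime G (blind G) τ → ∃ λ t → total G τ ≡ total G (λ _ → t)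
    blind-total {τ} st with permutations G
    -- For an empty list both totals are zero, so any time will do.
    ... | []    = some N , refl
      where
      some : ∀ n → .{{NonZero n}} → Fin n
      some (suc n) = zero
    ... | σ ∷ σs = τ σ , go (σ ∷ σs)
      where
      go : ∀ πs → sum (map (λ π → C̃ G (τ π) π) πs) ≡ sum (map (λ π → C̃ G (τ σ) π) πs)
      go []       = refl
      go (π ∷ πs) = cong₂ ℕ._+_ (cong (λ t → C̃ G t π) (blind-constant st σ π)) (go πs)

    +sum : {A : Set} (f : A → ℕ) (xs : List A) → + sum (map f xs) ≡ Σᴸ (λ x → + f x) xs
    +sum f []       = refl
    +sum f (x ∷ xs) = trans (ℤ.pos-+ (f x) _) (cong (ℤ._+_ (+ f x)) (+sum f xs))

    total-constant : ∀ t → + total G (λ _ → t) ≡ Σ-orderings N N [] (λ w → + clustersOf G (Fin.toℕ<n t) w)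
    total-constant t = trans (+sum (λ σ → C̃ G t σ) (permutations G)) (Σ-permutations G (λ w → + clustersOf G (Fin.toℕ<n t) w))

    module _ .{{_ : NonZero N}} where

      private instance
        N!≢0 : NonZero (N !)
        N!≢0 = N ℕ.!≢0
        N*N!≢0 : NonZero (N ℕ.* N !)
        N*N!≢0 = ℕ.m*n≢0 N (N !)

      perVertex-≃ : ∀ τ → ℚ.toℚᵘ (perVertex G τ) ≃ (+ total G τ ℚᵘ./ (N ℕ.* N !))
      perVertex-≃ τ = ℚᵘ.≃-trans (ℚ.toℚᵘ-homo-* (+ 1 ℚ./ N) (+ total G τ ℚ./ N !))
        (ℚᵘ.≃-trans (ℚᵘ.*-cong (/-≃ 1 N) (/-≃ (total G τ) (N !))) (1/*/ (total G τ) N (N !)))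

      perVertex-≤⁺ : ∀ τ a b .{{_ : NonZero b}} → b ℕ.* total G τ ℕ.≤ a ℕ.* (N ℕ.* N !) → perVertex G τ ℚ.≤ (+ a ℚ./ b)
      perVertex-≤⁺ τ a b le = ℚ.toℚᵘ-cancel-≤ (ℚᵘ.≤-respˡ-≃ (ℚᵘ.≃-sym (perVertex-≃ τ)) (ℚᵘ.≤-respʳ-≃ (ℚᵘ.≃-sym (/-≃ a b))
        (/-≤ᵘ⁺ (total G τ) (N ℕ.* N !) a b (subst (ℕ._≤ a ℕ.* (N ℕ.* N !)) (ℕ.*-comm b (total G τ)) le))))

      perVertex-≥⁺ : ∀ τ a b .{{_ : NonZero b}} → a ℕ.* (N ℕ.* N !) ℕ.≤ b ℕ.* total G τ → (+ a ℚ./ b) ℚ.≤ perVertex G τ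
      perVertex-≥⁺ τ a b le = ℚ.toℚᵘ-cancel-≤ (ℚᵘ.≤-respˡ-≃ (ℚᵘ.≃-sym (/-≃ a b)) (ℚᵘ.≤-respʳ-≃ (ℚᵘ.≃-sym (perVertex-≃ τ))
        (/-≤ᵘ⁺ a b (total G τ) (N ℕ.* N !) (subst (a ℕ.* (N ℕ.* N !) ℕ.≤_) (ℕ.*-comm b (total G τ)) le))))

      perVertex-mono : ∀ τ τ′ → total G τ ℕ.≤ total G τ′ → perVertex G τ ℚ.≤ perVertex G τ′
      perVertex-mono τ τ′ le = ℚ.toℚᵘ-cancel-≤ (ℚᵘ.≤-respˡ-≃ (ℚᵘ.≃-sym (perVertex-≃ τ)) (ℚᵘ.≤-respʳ-≃ (ℚᵘ.≃-sym (perVertex-≃ τ′))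
        (/-≤ᵘ⁺ (total G τ) (N ℕ.* N !) (total G τ′) (N ℕ.* N !) (ℕ.*-monoˡ-≤ (N ℕ.* N !) le))))

      perVertex-+ε : ∀ τ τ′ ε e d → ℚ.toℚᵘ ε ≃ mkℚᵘ (+ suc e) d →
        total G τ ℕ.* suc d ℕ.≤ total G τ′ ℕ.* suc d ℕ.+ N ℕ.* N ! → perVertex G τ ℚ.≤ perVertex G τ′ ℚ.+ ε
      perVertex-+ε τ τ′ ε e d ε≃ le = ℚ.toℚᵘ-cancel-≤
        (ℚᵘ.≤-respˡ-≃ (ℚᵘ.≃-sym (perVertex-≃ τ)) (ℚᵘ.≤-respʳ-≃ (ℚᵘ.≃-sym sum-≃)
          (/-+-≤ (total G τ) (total G τ′) (N ℕ.* N !) e d le)))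
        where
        sum-≃ : ℚ.toℚᵘ (perVertex G τ′ ℚ.+ ε) ≃ (+ total G τ′ ℚᵘ./ (N ℕ.* N !)) ℚᵘ.+ mkℚᵘ (+ suc e) d
        sum-≃ = ℚᵘ.≃-trans (ℚ.toℚᵘ-homo-+ (perVertex G τ′) ε) (ℚᵘ.+-cong (perVertex-≃ τ′) ε≃)

-- Bounds for the blind game.

module Bounds where
  open import Defs
  open Model
  open Estimates
  open Grids
  open Stopping
  open import Data.Bool.Base using (T)
  open import Data.Fin.Base as Fin using (Fin; toℕ; fromℕ<)
  import Data.Fin.Properties as Fin
  open import Data.Integer.Base as ℤ using (ℤ; +_)
  import Data.Integer.Properties as ℤ
  open import Data.List.Relation.Unary.All using (All)
  open import Data.Nat.Base as ℕ using (ℕ; suc; NonZero; _+_; _*_; _^_; _≤_; _!)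
  import Data.Nat.Properties as ℕ
  import Data.Nat.Tactic.RingSolver as ℕRing
  open import Data.Product.Base using (_,_; proj₁; proj₂)
  open import Data.Rational.Base as ℚ using (ℚ)
  open import Relation.Binary.PropositionalEquality

  module _ {L d b U D} .{{_ : NonZero d}} (F : Family L d b U D) where
    open Family F

    -- The check covers all densities and hence every constant time. The threshold adds up what must
    -- fit below N: the least size of the model, the margin, K deg and deg.
    blind-≤ : ∀ bnd X K deg {Y} .{{_ : NonZero X}} .{{_ : NonZero K}} →
      All (λ (_ , a) → a ≤ deg) U → d * bnd ≡ suc Y → T (allBelow (gridCheck K deg X Y U) (suc K)) →
      ForLargeN L (λ G → ∀ τ → IsOptimal G (blind G) τ → perVertex G τ ℚ.≤ (+ bnd ℚ./ X))
    blind-≤ bnd X K deg degrees Y≡ check = least + proj₁ (small (X * (d * b))) + K * deg + deg , λ n N₀≤ τ (st , _) →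
      let G      = lattice L n
          N      = Graph.order G
          least≤ = ℕ.≤-trans (ℕ.≤-trans (ℕ.≤-trans (ℕ.m≤m+n _ _) (ℕ.m≤m+n _ _)) (ℕ.m≤m+n _ _)) N₀≤
          small≤ = ℕ.≤-trans (ℕ.≤-trans (ℕ.≤-trans (ℕ.m≤n+m _ least) (ℕ.m≤m+n _ _)) (ℕ.m≤m+n _ _)) N₀≤
          K≤     = ℕ.≤-trans (ℕ.≤-trans (ℕ.m≤n+m _ (least + proj₁ (small (X * (d * b))))) (ℕ.m≤m+n _ _)) N₀≤
          deg≤   = ℕ.≤-trans (ℕ.m≤n+m deg (least + proj₁ (small (X * (d * b))) + K * deg)) N₀≤
          t , eq = blind-total G st
          open Analysed (model n least≤)
          le     = upper-estimate N M d margin b X bnd size U K deg (suc (toℕ t)) (+ total G τ) degrees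
                     (Fin.toℕ<n t) K≤ deg≤ Y≡ (subst (_≤ N) (lem X d b margin) (proj₂ (small (X * (d * b))) n least≤ small≤)) check
                     (subst (ℤ._≤ + M ℤ.* moment N (suc (toℕ t)) U ℤ.+ + (N !) ℤ.* + (margin * b))
                       (trans (sym (total-constant G t)) (cong +_ (sym eq))) (upper (Fin.toℕ<n t)))
      in perVertex-≤⁺ G τ bnd X (ℤ.drop‿+≤+ (subst (ℤ._≤ + (bnd * (N * N !))) (sym (ℤ.pos-* X (total G τ))) le))
      where
      instance
        K^deg≢0 : NonZero (K ^ deg)
        K^deg≢0 = ℕ.m^n≢0 K deg
      lem : ∀ X d b g → X * (d * b) * g ≡ X * (d * (g * b))
      lem = ℕRing.solve-∀

    -- By optimality one constant time is enough; it is chosen so that the density of open vertices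
    -- lies just above lo / K.
    blind-≥ : ∀ bnd X K lo {Y} .{{_ : NonZero X}} .{{_ : NonZero K}} →
      All (λ (_ , a) → a ≤ 13) (negate D) → lo + 14 ≤ K → suc (d * bnd) ≡ Y →
      T (+ X ℤ.* extreme K 13 lo (lo + 14) (negate D) ℤ.≤ᵇ ℤ.- + Y ℤ.* + (K ^ 13)) →
      ForLargeN L (λ G → ∀ τ → IsOptimal G (blind G) τ → (+ bnd ℚ./ X) ℚ.≤ perVertex G τ)
    blind-≥ bnd X K lo {Y} degrees lo≤K Y≡ check = least + proj₁ (small C) + K + 13 , λ n N₀≤ τ opt →
      let G      = lattice L n
          N      = Graph.order G
          least≤ = ℕ.≤-trans (ℕ.≤-trans (ℕ.≤-trans (ℕ.m≤m+n _ _) (ℕ.m≤m+n _ _)) (ℕ.m≤m+n _ _)) N₀≤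
          small≤ = ℕ.≤-trans (ℕ.≤-trans (ℕ.≤-trans (ℕ.m≤n+m _ least) (ℕ.m≤m+n _ _)) (ℕ.m≤m+n _ _)) N₀≤
          K≤     = ℕ.≤-trans (ℕ.≤-trans (ℕ.m≤n+m K (least + proj₁ (small C))) (ℕ.m≤m+n _ _)) N₀≤
          deg≤   = ℕ.≤-trans (ℕ.m≤n+m 13 (least + proj₁ (small C) + K)) N₀≤
          m , m< , Km≤ , lo≤ = density-witness N K lo lo≤K K≤
          t      = fromℕ< m<
          t≡     = Fin.toℕ-fromℕ< m<
          open Analysed (model n least≤)
          le     = lower-estimate N M d margin b X bnd size (negate D) K 13 (suc (toℕ t)) lo (lo + 14) (+ total G (λ _ → t)) degrees
                     (Fin.toℕ<n t) deg≤ (subst (λ x → K * suc x ≤ (lo + 14) * N) (sym t≡) Km≤)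
                     (subst (λ x → lo * N ≤ K * (suc x ℕ.∸ 13)) (sym t≡) lo≤) Y≡
                     (subst (_≤ N) (lem X d b margin Y) (proj₂ (small C) n least≤ small≤)) check
                     (subst (λ z → ℤ.- z ℤ.≤ + M ℤ.* moment N (suc (toℕ t)) (negate D) ℤ.+ + (N !) ℤ.* + (margin * b))
                       (sym (total-constant G t)) (lower (Fin.toℕ<n t)))
      in perVertex-≥⁺ G τ bnd X (ℕ.≤-trans
           (ℤ.drop‿+≤+ (subst (+ (bnd * (N * N !)) ℤ.≤_) (sym (ℤ.pos-* X (total G (λ _ → t)))) le))
           (ℕ.*-monoʳ-≤ X (optimal-≥ G opt t)))
      where
      instance
        K^13≢0 : NonZero (K ^ 13)
        K^13≢0 = ℕ.m^n≢0 K 13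
      C = Y + X * (d * b)
      lem : ∀ X d b g Y → (Y + X * (d * b)) * g ≡ g * Y + X * (d * (g * b))
      lem = ℕRing.solve-∀

-- The full information game: concentration at checkpoints.

module Information where
  open import Defs
  open Scan
  open Orderings
  open Variance
  open Model
  open Grids
  open Stopping
  open import Data.Fin.Base as Fin using (Fin; toℕ)
  import Data.Fin.Properties as Fin
  open import Data.Integer.Base as ℤ using (ℤ; +_; 0ℤ; 1ℤ; _+_; _*_; _-_; _≤_)
  import Data.Integer.Properties as ℤ
  open import Data.Integer.Tactic.RingSolver using (solve-∀)
  open import Data.Irrelevant using ([_])
  open import Data.List.Base using ([]; _∷_; length; upTo)
  open import Data.List.Membership.Propositional using (_∈_)
  open import Data.List.Membership.Propositional.Properties using (∈-upTo⁺)
  open import Data.List.Properties using (length-upTo)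
  open import Data.List.Relation.Unary.AllPairs using () renaming ([] to []ᵖ)
  open import Data.List.Relation.Unary.Any using (here; there)
  open import Data.Nat.Base as ℕ using (ℕ; suc; NonZero; _!)
  open import Data.Nat.DivMod using (_/_; _%_; _mod_; m≡m%n+[m/n]*n; m%n<n; m<n⇒m%n≡m; m<n*o⇒m/o<n; m/n*n≤m; m*n/n≡m; /-monoˡ-≤)
  import Data.Nat.Properties as ℕ
  import Data.Nat.Tactic.RingSolver as ℕRing
  open import Data.Product.Base using (∃; _×_; _,_; proj₁; proj₂)
  open import Data.Rational.Base as ℚ using (ℚ; mkℚ; 0ℚ)
  import Data.Rational.Properties as ℚ
  import Data.Rational.Unnormalised.Base as ℚᵘ
  import Data.Rational.Unnormalised.Properties as ℚᵘ
  open import Data.Refinement.Base using (value; _,_)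
  open import Data.Vec.Base using (Vec)
  open import Data.Vec.Relation.Unary.AllPairs using (allPairs?)
  import Data.Vec.Relation.Unary.Unique.Propositional as Vec
  open import Function.Base using (_∘_)
  open import Relation.Binary.PropositionalEquality
  open import Relation.Nullary.Decidable using (¬?; recompute)

  Σᴸ-member : {A : Set} {f : A → ℤ} → (∀ x → 0ℤ ≤ f x) → ∀ {x xs} → x ∈ xs → f x ≤ Σᴸ f xs
  Σᴸ-member {f = f} f≥0 {xs = y ∷ ys} (here refl) = subst (_≤ f y + Σᴸ f ys) (ℤ.+-identityʳ (f y))
    (ℤ.+-monoʳ-≤ (f y) (ℤ.≤-trans (ℤ.≤-reflexive (sym (trans (Σᴸ-const 0ℤ ys) (ℤ.*-zeroʳ (+ length ys))))) (Σᴸ-mono ys (λ {z} _ → f≥0 z))))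
  Σᴸ-member {f = f} f≥0 {xs = y ∷ ys} (there x∈) = ℤ.≤-trans (Σᴸ-member f≥0 x∈)
    (subst (_≤ f y + Σᴸ f ys) (ℤ.+-identityˡ (Σᴸ f ys)) (ℤ.+-monoˡ-≤ (Σᴸ f ys) (f≥0 y)))

  -- This takes the place of a tail bound: a deviation `y` is paid for by its square, whose mean is
  -- the variance, and `u` balances the two terms.
  2uy≤y²+u² : ∀ u y → + 2 * u * y ≤ y * y + u * u
  2uy≤y²+u² u y = subst₂ _≤_ (ℤ.+-identityˡ _) (lem u y) (ℤ.+-monoˡ-≤ (+ 2 * u * y) (square-≥0 (y - u)))
    where
    lem : ∀ u y → (y - u) * (y - u) + + 2 * u * y ≡ y * y + u * u
    lem = solve-∀

  -- For any rule τ, the number of clusters at time τ exceeds the one at the last earlier multiple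
  -- of h by at most h, and the latter is concentrated around its mean.
  module _ (G : Graph) .{{_ : NonZero (Graph.order G)}}
           (lipschitz : ∀ {m} (le : m ℕ.≤ Graph.order G) → Lipschitz (Graph.order G) 14 [] (λ w → + clustersOf G le w))
           (step : ∀ a k (le : a ℕ.+ k ℕ.≤ Graph.order G) (le′ : a ℕ.≤ Graph.order G) w → Vec.Unique w →
                   clustersOf G le w ℕ.≤ k ℕ.+ clustersOf G le′ w)
           (Tb : ℕ) (best : ∀ t → total G (λ _ → t) ℕ.≤ Tb)
           (h J : ℕ) .{{_ : NonZero h}} (covers : Graph.order G ℕ.≤ J ℕ.* h) where

    open Graph G using () renaming (order to N)

    private
      F : ℤ
      F = + (N !)

      checkpoint : ℕ → Fin N
      -- For j h < N this is the time index j h; the reduction only gives a value to those `j` that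
      -- run past the end.
      checkpoint j = (j ℕ.* h) mod N

      count : ℕ → Vec (Fin N) N → ℤ
      count j w = + clustersOf G (Fin.toℕ<n (checkpoint j)) w

      mean : ℕ → ℤ
      mean j = + total G (λ _ → checkpoint j)

      deviation : ℕ → Vec (Fin N) N → ℤ
      deviation j w = F * count j w - mean j

      -- 196 is the square of the Lipschitz constant 14. As `mean` is the exact sum over all
      -- orderings, the cross terms collapse to the expression bounded by `variance-bound`.
      Σ-deviation : ∀ j → Σ-orderings N N [] (λ w → deviation j w * deviation j w) ≤ F * (+ (N ℕ.* 196) * (F * F))
      Σ-deviation j = begin
        Σ-orderings N N [] (λ w → deviation j w * deviation j w)
          ≡⟨ Σ-orderings-cong N N [] (λ w _ → expand F (count j w) μ) ⟩
        Σ-orderings N N [] (λ w → F * F * (count j w * count j w) + (ℤ.- (+ 2 * F * μ) * count j w + μ * μ))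
          ≡⟨ Σ-orderings-+ N N [] _ _ ⟩
        Σ-orderings N N [] (λ w → F * F * (count j w * count j w)) + Σ-orderings N N [] (λ w → ℤ.- (+ 2 * F * μ) * count j w + μ * μ)
          ≡⟨ cong₂ _+_ (Σ-orderings-* N N [] (F * F) _) (trans (Σ-orderings-+ N N [] _ _)
               (cong₂ _+_ (Σ-orderings-* N N [] (ℤ.- (+ 2 * F * μ)) _) (Σ-orderings-const N N [] (μ * μ) []ᵖ refl))) ⟩
        F * F * Q + (ℤ.- (+ 2 * F * μ) * S + F * (μ * μ))
          ≡⟨ cong (λ x → F * F * Q + (ℤ.- (+ 2 * F * x) * S + F * (x * x))) (total-constant G (checkpoint j)) ⟩
        F * F * Q + (ℤ.- (+ 2 * F * S) * S + F * (S * S))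
          ≡⟨ collect F Q S ⟩
        F * (F * Q - S * S)
          ≤⟨ *-monoʳ-≤ (N !) (variance-bound N 14 N [] (count j) []ᵖ refl (lipschitz (Fin.toℕ<n (checkpoint j)))) ⟩
        F * (+ (N ℕ.* 196) * (F * F)) ∎
        where
        open ℤ.≤-Reasoning
        μ = mean j
        Q = Σ-orderings N N [] (λ w → count j w * count j w)
        S = Σ-orderings N N [] (count j)
        expand : ∀ f c m → (f * c - m) * (f * c - m) ≡ f * f * (c * c) + (ℤ.- (+ 2 * f * m) * c + m * m)
        expand = solve-∀
        collect : ∀ f q s → f * f * q + (ℤ.- (+ 2 * f * s) * s + f * (s * s)) ≡ f * (f * q - s * s)
        collect = solve-∀

      clusters-shift : ∀ {m m′} a k (le : m ℕ.≤ N) (le′ : m′ ℕ.≤ N) w → Vec.Unique w → m ≡ a ℕ.+ k → m′ ≡ a →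
                       clustersOf G le w ℕ.≤ k ℕ.+ clustersOf G le′ w
      clusters-shift a k le le′ w w! refl refl = step a k le le′ w w!

      unique : (σ : 𝒮 G) → Vec.Unique (value σ)
      unique (w , [ w! ]) = recompute (allPairs? (λ u v → ¬? (u Fin.≟ v)) w) w!

      near-checkpoint : ∀ t σ → ∃ λ j → j ℕ.< J × + C̃ G t σ ≤ + h + count j (value σ)
      near-checkpoint t σ = j , m<n*o⇒m/o<n (ℕ.≤-trans (Fin.toℕ<n t) covers) ,
        ℤ.+≤+ (ℕ.≤-trans (clusters-shift (suc (j ℕ.* h)) (i % h) (Fin.toℕ<n t) (Fin.toℕ<n (checkpoint j)) (value σ) (unique σ)
                 (cong suc (trans (m≡m%n+[m/n]*n i h) (ℕ.+-comm (i % h) (j ℕ.* h)))) (cong suc at))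
               (ℕ.+-monoˡ-≤ (clustersOf G (Fin.toℕ<n (checkpoint j)) (value σ)) (ℕ.<⇒≤ (m%n<n i h))))
        where
        i j : ℕ
        i = toℕ t
        j = i / h
        at : toℕ (checkpoint j) ≡ j ℕ.* h
        at = trans (Fin.toℕ-fromℕ< _) (m<n⇒m%n≡m (ℕ.≤-<-trans (m/n*n≤m i h) (Fin.toℕ<n t)))

      -- With this choice u² / (2u) is N! h / 2, of the same size as the loss N! h between
      -- checkpoints.
      u : ℤ
      u = F * + h

      excess : (𝒮 G → Time G) → 𝒮 G → ℤ
      excess τ σ = + 2 * u * (F * + C̃ G (τ σ) σ - (F * + h + + Tb))

      deviations : Vec (Fin N) N → ℤ
      deviations w = Σᴸ (λ j → deviation j w * deviation j w) (upTo J) + u * u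

      -- The checkpoint used depends on `σ`. Its squared deviation is therefore bounded by the sum
      -- over all `J` checkpoints, which plays the part of a union bound.
      excess-≤ : ∀ τ σ → excess τ σ ≤ deviations (value σ)
      excess-≤ τ σ with near-checkpoint (τ σ) σ
      ... | j , j<J , close = begin
        + 2 * u * (F * + C̃ G (τ σ) σ - (F * + h + + Tb))
          ≡⟨ cong (λ x → + 2 * x * (F * + C̃ G (τ σ) σ - (F * + h + + Tb))) (sym (ℤ.pos-* (N !) h)) ⟩
        + 2 * + (N ! ℕ.* h) * (F * + C̃ G (τ σ) σ - (F * + h + + Tb))
          ≡⟨ cong (λ x → x * (F * + C̃ G (τ σ) σ - (F * + h + + Tb))) (sym (ℤ.pos-* 2 (N ! ℕ.* h))) ⟩
        + (2 ℕ.* (N ! ℕ.* h)) * (F * + C̃ G (τ σ) σ - (F * + h + + Tb))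
          ≤⟨ *-monoʳ-≤ (2 ℕ.* (N ! ℕ.* h)) bound ⟩
        + (2 ℕ.* (N ! ℕ.* h)) * y
          ≡⟨ cong (_* y) (trans (ℤ.pos-* 2 (N ! ℕ.* h)) (cong (+ 2 *_) (ℤ.pos-* (N !) h))) ⟩
        + 2 * u * y
          ≤⟨ 2uy≤y²+u² u y ⟩
        y * y + u * u
          ≤⟨ ℤ.+-monoˡ-≤ (u * u) (Σᴸ-member (λ j → square-≥0 (deviation j (value σ))) (∈-upTo⁺ j<J)) ⟩
        deviations (value σ) ∎
        where
        open ℤ.≤-Reasoning
        y = deviation j (value σ)
        bound : F * + C̃ G (τ σ) σ - (F * + h + + Tb) ≤ y
        bound = ℤ.≤-trans (ℤ.+-mono-≤ (*-monoʳ-≤ (N !) close) (ℤ.neg-mono-≤ (ℤ.+-monoʳ-≤ (F * + h) (ℤ.+≤+ (best (checkpoint j))))))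
          (ℤ.≤-reflexive (lem F (+ h) (count j (value σ)) (mean j)))
          where
          lem : ∀ f h c m → f * (h + c) - (f * h + m) ≡ f * c - m
          lem = solve-∀

      Σ-excess : ∀ τ → Σᴸ (excess τ) (permutations G) ≡ + 2 * u * (F * + total G τ - F * (F * + h + + Tb))
      Σ-excess τ = trans (Σᴸ-* (+ 2 * u) _ (permutations G)) (cong (+ 2 * u *_) (trans (Σᴸ-+ _ _ (permutations G))
        (cong₂ _+_ (trans (Σᴸ-* F _ (permutations G)) (cong (F *_) (sym (+sum G (λ σ → C̃ G (τ σ) σ) (permutations G)))))
          (trans (Σᴸ-const c (permutations G)) (trans (cong (_* c) number) (sym (ℤ.neg-distribʳ-* F (F * + h + + Tb))))))))
        where
        c = ℤ.- (F * + h + + Tb)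
        number : + length (permutations G) ≡ F
        number = trans (sym (trans (Σᴸ-const 1ℤ (permutations G)) (ℤ.*-identityʳ _)))
          (trans (Σ-permutations G (λ _ → 1ℤ)) (trans (Σ-orderings-const N N [] 1ℤ []ᵖ refl) (ℤ.*-identityʳ F)))

      Σ-deviations : Σᴸ (deviations ∘ value) (permutations G) ≤ + J * (F * (+ (N ℕ.* 196) * (F * F))) + F * (u * u)
      Σ-deviations = begin
        Σᴸ (deviations ∘ value) (permutations G)
          ≡⟨ trans (Σ-permutations G deviations) (Σ-orderings-+ N N [] _ _) ⟩
        Σ-orderings N N [] (λ w → Σᴸ (λ j → deviation j w * deviation j w) (upTo J)) + Σ-orderings N N [] (λ _ → u * u)
          ≡⟨ cong₂ _+_ (Σ-orderings-Σᴸ N N [] (λ j w → deviation j w * deviation j w) (upTo J)) (Σ-orderings-const N N [] (u * u) []ᵖ refl) ⟩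
        Σᴸ (λ j → Σ-orderings N N [] (λ w → deviation j w * deviation j w)) (upTo J) + F * (u * u)
          ≤⟨ ℤ.+-monoˡ-≤ (F * (u * u)) (Σᴸ-mono (upTo J) (λ {j} _ → Σ-deviation j)) ⟩
        Σᴸ (λ _ → F * (+ (N ℕ.* 196) * (F * F))) (upTo J) + F * (u * u)
          ≡⟨ cong (_+ F * (u * u)) (trans (Σᴸ-const _ (upTo J)) (cong (λ l → + l * (F * (+ (N ℕ.* 196) * (F * F)))) (length-upTo J))) ⟩
        + J * (F * (+ (N ℕ.* 196) * (F * F))) + F * (u * u) ∎
        where
        open ℤ.≤-Reasoning

      positive-! : ℤ.Positive F
      positive-! = ℤ.positive (ℤ.+<+ (ℕ.>-nonZero⁻¹ (N !) {{N ℕ.!≢0}}))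

    -- In terms of expectations: the gain over Tb / N! is at most 3h / 2 + 98 J N / h.
    any-rule : ∀ τ → + 2 * + h * (+ total G τ - (F * + h + + Tb)) ≤ F * (+ J * + (N ℕ.* 196) + + h * + h)
    any-rule τ = ℤ.*-cancelˡ-≤-pos _ _ F {{positive-!}} (ℤ.*-cancelˡ-≤-pos _ _ F {{positive-!}} (begin
      F * (F * (+ 2 * + h * (+ total G τ - (F * + h + + Tb))))
        ≡⟨ left F (+ h) (+ total G τ) (F * + h + + Tb) ⟩
      + 2 * u * (F * + total G τ - F * (F * + h + + Tb))
        ≡⟨ Σ-excess τ ⟨
      Σᴸ (excess τ) (permutations G)
        ≤⟨ Σᴸ-mono (permutations G) (λ {σ} _ → excess-≤ τ σ) ⟩
      Σᴸ (deviations ∘ value) (permutations G)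
        ≤⟨ Σ-deviations ⟩
      + J * (F * (+ (N ℕ.* 196) * (F * F))) + F * (u * u)
        ≡⟨ right-side F (+ J) (+ (N ℕ.* 196)) (+ h) ⟩
      F * (F * (F * (+ J * + (N ℕ.* 196) + + h * + h))) ∎))
      where
      open ℤ.≤-Reasoning
      left : ∀ f h t c → f * (f * (+ 2 * h * (t - c))) ≡ + 2 * (f * h) * (f * t - f * c)
      left = solve-∀
      right-side : ∀ f j v h → j * (f * (v * (f * f))) + f * (f * h * (f * h)) ≡ f * (f * (f * (j * v + h * h)))
      right-side = solve-∀

    -- The two conditions give 3h / 2 ≤ 3N / (8D) and 98 J N / h ≤ N / (2D), whose sum is below N /
    -- D.
    rule-≤ : ∀ D τ → 4 ℕ.* D ℕ.* h ℕ.≤ N → 196 ℕ.* D ℕ.* J ℕ.≤ h → total G τ ℕ.* D ℕ.≤ Tb ℕ.* D ℕ.+ N ℕ.* N !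
    rule-≤ D τ 4Dh≤N small = ℤ.drop‿+≤+ (subst₂ _≤_ (sym (ℤ.pos-* Tf D))
      (sym (trans (ℤ.pos-+ (Tb ℕ.* D) (N ℕ.* N !)) (cong₂ _+_ (ℤ.pos-* Tb D) (ℤ.pos-* N (N !)))))
      (ℤ.*-cancelˡ-≤-pos _ _ (+ 2 * + h) {{subst ℤ.Positive (ℤ.pos-* 2 h) (ℤ.positive (ℤ.+<+ (ℕ.*-mono-≤ (ℕ.s≤s (ℕ.z≤n {1})) (ℕ.>-nonZero⁻¹ h))))}} (begin
        + 2 * + h * (+ Tf * + D)
          ≡⟨ step₁ (+ h) (+ Tf) (+ D) (F * + h) (+ Tb) ⟩
        + D * (+ 2 * + h * (+ Tf - (F * + h + + Tb))) + + 2 * + h * + D * (F * + h + + Tb)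
          ≤⟨ ℤ.+-monoˡ-≤ _ (*-monoʳ-≤ D (any-rule τ)) ⟩
        + D * (F * (+ J * + (N ℕ.* 196) + + h * + h)) + + 2 * + h * + D * (F * + h + + Tb)
          ≡⟨ step₂ (+ D) F (+ J) (+ (N ℕ.* 196)) (+ h) (+ Tb) ⟩
        F * (+ D * (+ J * + (N ℕ.* 196)) + + 3 * (+ D * (+ h * + h))) + + 2 * + h * (+ Tb * + D)
          ≤⟨ ℤ.+-monoˡ-≤ _ (*-monoʳ-≤ (N !) (subst₂ _≤_ cast₁ cast₂ (ℤ.+≤+ sizes))) ⟩
        F * (+ 2 * (+ h * + N)) + + 2 * + h * (+ Tb * + D)
          ≡⟨ step₃ F (+ h) (+ N) (+ Tb * + D) ⟩
        + 2 * + h * (+ Tb * + D + + N * F) ∎)))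
      where
      open ℤ.≤-Reasoning
      Tf = total G τ
      step₁ : ∀ h t d x b → + 2 * h * (t * d) ≡ d * (+ 2 * h * (t - (x + b))) + + 2 * h * d * (x + b)
      step₁ = solve-∀
      step₂ : ∀ d f j v h b → d * (f * (j * v + h * h)) + + 2 * h * d * (f * h + b) ≡
              f * (d * (j * v) + + 3 * (d * (h * h))) + + 2 * h * (b * d)
      step₂ = solve-∀
      step₃ : ∀ f h n c → f * (+ 2 * (h * n)) + + 2 * h * c ≡ + 2 * h * (c + n * f)
      step₃ = solve-∀
      cast₁ : + (D ℕ.* (J ℕ.* (N ℕ.* 196)) ℕ.+ 3 ℕ.* (D ℕ.* (h ℕ.* h))) ≡ + D * (+ J * + (N ℕ.* 196)) + + 3 * (+ D * (+ h * + h))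
      cast₁ = trans (ℤ.pos-+ (D ℕ.* (J ℕ.* (N ℕ.* 196))) (3 ℕ.* (D ℕ.* (h ℕ.* h)))) (cong₂ _+_
        (trans (ℤ.pos-* D (J ℕ.* (N ℕ.* 196))) (cong (+ D *_) (ℤ.pos-* J (N ℕ.* 196))))
        (trans (ℤ.pos-* 3 (D ℕ.* (h ℕ.* h))) (cong (+ 3 *_) (trans (ℤ.pos-* D (h ℕ.* h)) (cong (+ D *_) (ℤ.pos-* h h))))))
      cast₂ : + (2 ℕ.* (h ℕ.* N)) ≡ + 2 * (+ h * + N)
      cast₂ = trans (ℤ.pos-* 2 (h ℕ.* N)) (cong (+ 2 *_) (ℤ.pos-* h N))
      sizes : D ℕ.* (J ℕ.* (N ℕ.* 196)) ℕ.+ 3 ℕ.* (D ℕ.* (h ℕ.* h)) ℕ.≤ 2 ℕ.* (h ℕ.* N)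
      sizes = ≤.begin
        D ℕ.* (J ℕ.* (N ℕ.* 196)) ℕ.+ 3 ℕ.* (D ℕ.* (h ℕ.* h))   ≤.≡⟨ lem₁ D J N h ⟩
        196 ℕ.* D ℕ.* J ℕ.* N ℕ.+ 3 ℕ.* D ℕ.* h ℕ.* h           ≤.≤⟨ ℕ.+-mono-≤ (ℕ.*-monoˡ-≤ N small) (ℕ.*-monoˡ-≤ h (ℕ.≤-trans (ℕ.*-monoˡ-≤ h (ℕ.m≤n+m (3 ℕ.* D) D)) 4Dh≤N)) ⟩
        h ℕ.* N ℕ.+ N ℕ.* h                                     ≤.≡⟨ lem₂ h N ⟩
        2 ℕ.* (h ℕ.* N) ≤.∎
        where
        module ≤ = ℕ.≤-Reasoning
        lem₁ : ∀ d j n h → d ℕ.* (j ℕ.* (n ℕ.* 196)) ℕ.+ 3 ℕ.* (d ℕ.* (h ℕ.* h)) ≡ 196 ℕ.* d ℕ.* j ℕ.* n ℕ.+ 3 ℕ.* d ℕ.* h ℕ.* h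
        lem₁ = ℕRing.solve-∀
        lem₂ : ∀ h n → h ℕ.* n ℕ.+ n ℕ.* h ≡ 2 ℕ.* (h ℕ.* n)
        lem₂ = ℕRing.solve-∀

  positive-fraction : ∀ ε → 0ℚ ℚ.< ε → ∃ λ e → ∃ λ d → ℚ.toℚᵘ ε ℚᵘ.≃ ℚᵘ.mkℚᵘ (+ suc e) d
  positive-fraction ε 0<ε = go ε (ℚ.positive 0<ε)
    where
    go : ∀ ε → ℚ.Positive ε → ∃ λ e → ∃ λ d → ℚ.toℚᵘ ε ℚᵘ.≃ ℚᵘ.mkℚᵘ (+ suc e) d
    go (mkℚ (+ suc e) d _) _ = e , d , ℚᵘ.≃-refl

  -- With h about N / (4D), proportional to N, the constant number 8D of checkpoints suffices, and
  -- the condition on 196 D J holds once N is large.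
  grid-spacing : ∀ D → .{{NonZero D}} → ∃ λ N₀ → ∀ N → N₀ ℕ.≤ N → ∃ λ h → ∃ λ J →
                 1 ℕ.≤ h × N ℕ.≤ J ℕ.* h × 4 ℕ.* D ℕ.* h ℕ.≤ N × 196 ℕ.* D ℕ.* J ℕ.≤ h
  grid-spacing D = suc H ℕ.* Q , λ N le →
    let h   = N / Q
        H<h = ℕ.≤-trans (ℕ.≤-reflexive (sym (m*n/n≡m (suc H) Q))) (/-monoˡ-≤ Q le)
        1≤h = ℕ.≤-trans (ℕ.s≤s ℕ.z≤n) H<h
    in h , 8 ℕ.* D , 1≤h , covers N 1≤h , ℕ.≤-trans (ℕ.≤-reflexive (ℕ.*-comm Q h)) (m/n*n≤m N Q) , ℕ.<⇒≤ H<h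
    where
    Q H : ℕ
    Q = 4 ℕ.* D
    H = 196 ℕ.* D ℕ.* (8 ℕ.* D)
    instance
      Q≢0 : NonZero Q
      Q≢0 = ℕ.m*n≢0 4 D
    covers : ∀ N → 1 ℕ.≤ N / Q → N ℕ.≤ 8 ℕ.* D ℕ.* (N / Q)
    covers N 1≤h = begin
      N                                  ≡⟨ m≡m%n+[m/n]*n N Q ⟩
      N % Q ℕ.+ N / Q ℕ.* Q              ≤⟨ ℕ.+-monoˡ-≤ (N / Q ℕ.* Q) (ℕ.≤-trans (ℕ.<⇒≤ (m%n<n N Q)) (ℕ.m≤n*m Q (N / Q) {{ℕ.>-nonZero 1≤h}})) ⟩
      N / Q ℕ.* Q ℕ.+ N / Q ℕ.* Q        ≡⟨ lem (N / Q) D ⟩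
      8 ℕ.* D ℕ.* (N / Q)                ∎
      where
      open ℕ.≤-Reasoning
      lem : ∀ h d → h ℕ.* (4 ℕ.* d) ℕ.+ h ℕ.* (4 ℕ.* d) ≡ 8 ℕ.* d ℕ.* h
      lem = ℕRing.solve-∀

  module _ {L d b U P} (F : Family L d b U P) where
    open Family F

    full-information-total : ∀ D → .{{NonZero D}} → ForLargeN L (λ G → ∀ τᵇ τᶠ → IsOptimal G (blind G) τᵇ →
      total G τᶠ ℕ.* D ℕ.≤ total G τᵇ ℕ.* D ℕ.+ Graph.order G ℕ.* Graph.order G !)
    full-information-total D = least ℕ.+ proj₁ (grid-spacing D) , λ n N₀≤ τᵇ τᶠ opt →
      let G = lattice L n
          A = model n (ℕ.≤-trans (ℕ.m≤m+n least _) N₀≤)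
          h , J , 1≤h , covers , 4Dh≤N , small = proj₂ (grid-spacing D) (Graph.order G) (ℕ.≤-trans (ℕ.m≤n+m _ least) N₀≤)
      in rule-≤ G (Analysed.lipschitz A) (Analysed.step A) (total G τᵇ) (optimal-≥ G {τᵇ} opt) h J {{ℕ.>-nonZero 1≤h}} covers D τᶠ 4Dh≤N small

    full-information : ∀ (ε : ℚ) → 0ℚ ℚ.< ε → ForLargeN L (λ G → ∀ τᵇ τᶠ →
      IsOptimal G (blind G) τᵇ → IsOptimal G (fullInformation G) τᶠ →
      perVertex G τᵇ ℚ.≤ perVertex G τᶠ × perVertex G τᶠ ℚ.≤ perVertex G τᵇ ℚ.+ ε)
    full-information ε 0<ε = let e , q , ε≃ = positive-fraction ε 0<ε in
      proj₁ (full-information-total (suc q)) , λ n N₀≤ τᵇ τᶠ optᵇ optᶠ →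
      perVertex-mono (lattice L n) τᵇ τᶠ (total-mono (lattice L n) {τᶠ} {τᵇ} (proj₂ optᶠ τᵇ (blind-full (lattice L n) (proj₁ optᵇ)))) ,
      perVertex-+ε (lattice L n) τᶠ τᵇ ε e q ε≃ (proj₂ (full-information-total (suc q)) n N₀≤ τᵇ τᶠ optᵇ)

-- The numerical instances and the theorem.

open import Defs
import Data.List.Relation.Unary.All as All
import Data.Nat.Base as ℕ
import Data.Nat.Properties as ℕ
import Data.Rational.Properties as ℚ
open import Data.Unit.Base using (tt)
open import Relation.Binary.PropositionalEquality using (refl)
open import Relation.Nullary.Decidable using (from-yes)
open import Data.Product.Base using (_,_)
open import Data.Integer.Base using (+_)
open import Data.Product.Base using (_×_)
open import Data.Rational.Base using (ℚ; 0ℚ; 1ℚ; _/_; _+_; _≤_; _<_)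
open Model
open Squares
open Triangles
open Hexagons
open Families
open Stopping
open Bounds
open Information

-- The upper polynomial has degree 7 and maximum about 0.1315. Interval arithmetic with K = 2000
-- adds about 2 / K times the slope of its positive terms, about 0.00115, which still fits below
-- 0.13268.
square-≤ : ForLargeN squareL (λ G → ∀ τᵇ → IsOptimal G (blind G) τᵇ → perVertex G τᵇ ≤ (+ 13268 / 100000))
square-≤ = blind-≤ squareFamily 13268 100000 2000 7
  (from-yes (All.all? (λ (_ , a) → a ℕ.≤? 7) (profile squareUpper))) refl tt

triangular-≤ : ForLargeN triangularL (λ G → ∀ τᵇ → IsOptimal G (blind G) τᵇ → perVertex G τᵇ ≤ (+ 10107 / 100000))
triangular-≤ = blind-≤ triangularFamily 10107 100000 2000 6
  (from-yes (All.all? (λ (_ , a) → a ℕ.≤? 6) (profile triangularUpper))) refl tt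

-- The polynomial reaches about 0.1706 per vertex. This leaves a gap of less than 0.0009, too small
-- for the intervals used on the other two lattices, hence K = 3000.
hexagonal-≤ : ForLargeN hexagonalL (λ G → ∀ τᵇ → IsOptimal G (blind G) τᵇ → perVertex G τᵇ ≤ (+ 17144 / 100000))
hexagonal-≤ = blind-≤ hexagonalFamily 17144 100000 3000 6
  (from-yes (All.all? (λ (_ , a) → a ℕ.≤? 6) (profile hexagonalUpper))) refl tt

-- The witnesses for the lower bounds are the densities 0.2698, 0.2119 and 0.33775.
square-≥ : ForLargeN squareL (λ G → ∀ τᵇ → IsOptimal G (blind G) τᵇ → (+ 12953000 / 100000000) ≤ perVertex G τᵇ)
square-≥ = blind-≥ squareFamily 12953000 100000000 100000000 26980000
  (from-yes (All.all? (λ (_ , a) → a ℕ.≤? 13) (negate (profile squareLower)))) (from-yes (26980000 ℕ.+ 14 ℕ.≤? 100000000)) refl tt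

triangular-≥ : ForLargeN triangularL (λ G → ∀ τᵇ → IsOptimal G (blind G) τᵇ → (+ 9629000 / 100000000) ≤ perVertex G τᵇ)
triangular-≥ = blind-≥ triangularFamily 9629000 100000000 100000000 21190000
  (from-yes (All.all? (λ (_ , a) → a ℕ.≤? 13) (negate (profile triangularLower)))) (from-yes (21190000 ℕ.+ 14 ℕ.≤? 100000000)) refl tt

hexagonal-≥ : ForLargeN hexagonalL (λ G → ∀ τᵇ → IsOptimal G (blind G) τᵇ → (+ 16738000 / 100000000) ≤ perVertex G τᵇ)
hexagonal-≥ = blind-≥ hexagonalFamily 16738000 100000000 100000000 33775000
  (from-yes (All.all? (λ (_ , a) → a ℕ.≤? 13) (negate (profile hexagonalLower)))) (from-yes (33775000 ℕ.+ 14 ℕ.≤? 100000000)) refl tt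

-- The lower bounds are proved with denominator 10^8, because the unit that `lower-estimate` sets
-- aside must be smaller than their slack, which is below 10^-5 and for hexagons below 10^-6. The
-- parameter a ≤ a′ returns to the denominator 10^5.
two-sided : ∀ {L} (a a′ b : ℚ) → a ≤ a′ →
  ForLargeN L (λ G → ∀ τᵇ → IsOptimal G (blind G) τᵇ → a′ ≤ perVertex G τᵇ) →
  ForLargeN L (λ G → ∀ τᵇ → IsOptimal G (blind G) τᵇ → perVertex G τᵇ ≤ b) →
  ForLargeN L (λ G → ∀ τᵇ → IsOptimal G (blind G) τᵇ → a ≤ perVertex G τᵇ × perVertex G τᵇ ≤ b)
two-sided a a′ b a≤a′ (N₁ , lower) (N₂ , upper) = N₁ ℕ.+ N₂ , λ n N₀≤ τᵇ opt →
  ℚ.≤-trans a≤a′ (lower n (ℕ.≤-trans (ℕ.m≤m+n N₁ N₂) N₀≤) τᵇ opt) , upper n (ℕ.≤-trans (ℕ.m≤n+m N₂ N₁) N₀≤) τᵇ opt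

corollary5 : ForLargeN squareL (λ G → ∀ τᵇ → IsOptimal G (blind G) τᵇ →
    (+ 12953 / 100000) ≤ perVertex G τᵇ × perVertex G τᵇ ≤ (+ 13268 / 100000))
    × ForLargeN triangularL (λ G → ∀ τᵇ → IsOptimal G (blind G) τᵇ →
    (+ 9629 / 100000) ≤ perVertex G τᵇ × perVertex G τᵇ ≤ (+ 10107 / 100000))
    × ForLargeN hexagonalL (λ G → ∀ τᵇ → IsOptimal G (blind G) τᵇ →
    (+ 16738 / 100000) ≤ perVertex G τᵇ × perVertex G τᵇ ≤ (+ 17144 / 100000))
    × (∀ L (ε : ℚ) → 0ℚ < ε → ε < 1ℚ →
    ForLargeN L (λ G → ∀ τᵇ τᶠ →
    IsOptimal G (blind G) τᵇ → IsOptimal G (fullInformation G) τᶠ →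
    perVertex G τᵇ ≤ perVertex G τᶠ × perVertex G τᶠ ≤ perVertex G τᵇ + ε))
corollary5 =
  two-sided {squareL} (+ 12953 / 100000) (+ 12953000 / 100000000) (+ 13268 / 100000) (/-≤⁺ 12953 100000 12953000 100000000 ℕ.≤-refl) square-≥ square-≤ ,
  two-sided {triangularL} (+ 9629 / 100000) (+ 9629000 / 100000000) (+ 10107 / 100000) (/-≤⁺ 9629 100000 9629000 100000000 ℕ.≤-refl) triangular-≥ triangular-≤ ,
  two-sided {hexagonalL} (+ 16738 / 100000) (+ 16738000 / 100000000) (+ 17144 / 100000) (/-≤⁺ 16738 100000 16738000 100000000 ℕ.≤-refl) hexagonal-≥ hexagonal-≤ ,
  λ where
    squareL     ε 0<ε _ → full-information squareFamily ε 0<ε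
    triangularL ε 0<ε _ → full-information triangularFamily ε 0<ε
    hexagonalL  ε 0<ε _ → full-information hexagonalFamily ε 0<ε
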